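{- For a positive integer $n$, let $\mathcal{P}(n)$ denote the power set of $[n]=\{1,\dots,n\}$, and let $\alpha(n)$ be the number of union-free families $\mathcal{F}\subseteq \mathcal{P}(n)$. Then $$\alpha(n)=2^{\binom{n}{\lfloor n/2\rfloor}(1+o(1))}\qquad (n\to\infty).$$
   Context: A family $\mathcal{F}\subseteq\mathcal{P}(n)$ is union-free if there are no three distinct sets $A,B,C\in\mathcal{F}$ with $A\cup B=C$. -}

module Defs where

open import Data.Nat using (ℕ; zero; suc)
open import Data.Bool using (Bool; true; false)
import Data.Bool.Properties as BoolP
open import Data.Fin using (Fin)
open import Data.Fin.Subset using (Subset; _∈_; _∪_; inside; outside)
open import Data.Fin.Subset.Properties using (_∈?_)
open import Data.Fin.Properties using (all?)
open import Data.List using (List; []; _∷_; _++_; map; length; lookup; filter)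
open import Data.Vec using (Vec)
import Data.Vec as Vec
open import Data.Vec.Properties using (≡-dec)
open import Relation.Binary.PropositionalEquality using (_≡_; _≢_)
open import Relation.Nullary using (Dec; ¬?)
open import Relation.Nullary.Decidable using (_→-dec_)

allVecs : (m : ℕ) → List (Vec Bool m)
allVecs zero    = Vec.[] ∷ []
allVecs (suc m) = map (outside Vec.∷_) (allVecs m) ++ map (inside Vec.∷_) (allVecs m)

powerSet : (n : ℕ) → List (Subset n)
powerSet n = allVecs n

PIdx : ℕ → Set
PIdx n = Fin (length (powerSet n))

setAt : (n : ℕ) → PIdx n → Subset n
setAt n i = lookup (powerSet n) i

-- A family F ⊆ P(n), given by its characteristic vector over the enumeration.
Family : ℕ → Set
Family n = Subset (length (powerSet n))

UnionFree : ∀ {n} → Family n → Set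
UnionFree {n} F =
  (i j k : PIdx n) → i ∈ F → j ∈ F → k ∈ F →
  S i ≢ S j → S j ≢ S k → S i ≢ S k →
  (S i ∪ S j) ≢ S k
  where
  S = setAt n

private
  _≟ˢ_ : ∀ {n} (A B : Subset n) → Dec (A ≡ B)
  _≟ˢ_ = ≡-dec BoolP._≟_

unionFree? : ∀ {n} (F : Family n) → Dec (UnionFree F)
unionFree? {n} F =
  all? λ i → all? λ j → all? λ k →
    (i ∈? F) →-dec (j ∈? F) →-dec (k ∈? F) →-dec
    ¬? (S i ≟ˢ S j) →-dec ¬? (S j ≟ˢ S k) →-dec ¬? (S i ≟ˢ S k) →-dec
    ¬? ((S i ∪ S j) ≟ˢ S k)
  where
  S = setAt n

α : ℕ → ℕ
α n = length (filter (unionFree? {n}) (allVecs (length (powerSet n))))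

{-# OPTIONS --safe #-}
module Submission where

-- Lower bound: every subfamily of the middle layer is union-free.
--
-- Upper bound, by containers. Suppose a family U of sets contains some Z together with d sets A, each of
-- which has d partners B in U with A ∪ B = Z. A union-free subfamily of U omits Z, or contains one of the A
-- and omits all its partners, or omits all the A. For t of order √n and d of order t log t this branching
-- multiplies the count by at most (1 + 1/t)^(2^n) = 2^o(C(n, n/2)), and it stops at families U in which no
-- such Z is left. Such a U has at most (1 + o(1)) C(n, n/2) members: it suffices that a random maximal chain
-- through a member Z rarely meets another member below Z. Discard the O(d) sets with d partners or with
-- ∣Z ∖ A∣ = 1, cut a random ordering of Z into b blocks, and let each block define a chain of initial
-- segments removed from Z. If two blocks both meet U, they meet it in A and B with A ∪ B = Z, which is
-- unlikely; since all blocks are equivalent, each meets U with probability about 1/b (cf. Erdős–Ko–Rado).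
-- Sets far from the middle are few by Chebyshev's inequality.

open import Defs
open import Data.Nat using (ℕ; zero; suc; pred; _+_; _*_; _∸_; _^_; _/_; _%_; _!; _≤_; _<_; z≤n; s≤s; s≤s⁻¹; _≤?_; _<?_; NonZero; >-nonZero) renaming (∣_-_∣ to dist)
open import Data.Nat.Combinatorics using (_C_; nCk≡n!/k![n-k]!; k![n∸k]!∣n!; k>n⇒nCk≡0; nCk+nC[k+1]≡[n+1]C[k+1])
open import Data.Nat.DivMod using (m*n/n≡m; /-monoˡ-≤; m/n*n≡m; m/n*n≤m; m≡m%n+[m/n]*n; m%n<n)
open import Data.Nat.Properties
open import Data.Nat.Tactic.RingSolver using (solve-∀)
open import Algebra.Properties.Semiring.Sum +-*-semiring using (sum; sum-cong-≗; ∑-distrib-+; ∑-comm; *-distribˡ-sum)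
open import Data.Bool using (true; false)
import Data.Bool.Properties as Bool
open import Data.Empty using (⊥-elim)
open import Data.Fin using (Fin; zero; suc; toℕ; fromℕ<)
import Data.Fin.Properties as Fin
open import Data.Fin.Properties using (any?)
open import Data.Fin.Subset using (Subset; _∈_; _∉_; _⊆_; _∪_; _─_; _-_; ∣_∣; ⁅_⁆; ⊤; ∁; inside; outside) renaming (⊥ to ∅)
open import Data.Fin.Subset.Properties
open import Data.List using (List; []; _∷_; _++_; _∷ʳ_; length; take; drop; map; filter; lookup)
open import Data.List.Membership.Propositional using () renaming (_∈_ to _∈ˡ_)
open import Data.List.Membership.Propositional.Properties using (∈-++⁺ˡ; ∈-++⁺ʳ; ∈-map⁺; ∈-map⁻; ∈-lookup)
open import Data.List.Properties using (drop-drop; length-++; length-map; filter-++)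
open import Data.List.Relation.Binary.Disjoint.Propositional using (Disjoint)
open import Data.List.Relation.Unary.All as All using (All; []; _∷_)
open import Data.List.Relation.Unary.All.Properties using (take⁺; drop⁺)
open import Data.List.Relation.Unary.AllPairs using ([]; _∷_)
open import Data.List.Relation.Unary.Any using (here; index)
open import Data.List.Relation.Unary.Any.Properties using (lookup-index)
open import Data.List.Relation.Unary.Unique.Propositional using (Unique)
import Data.List.Relation.Unary.Unique.Propositional.Properties as Unique
open import Data.Product using (∃; _×_; _,_; proj₁; proj₂)
open import Data.Sum using (_⊎_; inj₁; inj₂)
open import Data.Vec using ([]; _∷_; here; there; tabulate)
open import Data.Vec.Properties using (≡-dec; ∷-injectiveʳ; lookup⇒[]=; []=⇒lookup; lookup∘tabulate)
open import Function using (_∘_; case_of_)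
open import Relation.Binary.PropositionalEquality
open import Relation.Nullary using (Dec; yes; no; does; ¬_; ¬?; contradiction)
open import Relation.Nullary.Decidable using (_×-dec_; _⊎-dec_; dec-true)
open import Relation.Unary using (Decidable)

-- Two demands on the parameters compete. The factor (1 + 1/t)^(2^n) is harmless only if 2^n / t is
-- small against C(n, n/2), which is itself of order 2^n / √n; hence t must be a large constant
-- multiple of √n. Thinness needs the window R to exceed 4 b² d. The window can be a constant
-- fraction of n, because Chebyshev then leaves only O(2^n / n) = o(C(n, n/2)) sets outside it, so d
-- of order √n log n fits. The sets that miss just one element of Z are discarded for the sake of
-- the pair estimate. The first block may meet its set A at any of R + 1 positions. A partner B
-- missing at least two elements of Z is met by the second block with probability O(1/R²), so fewer
-- than d partners over R + 1 positions contribute O(d/R). For a partner missing one element the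
-- probability is only bounded by O(1/R), and the sum over positions would cancel the gain. Few such
-- sets exist, since any two of them have union Z.

private
  variable
    n m : ℕ
    P Q : Set

-- Indicators and finite sums

ι : Dec P → ℕ
ι (yes _) = 1
ι (no _)  = 0

ι≤1 : (P? : Dec P) → ι P? ≤ 1
ι≤1 (yes _) = s≤s z≤n
ι≤1 (no _)  = z≤n

ι-mono : (P? : Dec P) (Q? : Dec Q) → (P → Q) → ι P? ≤ ι Q?
ι-mono (yes p) (yes _) f = s≤s z≤n
ι-mono (yes p) (no ¬q) f = contradiction (f p) ¬q
ι-mono (no _)  _       f = z≤n

ι-cong : (P? : Dec P) (Q? : Dec Q) → (P → Q) → (Q → P) → ι P? ≡ ι Q?
ι-cong P? Q? f g = ≤-antisym (ι-mono P? Q? f) (ι-mono Q? P? g)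

ι-yes : (P? : Dec P) → P → ι P? ≡ 1
ι-yes (yes _) p = refl
ι-yes (no ¬p) p = contradiction p ¬p

ι-no : (P? : Dec P) → ¬ P → ι P? ≡ 0
ι-no (yes p) ¬p = contradiction p ¬p
ι-no (no _)  ¬p = refl

ι-× : (P? : Dec P) (Q? : Dec Q) → ι (P? ×-dec Q?) ≡ ι P? * ι Q?
ι-× (yes p) (yes q) = refl
ι-× (yes p) (no ¬q) = refl
ι-× (no ¬p) Q?      = refl

ι*-mono : (P? : Dec P) {x y : ℕ} → (P → x ≤ y) → ι P? * x ≤ ι P? * y
ι*-mono (yes p) f = *-monoʳ-≤ 1 (f p)
ι*-mono (no _)  f = z≤n

ι*-cong : (P? : Dec P) {x y : ℕ} → (P → x ≡ y) → ι P? * x ≡ ι P? * y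
ι*-cong (yes p) f = cong (1 *_) (f p)
ι*-cong (no _)  f = refl

∑-mono : {f g : Fin n → ℕ} → (∀ i → f i ≤ g i) → sum f ≤ sum g
∑-mono {zero}  h = z≤n
∑-mono {suc n} h = +-mono-≤ (h zero) (∑-mono (h ∘ suc))

∑-*ʳ : (f : Fin n → ℕ) (c : ℕ) → sum (λ i → f i * c) ≡ sum f * c
∑-*ʳ f c = trans (sum-cong-≗ (λ i → *-comm (f i) c)) (trans (sym (*-distribˡ-sum c f)) (*-comm c (sum f)))

∑-term : (f : Fin n → ℕ) (i : Fin n) → f i ≤ sum f
∑-term f zero    = m≤m+n _ _
∑-term f (suc i) = ≤-trans (∑-term (f ∘ suc) i) (m≤n+m _ _)

∑ˢ : (Subset n → ℕ) → ℕ
∑ˢ {zero}  f = f []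
∑ˢ {suc n} f = ∑ˢ (f ∘ (outside ∷_)) + ∑ˢ (f ∘ (inside ∷_))

∑ˢ-mono : {f g : Subset n → ℕ} → (∀ A → f A ≤ g A) → ∑ˢ f ≤ ∑ˢ g
∑ˢ-mono {zero}  h = h []
∑ˢ-mono {suc n} h = +-mono-≤ (∑ˢ-mono (h ∘ (outside ∷_))) (∑ˢ-mono (h ∘ (inside ∷_)))

∑ˢ-cong : {f g : Subset n → ℕ} → (∀ A → f A ≡ g A) → ∑ˢ f ≡ ∑ˢ g
∑ˢ-cong {zero}  h = h []
∑ˢ-cong {suc n} h = cong₂ _+_ (∑ˢ-cong (h ∘ (outside ∷_))) (∑ˢ-cong (h ∘ (inside ∷_)))

∑ˢ-const : ∀ n c → ∑ˢ {n} (λ _ → c) ≡ 2 ^ n * c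
∑ˢ-const zero    c = sym (+-identityʳ c)
∑ˢ-const (suc n) c rewrite ∑ˢ-const n c = lemma (2 ^ n) c
  where
  lemma : ∀ p c → p * c + p * c ≡ (p + (p + 0)) * c
  lemma = solve-∀

∑ˢ-+ : (f g : Subset n → ℕ) → ∑ˢ (λ A → f A + g A) ≡ ∑ˢ f + ∑ˢ g
∑ˢ-+ {zero}  f g = refl
∑ˢ-+ {suc n} f g
  rewrite ∑ˢ-+ (f ∘ (outside ∷_)) (g ∘ (outside ∷_)) | ∑ˢ-+ (f ∘ (inside ∷_)) (g ∘ (inside ∷_))
  = lemma (∑ˢ (f ∘ (outside ∷_))) (∑ˢ (g ∘ (outside ∷_))) (∑ˢ (f ∘ (inside ∷_))) (∑ˢ (g ∘ (inside ∷_)))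
  where
  lemma : ∀ a b c d → a + b + (c + d) ≡ a + c + (b + d)
  lemma = solve-∀

∑ˢ-*ˡ : ∀ c (f : Subset n → ℕ) → c * ∑ˢ f ≡ ∑ˢ (λ A → c * f A)
∑ˢ-*ˡ {zero}  c f = refl
∑ˢ-*ˡ {suc n} c f = trans (*-distribˡ-+ c (∑ˢ (f ∘ (outside ∷_))) _) (cong₂ _+_ (∑ˢ-*ˡ c (f ∘ (outside ∷_))) (∑ˢ-*ˡ c (f ∘ (inside ∷_))))

∑ˢ-*ʳ : ∀ (f : Subset n → ℕ) c → ∑ˢ (λ A → f A * c) ≡ ∑ˢ f * c
∑ˢ-*ʳ f c = trans (∑ˢ-cong (λ A → *-comm (f A) c)) (trans (sym (∑ˢ-*ˡ c f)) (*-comm c (∑ˢ f)))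

∑ˢ-zero : {f : Subset n → ℕ} → (∀ A → f A ≡ 0) → ∑ˢ f ≡ 0
∑ˢ-zero {n} h = trans (∑ˢ-cong h) (trans (∑ˢ-const n 0) (*-zeroʳ (2 ^ n)))

∑-∑ˢ-comm : (f : Fin m → Subset n → ℕ) → sum (λ i → ∑ˢ (f i)) ≡ ∑ˢ (λ A → sum (λ i → f i A))
∑-∑ˢ-comm {m} {zero}  f = refl
∑-∑ˢ-comm {m} {suc n} f =
  trans (∑-distrib-+ (λ i → ∑ˢ (f i ∘ (outside ∷_))) _)
        (cong₂ _+_ (∑-∑ˢ-comm (λ i → f i ∘ (outside ∷_))) (∑-∑ˢ-comm (λ i → f i ∘ (inside ∷_))))

infix 4 _≟ˢ_
_≟ˢ_ : (A B : Subset n) → Dec (A ≡ B)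
_≟ˢ_ = ≡-dec Bool._≟_

∑ˢ-point : (f : Subset n → ℕ) (V : Subset n) → ∑ˢ (λ A → f A * ι (V ≟ˢ A)) ≡ f V
∑ˢ-point f [] = *-identityʳ (f [])
∑ˢ-point f (outside ∷ V) = trans
  (cong₂ _+_ (trans (∑ˢ-cong λ A → cong (f (outside ∷ A) *_) (ι-cong (outside ∷ V ≟ˢ outside ∷ A) (V ≟ˢ A) (λ { refl → refl }) (cong (outside ∷_))))
                    (∑ˢ-point (f ∘ (outside ∷_)) V))
             (∑ˢ-zero λ A → trans (cong (f (inside ∷ A) *_) (ι-no (outside ∷ V ≟ˢ inside ∷ A) λ ())) (*-zeroʳ (f (inside ∷ A)))))
  (+-identityʳ _)
∑ˢ-point f (inside ∷ V) =
  cong₂ _+_ (∑ˢ-zero λ A → trans (cong (f (outside ∷ A) *_) (ι-no (inside ∷ V ≟ˢ outside ∷ A) λ ())) (*-zeroʳ (f (outside ∷ A))))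
            (trans (∑ˢ-cong λ A → cong (f (inside ∷ A) *_) (ι-cong (inside ∷ V ≟ˢ inside ∷ A) (V ≟ˢ A) (λ { refl → refl }) (cong (inside ∷_))))
                   (∑ˢ-point (f ∘ (inside ∷_)) V))

-- Cardinalities of subsets

∣∣-sum : (V : Subset n) → sum (λ x → ι (x ∈? V)) ≡ ∣ V ∣
∣∣-sum []            = refl
∣∣-sum (outside ∷ V) = trans (sum-cong-≗ λ x → ι-cong (suc x ∈? outside ∷ V) (x ∈? V) drop-there there) (∣∣-sum V)
∣∣-sum (inside ∷ V)  = cong suc (trans (sum-cong-≗ λ x → ι-cong (suc x ∈? inside ∷ V) (x ∈? V) drop-there there) (∣∣-sum V))

∣─∣ : (V W : Subset n) → W ⊆ V → ∣ V ─ W ∣ + ∣ W ∣ ≡ ∣ V ∣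
∣─∣ [] [] W⊆V = refl
∣─∣ (v ∷ V) (inside ∷ W) W⊆V with W⊆V here
... | here = trans (+-suc _ _) (cong suc (∣─∣ V W (drop-∷-⊆ W⊆V)))
∣─∣ (outside ∷ V) (outside ∷ W) W⊆V = ∣─∣ V W (drop-∷-⊆ W⊆V)
∣─∣ (inside ∷ V)  (outside ∷ W) W⊆V = cong suc (∣─∣ V W (drop-∷-⊆ W⊆V))

∣V-x∣ : {V : Subset n} {x : Fin n} → x ∈ V → suc ∣ V - x ∣ ≡ ∣ V ∣
∣V-x∣ {V = V} {x} x∈V = trans (sym (trans (cong (∣ V - x ∣ +_) (∣⁅x⁆∣≡1 x)) (+-comm ∣ V - x ∣ 1)))
  (∣─∣ V ⁅ x ⁆ λ y∈ → subst (_∈ V) (sym (x∈⁅y⁆⇒x≡y x y∈)) x∈V)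

∉─ : {V W : Subset n} {y : Fin n} → y ∈ V ─ W → y ∉ W
∉─ {V = v ∷ V} {outside ∷ W} (there y∈) (there y∈W) = ∉─ y∈ y∈W
∉─ {V = v ∷ V} {inside ∷ W}  (there y∈) (there y∈W) = ∉─ y∈ y∈W

V-x⊆V : (V : Subset n) (x : Fin n) → V - x ⊆ V
V-x⊆V V x = p─q⊆p V ⁅ x ⁆

∉-x : {V : Subset n} {x y : Fin n} → y ∈ V - x → y ≢ x
∉-x {x = x} y∈ refl = ∉─ y∈ (x∈⁅x⁆ x)

-x-mono : {V W : Subset n} (x : Fin n) → V ⊆ W → V - x ⊆ W - x
-x-mono {V = V} x V⊆W y∈ = x∈p∧x≢y⇒x∈p-y (V⊆W (V-x⊆V V x y∈)) (∉-x y∈)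

⊆-card-≡ : {A B : Subset n} → A ⊆ B → ∣ B ∣ ≤ ∣ A ∣ → A ≡ B
⊆-card-≡ {A = []}          {[]}          A⊆B h = refl
⊆-card-≡ {A = outside ∷ A} {outside ∷ B} A⊆B h = cong (outside ∷_) (⊆-card-≡ (drop-∷-⊆ A⊆B) h)
⊆-card-≡ {A = outside ∷ A} {inside ∷ B}  A⊆B h = contradiction (≤-trans h (p⊆q⇒∣p∣≤∣q∣ (drop-∷-⊆ A⊆B))) (<-irrefl refl)
⊆-card-≡ {A = inside ∷ A}  {outside ∷ B} A⊆B h = contradiction (A⊆B here) λ ()
⊆-card-≡ {A = inside ∷ A}  {inside ∷ B}  A⊆B (s≤s h) = cong (inside ∷_) (⊆-card-≡ (drop-∷-⊆ A⊆B) h)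

∑∈ : Subset n → (Fin n → ℕ) → ℕ
∑∈ V f = sum λ x → ι (x ∈? V) * f x

∑∈-mono : (V : Subset n) {f g : Fin n → ℕ} → (∀ {x} → x ∈ V → f x ≤ g x) → ∑∈ V f ≤ ∑∈ V g
∑∈-mono V h = ∑-mono λ x → ι*-mono (x ∈? V) h

∑∈-cong : (V : Subset n) {f g : Fin n → ℕ} → (∀ {x} → x ∈ V → f x ≡ g x) → ∑∈ V f ≡ ∑∈ V g
∑∈-cong V h = sum-cong-≗ λ x → ι*-cong (x ∈? V) h

∑∈-+ : (V : Subset n) (f g : Fin n → ℕ) → ∑∈ V (λ x → f x + g x) ≡ ∑∈ V f + ∑∈ V g
∑∈-+ V f g = trans (sum-cong-≗ λ x → *-distribˡ-+ (ι (x ∈? V)) (f x) (g x))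
  (∑-distrib-+ (λ x → ι (x ∈? V) * f x) (λ x → ι (x ∈? V) * g x))

∑∈-*ˡ : (V : Subset n) (c : ℕ) (f : Fin n → ℕ) → ∑∈ V (λ x → c * f x) ≡ c * ∑∈ V f
∑∈-*ˡ V c f = trans (sum-cong-≗ λ x → lemma (ι (x ∈? V)) c (f x)) (sym (*-distribˡ-sum c (λ x → ι (x ∈? V) * f x)))
  where
  lemma : ∀ i c y → i * (c * y) ≡ c * (i * y)
  lemma = solve-∀

∑∈-const : (V : Subset n) (c : ℕ) → ∑∈ V (λ _ → c) ≡ ∣ V ∣ * c
∑∈-const V c = trans (∑-*ʳ (λ x → ι (x ∈? V)) c) (cong (_* c) (∣∣-sum V))

∑∈-∑ˢ : (V : Subset n) (f : Fin n → Subset m → ℕ) → ∑∈ V (λ x → ∑ˢ (f x)) ≡ ∑ˢ (λ A → ∑∈ V (λ x → f x A))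
∑∈-∑ˢ V f = trans (sum-cong-≗ λ x → ∑ˢ-*ˡ (ι (x ∈? V)) (f x)) (∑-∑ˢ-comm (λ x A → ι (x ∈? V) * f x A))

-- Both sides range over the ordered pairs of distinct elements of `V`.
∑∈-swap : (V : Subset n) (f : Fin n → Fin n → ℕ) →
  ∑∈ V (λ x → ∑∈ (V - x) (f x)) ≡ ∑∈ V (λ y → ∑∈ (V - y) (λ x → f x y))
∑∈-swap V f = begin
  ∑∈ V (λ x → ∑∈ (V - x) (f x))
    ≡⟨ sum-cong-≗ (λ x → *-distribˡ-sum (ι (x ∈? V)) (λ y → ι (y ∈? V - x) * f x y)) ⟩
  sum (λ x → sum λ y → ι (x ∈? V) * (ι (y ∈? V - x) * f x y))
    ≡⟨ ∑-comm (λ x y → ι (x ∈? V) * (ι (y ∈? V - x) * f x y)) ⟩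
  sum (λ y → sum λ x → ι (x ∈? V) * (ι (y ∈? V - x) * f x y))
    ≡⟨ sum-cong-≗ (λ y → sum-cong-≗ λ x → exchange x y) ⟩
  sum (λ y → sum λ x → ι (y ∈? V) * (ι (x ∈? V - y) * f x y))
    ≡⟨ sum-cong-≗ (λ y → *-distribˡ-sum (ι (y ∈? V)) (λ x → ι (x ∈? V - y) * f x y)) ⟨
  ∑∈ V (λ y → ∑∈ (V - y) (λ x → f x y)) ∎
  where
  open ≡-Reasoning
  flip-∈ : ∀ {x y} → x ∈ V × y ∈ V - x → y ∈ V × x ∈ V - y
  flip-∈ {x} (x∈V , y∈) = V-x⊆V V x y∈ , x∈p∧x≢y⇒x∈p-y x∈V (∉-x y∈ ∘ sym)
  exchange : ∀ x y → ι (x ∈? V) * (ι (y ∈? V - x) * f x y) ≡ ι (y ∈? V) * (ι (x ∈? V - y) * f x y)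
  exchange x y = begin
    ι (x ∈? V) * (ι (y ∈? V - x) * f x y)     ≡⟨ *-assoc (ι (x ∈? V)) _ _ ⟨
    ι (x ∈? V) * ι (y ∈? V - x) * f x y       ≡⟨ cong (_* f x y) (ι-× (x ∈? V) (y ∈? V - x)) ⟨
    ι (x ∈? V ×-dec y ∈? V - x) * f x y       ≡⟨ cong (_* f x y) (ι-cong (x ∈? V ×-dec y ∈? V - x) (y ∈? V ×-dec x ∈? V - y) flip-∈ flip-∈) ⟩
    ι (y ∈? V ×-dec x ∈? V - y) * f x y       ≡⟨ cong (_* f x y) (ι-× (y ∈? V) (x ∈? V - y)) ⟩
    ι (y ∈? V) * ι (x ∈? V - y) * f x y       ≡⟨ *-assoc (ι (y ∈? V)) _ _ ⟩
    ι (y ∈? V) * (ι (x ∈? V - y) * f x y)     ∎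

-- Sums over the orderings of a set

-- For `∣ V ∣ ≡ m` this is an expectation over a uniformly random ordering, scaled by `m !`. All
-- probabilities below take this form, with denominators multiplied out.
∑ᵒ : Subset n → ℕ → (List (Fin n) → ℕ) → ℕ
∑ᵒ V zero    f = f []
∑ᵒ V (suc m) f = ∑∈ V λ x → ∑ᵒ (V - x) m (f ∘ (x ∷_))

data Seq {n} : Subset n → ℕ → List (Fin n) → Set where
  []  : ∀ {V} → Seq V 0 []
  _∷_ : ∀ {V m x l} → x ∈ V → Seq (V - x) m l → Seq V (suc m) (x ∷ l)

Seq-length : ∀ {V : Subset n} {m l} → Seq V m l → length l ≡ m
Seq-length []      = refl
Seq-length (_ ∷ s) = cong suc (Seq-length s)

∑ᵒ-mono : (V : Subset n) (m : ℕ) {f g : List (Fin n) → ℕ} →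
  (∀ {l} → Seq V m l → f l ≤ g l) → ∑ᵒ V m f ≤ ∑ᵒ V m g
∑ᵒ-mono V zero    h = h []
∑ᵒ-mono V (suc m) h = ∑∈-mono V λ {x} x∈V → ∑ᵒ-mono (V - x) m λ s → h (x∈V ∷ s)

∑ᵒ-cong : (V : Subset n) (m : ℕ) {f g : List (Fin n) → ℕ} →
  (∀ {l} → Seq V m l → f l ≡ g l) → ∑ᵒ V m f ≡ ∑ᵒ V m g
∑ᵒ-cong V m h = ≤-antisym (∑ᵒ-mono V m (≤-reflexive ∘ h)) (∑ᵒ-mono V m (≤-reflexive ∘ sym ∘ h))

∑ᵒ-+ : (V : Subset n) (m : ℕ) (f g : List (Fin n) → ℕ) →
  ∑ᵒ V m (λ l → f l + g l) ≡ ∑ᵒ V m f + ∑ᵒ V m g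
∑ᵒ-+ V zero    f g = refl
∑ᵒ-+ V (suc m) f g = trans (∑∈-cong V λ {x} _ → ∑ᵒ-+ (V - x) m (f ∘ (x ∷_)) (g ∘ (x ∷_)))
  (∑∈-+ V (λ x → ∑ᵒ (V - x) m (f ∘ (x ∷_))) (λ x → ∑ᵒ (V - x) m (g ∘ (x ∷_))))

∑ᵒ-*ˡ : (V : Subset n) (m c : ℕ) (f : List (Fin n) → ℕ) → ∑ᵒ V m (λ l → c * f l) ≡ c * ∑ᵒ V m f
∑ᵒ-*ˡ V zero    c f = refl
∑ᵒ-*ˡ V (suc m) c f = trans (∑∈-cong V λ {x} _ → ∑ᵒ-*ˡ (V - x) m c (f ∘ (x ∷_)))
  (∑∈-*ˡ V c (λ x → ∑ᵒ (V - x) m (f ∘ (x ∷_))))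

∑ᵒ-∑ˢ : ∀ {k} (V : Subset n) (m : ℕ) (f : Subset k → List (Fin n) → ℕ) →
  ∑ᵒ V m (λ l → ∑ˢ (λ A → f A l)) ≡ ∑ˢ (λ A → ∑ᵒ V m (f A))
∑ᵒ-∑ˢ V zero    f = refl
∑ᵒ-∑ˢ V (suc m) f = trans (∑∈-cong V λ {x} _ → ∑ᵒ-∑ˢ (V - x) m (λ A → f A ∘ (x ∷_)))
  (∑∈-∑ˢ V (λ x A → ∑ᵒ (V - x) m (f A ∘ (x ∷_))))

∣V-x∣≡ : {V : Subset n} {x : Fin n} → ∣ V ∣ ≡ suc m → x ∈ V → ∣ V - x ∣ ≡ m
∣V-x∣≡ eq x∈V = suc-injective (trans (∣V-x∣ x∈V) eq)

∑ᵒ-const : (V : Subset n) (m : ℕ) → ∣ V ∣ ≡ m → (c : ℕ) → ∑ᵒ V m (λ _ → c) ≡ m ! * c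
∑ᵒ-const V zero    eq c = sym (+-identityʳ c)
∑ᵒ-const V (suc m) eq c = begin
  ∑∈ V (λ x → ∑ᵒ (V - x) m (λ _ → c))  ≡⟨ ∑∈-cong V (λ x∈V → ∑ᵒ-const _ m (∣V-x∣≡ eq x∈V) c) ⟩
  ∑∈ V (λ _ → m ! * c)                 ≡⟨ ∑∈-const V (m ! * c) ⟩
  ∣ V ∣ * (m ! * c)                    ≡⟨ cong (_* (m ! * c)) eq ⟩
  suc m * (m ! * c)                    ≡⟨ *-assoc (suc m) (m !) c ⟨
  suc m ! * c                          ∎
  where open ≡-Reasoning

-- Reversal symmetry of a random ordering: its last entry may be drawn first. Exchanging the first
-- and the last draw is `∑∈-swap`.
∑ᵒ-last : (V : Subset n) (m : ℕ) (f : List (Fin n) → ℕ) →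
  ∑ᵒ V (suc m) f ≡ ∑∈ V (λ x → ∑ᵒ (V - x) m (λ l → f (l ∷ʳ x)))
∑ᵒ-last V zero    f = refl
∑ᵒ-last V (suc m) f = begin
  ∑∈ V (λ y → ∑ᵒ (V - y) (suc m) (f ∘ (y ∷_)))
    ≡⟨ ∑∈-cong V (λ {y} _ → ∑ᵒ-last (V - y) m (f ∘ (y ∷_))) ⟩
  ∑∈ V (λ y → ∑∈ (V - y) (λ x → ∑ᵒ (V - y - x) m (λ l → f (y ∷ l ∷ʳ x))))
    ≡⟨ ∑∈-swap V (λ y x → ∑ᵒ (V - y - x) m (λ l → f (y ∷ l ∷ʳ x))) ⟩
  ∑∈ V (λ x → ∑∈ (V - x) (λ y → ∑ᵒ (V - y - x) m (λ l → f (y ∷ l ∷ʳ x))))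
    ≡⟨ ∑∈-cong V (λ {x} _ → ∑∈-cong (V - x) λ {y} _ →
         cong (λ W → ∑ᵒ W m (λ l → f (y ∷ l ∷ʳ x))) (p─x─y≡p─y─x V y x)) ⟩
  ∑∈ V (λ x → ∑ᵒ (V - x) (suc m) (λ l → f (l ∷ʳ x))) ∎
  where open ≡-Reasoning

Local : {A : Set} → ℕ → (List A → ℕ) → Set
Local r f = ∀ l l′ → r ≤ length l → f (l ++ l′) ≡ f l

drop-++ : {A : Set} (s : ℕ) (l l′ : List A) → s ≤ length l → drop s (l ++ l′) ≡ drop s l ++ l′
drop-++ zero    l       l′ h       = refl
drop-++ (suc s) (x ∷ l) l′ (s≤s h) = drop-++ s l l′ h

take-++ : {A : Set} (s : ℕ) (l l′ : List A) → s ≤ length l → take s (l ++ l′) ≡ take s l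
take-++ zero    l       l′ h       = refl
take-++ (suc s) (x ∷ l) l′ (s≤s h) = cong (x ∷_) (take-++ s l l′ h)

length-drop-≥ : {A : Set} (s r : ℕ) (l : List A) → s + r ≤ length l → r ≤ length (drop s l)
length-drop-≥ zero    r l       h       = h
length-drop-≥ (suc s) r (x ∷ l) (s≤s h) = length-drop-≥ s r l h

Local-drop : {A : Set} {r : ℕ} {f : List A → ℕ} (s : ℕ) → Local r f → Local (s + r) (f ∘ drop s)
Local-drop {r = r} {f} s loc l l′ h = trans (cong f (drop-++ s l l′ (≤-trans (m≤m+n s r) h))) (loc (drop s l) l′ (length-drop-≥ s r l h))

-- By ∑ᵒ-last, the discarded entries may be rotated to the end, where f does not see them.
∑ᵒ-drop : (V : Subset n) (m s r : ℕ) {f : List (Fin n) → ℕ} → Local r f → s + r ≤ m →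
  ∑ᵒ V m (f ∘ drop s) ≡ ∑ᵒ V m f
∑ᵒ-drop V m       zero    r loc h = refl
∑ᵒ-drop V (suc m) (suc s) r {f} loc (s≤s h) = begin
  ∑∈ V (λ x → ∑ᵒ (V - x) m (f ∘ drop s))
    ≡⟨ ∑∈-cong V (λ {x} _ → ∑ᵒ-cong (V - x) m λ {l} sq →
         Local-drop s loc l (x ∷ []) (subst (s + r ≤_) (sym (Seq-length sq)) h)) ⟨
  ∑∈ V (λ x → ∑ᵒ (V - x) m (λ l → f (drop s (l ∷ʳ x))))
    ≡⟨ ∑ᵒ-last V m (f ∘ drop s) ⟨
  ∑ᵒ V (suc m) (f ∘ drop s)
    ≡⟨ ∑ᵒ-drop V (suc m) s r loc (m≤n⇒m≤1+n h) ⟩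
  ∑ᵒ V (suc m) f ∎
  where open ≡-Reasoning

-- Chains of subsets

-- The ordering x₁, x₂, … is read as the descending chain W, W - x₁, W - x₁ - x₂, …
visits : (Subset n → ℕ) → Subset n → List (Fin n) → ℕ
visits g W []      = g W
visits g W (x ∷ l) = g W + visits g (W - x) l

Hit : (Subset n → Set) → Subset n → List (Fin n) → Set
Hit p W []      = p W
Hit p W (x ∷ l) = p W ⊎ Hit p (W - x) l

hit? : {p : Subset n → Set} → Decidable p → ∀ W l → Dec (Hit p W l)
hit? p? W []      = p? W
hit? p? W (x ∷ l) = p? W ⊎-dec hit? p? (W - x) l

δ : Subset n → Subset n → ℕ
δ B A = ι (A ≟ˢ B)

δ-≢ : {A B : Subset n} → A ≢ B → δ B A ≡ 0
δ-≢ {A = A} {B} A≢B = ι-no (A ≟ˢ B) A≢B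

visits-∑ˢ : (g : Subset n → ℕ) (W : Subset n) (l : List (Fin n)) →
  visits g W l ≡ ∑ˢ (λ A → g A * visits (δ A) W l)
visits-∑ˢ g W []      = sym (∑ˢ-point g W)
visits-∑ˢ g W (x ∷ l) = begin
  g W + visits g (W - x) l
    ≡⟨ cong₂ _+_ (sym (∑ˢ-point g W)) (visits-∑ˢ g (W - x) l) ⟩
  ∑ˢ (λ A → g A * δ A W) + ∑ˢ (λ A → g A * visits (δ A) (W - x) l)
    ≡⟨ ∑ˢ-+ _ (λ A → g A * visits (δ A) (W - x) l) ⟨
  ∑ˢ (λ A → g A * δ A W + g A * visits (δ A) (W - x) l)
    ≡⟨ ∑ˢ-cong (λ A → *-distribˡ-+ (g A) (δ A W) _) ⟨
  ∑ˢ (λ A → g A * visits (δ A) W (x ∷ l)) ∎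
  where open ≡-Reasoning

-- Linearity of expectation: visits to a whole family reduce to visits to one fixed set, which can
-- be counted exactly.
∑ᵒ-visits : (V : Subset n) (m : ℕ) (g : Subset n → ℕ) (W : Subset n) (h : List (Fin n) → List (Fin n)) →
  ∑ᵒ V m (λ l → visits g W (h l)) ≡ ∑ˢ (λ A → g A * ∑ᵒ V m (λ l → visits (δ A) W (h l)))
∑ᵒ-visits V m g W h = begin
  ∑ᵒ V m (λ l → visits g W (h l))
    ≡⟨ ∑ᵒ-cong V m (λ {l} _ → visits-∑ˢ g W (h l)) ⟩
  ∑ᵒ V m (λ l → ∑ˢ (λ A → g A * visits (δ A) W (h l)))
    ≡⟨ ∑ᵒ-∑ˢ V m (λ A l → g A * visits (δ A) W (h l)) ⟩
  ∑ˢ (λ A → ∑ᵒ V m (λ l → g A * visits (δ A) W (h l)))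
    ≡⟨ ∑ˢ-cong (λ A → ∑ᵒ-*ˡ V m (g A) (λ l → visits (δ A) W (h l))) ⟩
  ∑ˢ (λ A → g A * ∑ᵒ V m (λ l → visits (δ A) W (h l))) ∎
  where open ≡-Reasoning

visits-δ-⊈ : {B : Subset n} (W : Subset n) (l : List (Fin n)) → ¬ B ⊆ W → visits (δ B) W l ≡ 0
visits-δ-⊈ W []      B⊈W = δ-≢ λ { refl → B⊈W ⊆-refl }
visits-δ-⊈ W (x ∷ l) B⊈W = cong₂ _+_ (δ-≢ λ { refl → B⊈W ⊆-refl })
  (visits-δ-⊈ (W - x) l λ B⊆ → B⊈W (⊆-trans B⊆ (V-x⊆V W x)))

⊆-x : {V : Subset n} {A : Subset n} {x : Fin n} → A ⊆ V → x ∉ A → A ⊆ V - x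
⊆-x A⊆V x∉A y∈A = x∈p∧x≢y⇒x∈p-y (A⊆V y∈A) λ { refl → x∉A y∈A }

∑∈-∉ : (V B : Subset n) (c : ℕ) → ∑∈ V (λ x → ι (¬? (x ∈? B)) * c) ≡ ∣ V ─ B ∣ * c
∑∈-∉ V B c = trans (sum-cong-≗ λ x → eq x) (∑∈-const (V ─ B) c)
  where
  eq : ∀ x → ι (x ∈? V) * (ι (¬? (x ∈? B)) * c) ≡ ι (x ∈? V ─ B) * c
  eq x = trans (sym (*-assoc (ι (x ∈? V)) _ c)) (cong (_* c) (trans (sym (ι-× (x ∈? V) (¬? (x ∈? B))))
    (ι-cong (x ∈? V ×-dec ¬? (x ∈? B)) (x ∈? V ─ B)
      (λ (x∈V , x∉B) → x∈p∧x∉q⇒x∈p─q x∈V x∉B) (λ x∈ → p─q⊆p V B x∈ , ∉─ x∈))))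

∣─∣-≡ : {W B : Subset n} {r : ℕ} → B ⊆ W → ∣ W ∣ ≡ r + ∣ B ∣ → ∣ W ─ B ∣ ≡ r
∣─∣-≡ {W = W} {B} B⊆W eq = +-cancelʳ-≡ ∣ B ∣ _ _ (trans (∣─∣ W B B⊆W) eq)

-- The chain passes through `B` only if the first r entries are exactly the elements of `W` outside
-- `B`, in any order; the other entries are free. Start and ordered set are kept apart because a
-- later block starts again at Z while only the elements left by an earlier block are still to be
-- ordered.
∑ᵒ-visits-≤ : (R v r : ℕ) {V W B : Subset n} → V ⊆ W → B ⊆ W → ∣ V ∣ ≡ v → ∣ W ∣ ≡ r + ∣ B ∣ → r ≤ v →
  ∑ᵒ V v (λ l → visits (δ B) W (take R l)) ≤ r ! * (v ∸ r) !
∑ᵒ-visits-≤ zero v zero {V} {W} {B} V⊆W B⊆W eqV eqW r≤v = begin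
  ∑ᵒ V v (λ _ → δ B W) ≡⟨ ∑ᵒ-const V v eqV (δ B W) ⟩
  v ! * δ B W          ≤⟨ *-monoʳ-≤ (v !) (ι≤1 (W ≟ˢ B)) ⟩
  v ! * 1              ≡⟨ *-comm (v !) 1 ⟩
  1 * v !              ∎
  where open ≤-Reasoning
∑ᵒ-visits-≤ zero v (suc r) {V} {W} {B} V⊆W B⊆W eqV eqW r≤v = begin
  ∑ᵒ V v (λ _ → δ B W) ≡⟨ ∑ᵒ-const V v eqV (δ B W) ⟩
  v ! * δ B W          ≡⟨ cong (v ! *_) (δ-≢ λ { refl → m≢1+n+m ∣ W ∣ eqW }) ⟩
  v ! * 0              ≡⟨ *-zeroʳ (v !) ⟩
  0                    ≤⟨ z≤n ⟩
  _                    ∎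
  where open ≤-Reasoning
∑ᵒ-visits-≤ (suc R) zero zero {V} {W} {B} V⊆W B⊆W eqV eqW r≤v = ι≤1 (W ≟ˢ B)
∑ᵒ-visits-≤ (suc R) (suc v) zero {V} {W} {B} V⊆W B⊆W eqV eqW r≤v = begin
  ∑ᵒ V (suc v) (λ l → visits (δ B) W (take (suc R) l))
    -- Here `B` equals `W`, so after one removal the chain has lost an element of `B` and only its
    -- first set counts.
    ≤⟨ ∑∈-mono V (λ {x} x∈V → ∑ᵒ-mono (V - x) v (λ {l} _ → ≤-trans
         (≤-reflexive (trans (cong (δ B W +_) (visits-δ-⊈ (W - x) (take R l) λ B⊆ → ∉-x (B⊆ (W⊆B (V⊆W x∈V))) refl))
                             (+-identityʳ _)))
         (ι≤1 (W ≟ˢ B)))) ⟩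
  ∑ᵒ V (suc v) (λ _ → 1)  ≡⟨ ∑ᵒ-const V (suc v) eqV 1 ⟩
  suc v ! * 1             ≡⟨ *-comm (suc v !) 1 ⟩
  1 * suc v !             ∎
  where
  open ≤-Reasoning
  W⊆B : W ⊆ B
  W⊆B = ⊆-reflexive (sym (⊆-card-≡ B⊆W (≤-reflexive eqW)))
∑ᵒ-visits-≤ (suc R) (suc v) (suc r) {V} {W} {B} V⊆W B⊆W eqV eqW (s≤s r≤v) = begin
  ∑ᵒ V (suc v) (λ l → visits (δ B) W (take (suc R) l))
    ≤⟨ ∑∈-mono V step ⟩
  ∑∈ V (λ x → ι (¬? (x ∈? B)) * (r ! * (v ∸ r) !))
    ≡⟨ ∑∈-∉ V B _ ⟩
  ∣ V ─ B ∣ * (r ! * (v ∸ r) !)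
    ≤⟨ *-monoˡ-≤ _ (p⊆q⇒∣p∣≤∣q∣ {p = V ─ B} {q = W ─ B} (λ x∈ → x∈p∧x∉q⇒x∈p─q (V⊆W (p─q⊆p V B x∈)) (∉─ x∈))) ⟩
  ∣ W ─ B ∣ * (r ! * (v ∸ r) !)
    ≡⟨ cong (_* (r ! * (v ∸ r) !)) (∣─∣-≡ {W = W} {B} B⊆W eqW) ⟩
  suc r * (r ! * (v ∸ r) !)
    ≡⟨ *-assoc (suc r) (r !) ((v ∸ r) !) ⟨
  suc r ! * (v ∸ r) ! ∎
  where
  open ≤-Reasoning
  δ≡0 : δ B W ≡ 0
  δ≡0 = δ-≢ λ { refl → m≢1+n+m ∣ W ∣ eqW }
  step : ∀ {x} → x ∈ V → ∑ᵒ (V - x) v (λ l → δ B W + visits (δ B) (W - x) (take R l))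
    ≤ ι (¬? (x ∈? B)) * (r ! * (v ∸ r) !)
  step {x} x∈V with x ∈? B
  ... | yes x∈B = begin
    ∑ᵒ (V - x) v (λ l → δ B W + visits (δ B) (W - x) (take R l))
      ≡⟨ ∑ᵒ-cong (V - x) v (λ {l} _ → cong₂ _+_ δ≡0 (visits-δ-⊈ (W - x) (take R l) λ B⊆ → ∉-x (B⊆ x∈B) refl)) ⟩
    ∑ᵒ (V - x) v (λ _ → 0)
      ≡⟨ trans (∑ᵒ-const (V - x) v (∣V-x∣≡ eqV x∈V) 0) (*-zeroʳ (v !)) ⟩
    0 ∎
  ... | no x∉B = begin
    ∑ᵒ (V - x) v (λ l → δ B W + visits (δ B) (W - x) (take R l))
      ≡⟨ ∑ᵒ-cong (V - x) v (λ {l} _ → cong (_+ visits (δ B) (W - x) (take R l)) δ≡0) ⟩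
    ∑ᵒ (V - x) v (λ l → visits (δ B) (W - x) (take R l))
      ≤⟨ ∑ᵒ-visits-≤ R v r (-x-mono x V⊆W) (⊆-x B⊆W x∉B) (∣V-x∣≡ eqV x∈V) (∣V-x∣≡ eqW (V⊆W x∈V)) r≤v ⟩
    r ! * (v ∸ r) !
      ≡⟨ *-identityˡ _ ⟨
    1 * (r ! * (v ∸ r) !) ∎

-- Every ordering that lists the k elements outside `A` before those of `A` passes through `A`.
∑ᵒ-visits-≥ : (k m : ℕ) {V A : Subset n} → A ⊆ V → ∣ V ∣ ≡ k + ∣ A ∣ → ∣ V ∣ ≡ m →
  k ! * ∣ A ∣ ! ≤ ∑ᵒ V m (visits (δ A) V)
∑ᵒ-visits-≥ zero m {V} {A} A⊆V eqk eqm = begin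
  1 * ∣ A ∣ !                    ≡⟨ *-comm 1 (∣ A ∣ !) ⟩
  ∣ A ∣ ! * 1                    ≡⟨ cong (λ a → a ! * 1) (trans (sym eqk) eqm) ⟩
  m ! * 1                        ≡⟨ ∑ᵒ-const V m eqm 1 ⟨
  ∑ᵒ V m (λ _ → 1)               ≤⟨ ∑ᵒ-mono V m (λ {l} _ → first l) ⟩
  ∑ᵒ V m (visits (δ A) V)        ∎
  where
  open ≤-Reasoning
  1≤ : 1 ≤ δ A V
  1≤ = ≤-reflexive (sym (ι-yes (V ≟ˢ A) (sym (⊆-card-≡ A⊆V (≤-reflexive eqk)))))
  first : ∀ l → 1 ≤ visits (δ A) V l
  first []      = 1≤
  first (x ∷ l) = ≤-trans 1≤ (m≤m+n _ _)
∑ᵒ-visits-≥ (suc k) zero {V} {A} A⊆V eqk eqm = contradiction (trans (sym eqm) eqk) λ ()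
∑ᵒ-visits-≥ (suc k) (suc m) {V} {A} A⊆V eqk eqm = begin
  suc k ! * ∣ A ∣ !                                  ≡⟨ *-assoc (suc k) (k !) _ ⟩
  suc k * (k ! * ∣ A ∣ !)                            ≡⟨ cong (_* (k ! * ∣ A ∣ !)) (sym (∣─∣-≡ {W = V} {A} A⊆V eqk)) ⟩
  ∣ V ─ A ∣ * (k ! * ∣ A ∣ !)                        ≡⟨ ∑∈-∉ V A _ ⟨
  ∑∈ V (λ x → ι (¬? (x ∈? A)) * (k ! * ∣ A ∣ !))     ≤⟨ ∑∈-mono V step ⟩
  ∑ᵒ V (suc m) (visits (δ A) V)                      ∎
  where
  open ≤-Reasoning
  step : ∀ {x} → x ∈ V → ι (¬? (x ∈? A)) * (k ! * ∣ A ∣ !) ≤ ∑ᵒ (V - x) m (λ l → visits (δ A) V (x ∷ l))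
  step {x} x∈V with x ∈? A
  ... | yes _  = z≤n
  ... | no x∉A = begin
    1 * (k ! * ∣ A ∣ !)                ≡⟨ *-identityˡ _ ⟩
    k ! * ∣ A ∣ !                      ≤⟨ ∑ᵒ-visits-≥ k m (⊆-x A⊆V x∉A) (∣V-x∣≡ eqk x∈V) (∣V-x∣≡ eqm x∈V) ⟩
    ∑ᵒ (V - x) m (visits (δ A) (V - x)) ≤⟨ ∑ᵒ-mono (V - x) m (λ _ → m≤n+m _ _) ⟩
    ∑ᵒ (V - x) m (λ l → visits (δ A) V (x ∷ l)) ∎

Hit-⊆ : {p : Subset n → Set} (W : Subset n) (l : List (Fin n)) → Hit p W l → ∃ λ A → p A × A ⊆ W
Hit-⊆ W []      h        = W , h , ⊆-refl
Hit-⊆ W (x ∷ l) (inj₁ h) = W , h , ⊆-refl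
Hit-⊆ W (x ∷ l) (inj₂ h) with Hit-⊆ (W - x) l h
... | A , pA , A⊆ = A , pA , ⊆-trans A⊆ (V-x⊆V W x)

Hit-map : {p q : Subset n → Set} (W : Subset n) (l : List (Fin n)) → (∀ {A} → A ⊆ W → p A → q A) → Hit p W l → Hit q W l
Hit-map W []      f h        = f ⊆-refl h
Hit-map W (x ∷ l) f (inj₁ h) = inj₁ (f ⊆-refl h)
Hit-map W (x ∷ l) f (inj₂ h) = inj₂ (Hit-map (W - x) l (λ A⊆ → f (⊆-trans A⊆ (V-x⊆V W x))) h)

-- Each removal lowers the size by one, so sets at most R smaller than the start are met within R
-- removals.
Hit-take : {p : Subset n → Set} {V : Subset n} (R : ℕ) {l : List (Fin n)} → Seq V m l → (∀ {A} → p A → ∣ V ∣ ≤ R + ∣ A ∣) →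
  Hit p V l → Hit p V (take R l)
Hit-take zero    []        near h        = h
Hit-take zero    (x∈V ∷ s) near (inj₁ h) = h
Hit-take zero    (_∷_ {V} {x = x} {l} x∈V s) near (inj₂ h) with Hit-⊆ (V - x) l h
... | A , pA , A⊆ = contradiction (≤-trans (≤-reflexive (∣V-x∣ x∈V)) (≤-trans (near pA) (p⊆q⇒∣p∣≤∣q∣ A⊆))) (<-irrefl refl)
Hit-take (suc R) []        near h        = h
Hit-take (suc R) (x∈V ∷ s) near (inj₁ h) = inj₁ h
Hit-take (suc R) (x∈V ∷ s) near (inj₂ h) =
  inj₂ (Hit-take R s (λ pA → s≤s⁻¹ (≤-trans (≤-reflexive (∣V-x∣ x∈V)) (near pA))) h)

ι-hit≤visits : {p : Subset n → Set} (p? : Decidable p) (W : Subset n) (l : List (Fin n)) →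
  ι (hit? p? W l) ≤ visits (ι ∘ p?) W l
ι-hit≤visits p? W []      = ≤-refl
ι-hit≤visits p? W (x ∷ l) with p? W
... | yes _ = s≤s z≤n
... | no ¬p = ≤-trans (ι-mono (no ¬p ⊎-dec hit? p? (W - x) l) (hit? p? (W - x) l) λ { (inj₁ q) → contradiction q ¬p ; (inj₂ h) → h })
                       (ι-hit≤visits p? (W - x) l)

-- The expected number of members on a random maximal chain

module Chains {n : ℕ} {u : Subset n → Set} (u? : Decidable u) (R : ℕ)
  (near : ∀ {A B} → u A → u B → ∣ A ∣ ≤ R + ∣ B ∣) where

  Below : Subset n → Subset n → Set
  Below V A = u A × A ≢ V

  below? : (V : Subset n) → Decidable (Below V)
  below? V A = u? A ×-dec ¬? (A ≟ˢ V)

  repeat : Subset n → List (Fin n) → ℕ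
  repeat V l = ι (u? V) * ι (hit? (below? V) V (take R l))

  repeats : Subset n → List (Fin n) → ℕ
  repeats V []      = repeat V []
  repeats V (x ∷ l) = repeat V (x ∷ l) + repeats (V - x) l

  -- Each member met, except the last, has another member further down the chain, and `near` places
  -- that one within the next `R` removals. So the repeats account for all visits but one.
  visits≤1+repeats : ∀ {V m l} → Seq V m l → visits (ι ∘ u?) V l ≤ ι (hit? u? V l) + repeats V l
  visits≤1+repeats [] = m≤m+n _ _
  visits≤1+repeats {V} (_∷_ {x = x} {l} x∈V s) with u? V
  ... | no ¬uV = ≤-trans (visits≤1+repeats s)
                   (+-monoˡ-≤ _ (ι-mono (hit? u? (V - x) l) (no ¬uV ⊎-dec hit? u? (V - x) l) inj₂))
  ... | yes uV = s≤s (begin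
    visits (ι ∘ u?) (V - x) l
      ≤⟨ visits≤1+repeats s ⟩
    ι (hit? u? (V - x) l) + repeats (V - x) l
      ≤⟨ +-monoˡ-≤ _ (ι-mono (hit? u? (V - x) l) (hit? (below? V) V (take R (x ∷ l))) λ h →
           Hit-take R (x∈V ∷ s) (λ (uA , _) → near uV uA)
             (inj₂ (Hit-map (V - x) l (λ A⊆ uA → uA , λ { refl → ∉-x (A⊆ x∈V) refl }) h))) ⟩
    ι (hit? (below? V) V (take R (x ∷ l))) + repeats (V - x) l
      ≡⟨ cong (_+ repeats (V - x) l) (*-identityˡ _) ⟨
    1 * ι (hit? (below? V) V (take R (x ∷ l))) + repeats (V - x) l ∎)
    where open ≤-Reasoning

  module _ {b : ℕ}
    (thin : ∀ {V} → u V → b * ∑ᵒ V (∣ V ∣) (λ l → ι (hit? (below? V) V (take R l))) ≤ 2 * ∣ V ∣ !) where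

    ∑ᵒ-repeat : ∀ {V} m → ∣ V ∣ ≡ m → b * ∑ᵒ V m (repeat V) ≤ 2 * (m ! * ι (u? V))
    ∑ᵒ-repeat {V} m refl with u? V
    ... | no _ = ≤-reflexive (trans (cong (b *_) (trans (∑ᵒ-const V m refl 0) (*-zeroʳ (m !)))) (trans (*-zeroʳ b) (sym (cong (2 *_) (*-zeroʳ (m !))))))
    ... | yes uV = begin
      b * ∑ᵒ V m (λ l → 1 * ι (hit? (below? V) V (take R l))) ≡⟨ cong (b *_) (∑ᵒ-cong V m λ _ → *-identityˡ _) ⟩
      b * ∑ᵒ V m (λ l → ι (hit? (below? V) V (take R l)))     ≤⟨ thin uV ⟩
      2 * m !                                                 ≡⟨ cong (2 *_) (*-identityʳ (m !)) ⟨
      2 * (m ! * 1)                                           ∎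
      where open ≤-Reasoning

    -- Once the chain has reached a set, the rest of the ordering is a uniform ordering of that set,
    -- so `thin` applies at every member visited: each visit yields a repeat with probability at
    -- most 2/b.
    ∑ᵒ-repeats : ∀ {V} m → ∣ V ∣ ≡ m → b * ∑ᵒ V m (repeats V) ≤ 2 * ∑ᵒ V m (visits (ι ∘ u?) V)
    ∑ᵒ-repeats {V} zero    eq = ≤-trans (∑ᵒ-repeat {V} zero eq) (≤-reflexive (cong (2 *_) (*-identityˡ (ι (u? V)))))
    ∑ᵒ-repeats {V} (suc m) eq = begin
      b * ∑ᵒ V (suc m) (repeats V)
        ≡⟨ cong (b *_) (trans (∑ᵒ-cong V (suc m) {repeats V} {λ l → repeat V l + rest l} λ { (_ ∷ _) → refl }) (∑ᵒ-+ V (suc m) (repeat V) rest)) ⟩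
      b * (∑ᵒ V (suc m) (repeat V) + ∑ᵒ V (suc m) rest)
        ≡⟨ *-distribˡ-+ b _ _ ⟩
      b * ∑ᵒ V (suc m) (repeat V) + b * ∑ᵒ V (suc m) rest
        ≤⟨ +-mono-≤ (∑ᵒ-repeat {V} (suc m) eq) (begin
             b * ∑∈ V (λ x → ∑ᵒ (V - x) m (repeats (V - x)))
               ≡⟨ ∑∈-*ˡ V b _ ⟨
             ∑∈ V (λ x → b * ∑ᵒ (V - x) m (repeats (V - x)))
               ≤⟨ ∑∈-mono V (λ x∈V → ∑ᵒ-repeats m (∣V-x∣≡ eq x∈V)) ⟩
             ∑∈ V (λ x → 2 * ∑ᵒ (V - x) m (visits (ι ∘ u?) (V - x)))
               ≡⟨ ∑∈-*ˡ V 2 _ ⟩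
             2 * ∑∈ V (λ x → ∑ᵒ (V - x) m (visits (ι ∘ u?) (V - x))) ∎) ⟩
      2 * (suc m ! * ι (u? V)) + 2 * ∑∈ V (λ x → ∑ᵒ (V - x) m (visits (ι ∘ u?) (V - x)))
        ≡⟨ *-distribˡ-+ 2 (suc m ! * ι (u? V)) _ ⟨
      2 * (suc m ! * ι (u? V) + ∑∈ V (λ x → ∑ᵒ (V - x) m (visits (ι ∘ u?) (V - x))))
        ≡⟨ cong (λ z → 2 * (z + ∑∈ V (λ x → ∑ᵒ (V - x) m (visits (ι ∘ u?) (V - x))))) (∑ᵒ-const V (suc m) eq (ι (u? V))) ⟨
      2 * (∑ᵒ V (suc m) (λ _ → ι (u? V)) + ∑∈ V (λ x → ∑ᵒ (V - x) m (visits (ι ∘ u?) (V - x))))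
        ≡⟨ cong (2 *_) (∑∈-+ V (λ x → ∑ᵒ (V - x) m (λ _ → ι (u? V))) _) ⟨
      2 * ∑∈ V (λ x → ∑ᵒ (V - x) m (λ _ → ι (u? V)) + ∑ᵒ (V - x) m (visits (ι ∘ u?) (V - x)))
        ≡⟨ cong (2 *_) (∑∈-cong V λ {x} _ → ∑ᵒ-+ (V - x) m (λ _ → ι (u? V)) _) ⟨
      2 * ∑ᵒ V (suc m) (visits (ι ∘ u?) V) ∎
      where
      open ≤-Reasoning
      rest : List (Fin n) → ℕ
      rest []      = 0
      rest (x ∷ l) = repeats (V - x) l

    ∑ᵒ-visits-thin : let S = ∑ᵒ ⊤ n (visits (ι ∘ u?) ⊤) in b * S ≤ b * n ! + 2 * S
    ∑ᵒ-visits-thin = begin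
      b * ∑ᵒ ⊤ n (visits (ι ∘ u?) ⊤)
        ≤⟨ *-monoʳ-≤ b (∑ᵒ-mono ⊤ n λ {l} s → ≤-trans (visits≤1+repeats s) (+-monoˡ-≤ _ (ι≤1 (hit? u? ⊤ l)))) ⟩
      b * ∑ᵒ ⊤ n (λ l → 1 + repeats ⊤ l)
        ≡⟨ cong (b *_) (∑ᵒ-+ ⊤ n (λ _ → 1) (repeats ⊤)) ⟩
      b * (∑ᵒ ⊤ n (λ _ → 1) + ∑ᵒ ⊤ n (repeats ⊤))
        ≡⟨ *-distribˡ-+ b _ _ ⟩
      b * ∑ᵒ ⊤ n (λ _ → 1) + b * ∑ᵒ ⊤ n (repeats ⊤)
        ≤⟨ +-mono-≤ (≤-reflexive (cong (b *_) (trans (∑ᵒ-const ⊤ n (∣⊤∣≡n n) 1) (*-identityʳ (n !)))))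
                    (∑ᵒ-repeats n (∣⊤∣≡n n)) ⟩
      b * n ! + 2 * ∑ᵒ ⊤ n (visits (ι ∘ u?) ⊤) ∎
      where open ≤-Reasoning

-- Chains below a set that is the union of few pairs of members

-- Says that a binomial coefficient C(m, k) with 0 < k < m is at least m, for m = a + b + 2 and k =
-- a + 1.
m!*n!≤[m+n-1]! : ∀ a b → suc a ! * suc b ! ≤ suc (a + b) !
m!*n!≤[m+n-1]! zero    b = ≤-reflexive (*-identityˡ (suc b !))
m!*n!≤[m+n-1]! (suc a) b = begin
  suc (suc a) * suc a ! * suc b !     ≡⟨ *-assoc (suc (suc a)) (suc a !) (suc b !) ⟩
  suc (suc a) * (suc a ! * suc b !)   ≤⟨ *-mono-≤ (s≤s (s≤s (m≤m+n a b))) (m!*n!≤[m+n-1]! a b) ⟩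
  suc (suc (a + b)) * suc (a + b) !   ∎
  where open ≤-Reasoning

-- Says that C(m, k) is at least m (m - 1) / 2 for 2 ≤ k ≤ m - 2, with m = a + b + 4 and k = a + 2.
m!*n!≤2*[m+n-2]! : ∀ a b → (2 + a) ! * (2 + b) ! ≤ 2 * (2 + (a + b)) !
m!*n!≤2*[m+n-2]! zero    b = ≤-refl
m!*n!≤2*[m+n-2]! (suc a) b = begin
  (3 + a) * (2 + a) ! * (2 + b) !         ≡⟨ *-assoc (3 + a) ((2 + a) !) _ ⟩
  (3 + a) * ((2 + a) ! * (2 + b) !)       ≤⟨ *-mono-≤ (+-monoʳ-≤ 3 (m≤m+n a b)) (m!*n!≤2*[m+n-2]! a b) ⟩
  (3 + (a + b)) * (2 * (2 + (a + b)) !)   ≡⟨ swap (3 + (a + b)) 2 ((2 + (a + b)) !) ⟩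
  2 * (3 + (a + b)) !                     ∎
  where
  open ≤-Reasoning
  swap : ∀ x y z → x * (y * z) ≡ y * (x * z)
  swap = solve-∀

ι-⊎ : (P? : Dec P) (Q? : Dec Q) → ι (P? ⊎-dec Q?) ≤ ι P? + ι Q?
ι-⊎ (yes _) _       = s≤s z≤n
ι-⊎ (no _)  (yes _) = s≤s z≤n
ι-⊎ (no _)  (no _)  = z≤n

ι-hit-⊎ : {p q r : Subset n → Set} (p? : Decidable p) (q? : Decidable q) (r? : Decidable r) →
  (∀ {A} → p A → q A ⊎ r A) → ∀ W l → ι (hit? p? W l) ≤ ι (hit? q? W l) + visits (ι ∘ r?) W l
ι-hit-⊎ p? q? r? split W [] = ≤-trans (ι-mono (p? W) (q? W ⊎-dec r? W) split) (ι-⊎ (q? W) (r? W))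
ι-hit-⊎ p? q? r? split W (x ∷ l) with q? W
... | yes _ = ≤-trans (ι≤1 (p? W ⊎-dec hit? p? (W - x) l)) (s≤s z≤n)
... | no ¬q = begin
  ι (p? W ⊎-dec hit? p? (W - x) l)
    ≤⟨ ι-⊎ (p? W) (hit? p? (W - x) l) ⟩
  ι (p? W) + ι (hit? p? (W - x) l)
    ≤⟨ +-mono-≤ (ι-mono (p? W) (r? W) λ pW → fromʳ (split pW)) (ι-hit-⊎ p? q? r? split (W - x) l) ⟩
  ι (r? W) + (ι (hit? q? (W - x) l) + visits (ι ∘ r?) (W - x) l)
    ≡⟨ swap (ι (r? W)) (ι (hit? q? (W - x) l)) _ ⟩
  ι (hit? q? (W - x) l) + (ι (r? W) + visits (ι ∘ r?) (W - x) l)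
    ≤⟨ +-monoˡ-≤ _ (ι-mono (hit? q? (W - x) l) (no ¬q ⊎-dec hit? q? (W - x) l) inj₂) ⟩
  ι (no ¬q ⊎-dec hit? q? (W - x) l) + (ι (r? W) + visits (ι ∘ r?) (W - x) l) ∎
  where
  open ≤-Reasoning
  swap : ∀ a b c → a + (b + c) ≡ b + (a + c)
  swap = solve-∀
  fromʳ : ∀ {X} → _ ⊎ X → X
  fromʳ (inj₁ qW) = contradiction qW ¬q
  fromʳ (inj₂ rW) = rW

Seq-All : ∀ {V : Subset n} {m l} → Seq V m l → All (_∈ V) l
Seq-All []                     = []
Seq-All (_∷_ {V} {x = x} x∈V s) = x∈V ∷ All.map (V-x⊆V V x) (Seq-All s)

-- Adj A B: together with Z, the sets A and B violate union-freeness.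
module Degrees {n : ℕ} {u : Subset n → Set} (u? : Decidable u) (Z : Subset n) (d : ℕ) where

  Proper : Subset n → Set
  Proper A = u A × A ≢ Z

  proper? : Decidable Proper
  proper? A = u? A ×-dec ¬? (A ≟ˢ Z)

  Adj : Subset n → Subset n → Set
  Adj A B = Proper B × A ∪ B ≡ Z

  adj? : ∀ A → Decidable (Adj A)
  adj? A B = proper? B ×-dec A ∪ B ≟ˢ Z

  deg : Subset n → ℕ
  deg A = ∑ˢ (ι ∘ adj? A)

  Heavy : Subset n → Set
  Heavy A = Proper A × d ≤ deg A

  heavy? : Decidable Heavy
  heavy? A = proper? A ×-dec d ≤? deg A

module Thin {n : ℕ} {u : Subset n → Set} (u? : Decidable u) (Z : Subset n) (R d : ℕ)
  (near : ∀ {A} → u A → ∣ Z ∣ ≤ R + ∣ A ∣)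
  (wide : R + (2 + R) ≤ ∣ Z ∣)
  (few : ∑ˢ (ι ∘ Degrees.heavy? u? Z d) ≤ d) where

  open Degrees u? Z d

  private
    c : ℕ
    c = ∣ Z ∣

  Single : Subset n → Set
  Single A = Proper A × (A ⊆ Z × suc ∣ A ∣ ≡ c)

  single? : Decidable Single
  single? A = proper? A ×-dec (A ⊆? Z ×-dec suc ∣ A ∣ ≟ c)

  single-Adj : ∀ {A B} → Single A → Single B → A ≢ B → Adj A B
  single-Adj {A} {B} (_ , A⊆Z , ∣A∣) (prB , B⊆Z , ∣B∣) A≢B = prB , ⊆-card-≡ A∪B⊆Z c≤
    where
    A∪B⊆Z : A ∪ B ⊆ Z
    A∪B⊆Z x∈ with x∈p∪q⁻ A B x∈
    ... | inj₁ x∈A = A⊆Z x∈A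
    ... | inj₂ x∈B = B⊆Z x∈B
    c≤ : c ≤ ∣ A ∪ B ∣
    c≤ with ∣ A ∪ B ∣ ≤? ∣ A ∣
    ... | no ≰ = ≤-trans (≤-reflexive (sym ∣A∣)) (≰⇒> ≰)
    ... | yes le = contradiction (sym (⊆-card-≡ (⊆-trans (q⊆p∪q A B) (⊆-reflexive (sym (⊆-card-≡ (p⊆p∪q B) le))))
                     (≤-reflexive (suc-injective (trans ∣A∣ (sym ∣B∣)))))) A≢B

  -- By `single-Adj` these sets are pairwise partners. More than `d` of them would each have degree
  -- at least `d` and so be heavy, and of heavy sets there are at most `d`.
  few-single : ∑ˢ (ι ∘ single?) ≤ d
  few-single with ∑ˢ (ι ∘ single?) ≤? d
  ... | yes le = le
  ... | no ≰d = ≤-trans (∑ˢ-mono λ A → ι-mono (single? A) (heavy? A) λ sA → proj₁ sA , ≤-trans-pred (≤-trans (≰⇒> ≰d) (bound sA))) few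
    where
    open ≤-Reasoning
    ≤-trans-pred : ∀ {x y} → suc x ≤ y + 1 → x ≤ y
    ≤-trans-pred {x} {y} h = +-cancelʳ-≤ 1 x y (subst (_≤ y + 1) (+-comm 1 x) h)
    bound : ∀ {A} → Single A → ∑ˢ (ι ∘ single?) ≤ deg A + 1
    bound {A} sA = begin
      ∑ˢ (ι ∘ single?)                                 ≤⟨ ∑ˢ-mono pointwise ⟩
      ∑ˢ (λ B → ι (adj? A B) + 1 * ι (A ≟ˢ B))         ≡⟨ ∑ˢ-+ (ι ∘ adj? A) (λ B → 1 * ι (A ≟ˢ B)) ⟩
      deg A + ∑ˢ (λ B → 1 * ι (A ≟ˢ B))                ≡⟨ cong (deg A +_) (∑ˢ-point (λ _ → 1) A) ⟩
      deg A + 1                                        ∎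
      where
      pointwise : ∀ B → ι (single? B) ≤ ι (adj? A B) + 1 * ι (A ≟ˢ B)
      pointwise B with A ≟ˢ B
      ... | yes _  = ≤-trans (ι≤1 (single? B)) (m≤n+m 1 _)
      ... | no A≢B = ≤-trans (ι-mono (single? B) (adj? A B) λ sB → single-Adj sA sB A≢B) (m≤m+n _ _)

  Exceptional : Subset n → Set
  Exceptional A = Heavy A ⊎ Single A

  exceptional? : Decidable Exceptional
  exceptional? A = heavy? A ⊎-dec single? A

  few-exceptional : ∑ˢ (ι ∘ exceptional?) ≤ 2 * d
  few-exceptional = begin
    ∑ˢ (ι ∘ exceptional?)                    ≤⟨ ∑ˢ-mono (λ A → ι-⊎ (heavy? A) (single? A)) ⟩
    ∑ˢ (λ A → ι (heavy? A) + ι (single? A))  ≡⟨ ∑ˢ-+ (ι ∘ heavy?) (ι ∘ single?) ⟩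
    ∑ˢ (ι ∘ heavy?) + ∑ˢ (ι ∘ single?)       ≤⟨ +-mono-≤ few few-single ⟩
    d + d                                    ≡⟨ cong (d +_) (+-identityʳ d) ⟨
    2 * d                                    ∎
    where open ≤-Reasoning

  Light : Subset n → Set
  Light A = Proper A × ¬ Exceptional A

  light? : Decidable Light
  light? A = proper? A ×-dec ¬? (exceptional? A)

  codim : ∀ {A} → Proper A → A ⊆ Z → ∃ λ r → c ≡ suc r + ∣ A ∣ × suc r ≤ R
  codim {A} (uA , A≢Z) A⊆Z with c ∸ ∣ A ∣ in eq
  ... | zero  = contradiction (⊆-card-≡ A⊆Z (m∸n≡0⇒m≤n eq)) A≢Z
  ... | suc r = r , trans (sym (m∸n+n≡m (p⊆q⇒∣p∣≤∣q∣ A⊆Z))) (cong (_+ ∣ A ∣) eq)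
              , subst (_≤ R) eq (m≤n+o⇒m∸n≤o c (∣ A ∣) (subst (c ≤_) (+-comm R (∣ A ∣)) (near uA)))

  -- A proper subset of `Z` with k missing elements is met with probability at most 1 / C(c, k). As
  -- `wide` keeps `A` nonempty, 0 < k < c and this is at most 1/c.
  ∑ᵒ-visits-proper : ∀ {A} → Proper A → c * ∑ᵒ Z c (λ l → visits (δ A) Z (take R l)) ≤ c !
  ∑ᵒ-visits-proper {A} prA with A ⊆? Z
  ... | no A⊈Z = begin
    c * ∑ᵒ Z c (λ l → visits (δ A) Z (take R l))
      ≡⟨ cong (c *_) (trans (∑ᵒ-cong Z c λ {l} _ → visits-δ-⊈ Z (take R l) A⊈Z)
                            (trans (∑ᵒ-const Z c refl 0) (*-zeroʳ (c !)))) ⟩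
    c * 0  ≡⟨ *-zeroʳ c ⟩
    0      ≤⟨ z≤n ⟩
    c !    ∎
    where open ≤-Reasoning
  ... | yes A⊆Z with codim prA A⊆Z
  ... | r , c≡ , r<R with ≤⇒∃+ (≤-trans (s≤s r<R) (≤-trans (m≤n+m (suc R) (R + 1)) (≤-trans (≤-reflexive (lemma R)) wide)))
    where
    lemma : ∀ R → R + 1 + suc R ≡ R + (2 + R)
    lemma = solve-∀
    ≤⇒∃+ : ∀ {x y} → x ≤ y → ∃ λ k → y ≡ k + x
    ≤⇒∃+ {x} {y} h = y ∸ x , sym (m∸n+n≡m h)
  ... | s , c≡s = begin
    c * ∑ᵒ Z c (λ l → visits (δ A) Z (take R l))
      ≤⟨ *-monoʳ-≤ c (∑ᵒ-visits-≤ R c (suc r) ⊆-refl A⊆Z refl c≡ (≤-trans (n≤1+n _) (≤-trans (m≤n+m _ s) (≤-reflexive (sym c≡s))))) ⟩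
    c * (suc r ! * (c ∸ suc r) !)
      ≡⟨ cong (λ z → c * (suc r ! * z !)) (trans (cong (_∸ suc r) (trans c≡s (+-suc s (suc r)))) (m+n∸n≡m (suc s) (suc r))) ⟩
    c * (suc r ! * suc s !)
      ≤⟨ *-monoʳ-≤ c (m!*n!≤[m+n-1]! r s) ⟩
    c * suc (r + s) !
      ≡⟨ cong (_* suc (r + s) !) c≡′ ⟩
    suc (suc (r + s)) !
      ≡⟨ cong _! c≡′ ⟨
    c ! ∎
    where
    open ≤-Reasoning
    c≡′ : c ≡ suc (suc (r + s))
    c≡′ = trans c≡s (lemma s r)
      where
      lemma : ∀ s r → s + (2 + r) ≡ 2 + (r + s)
      lemma = solve-∀

  ∑ᵒ-exceptional : c * ∑ᵒ Z c (λ l → visits (ι ∘ exceptional?) Z (take R l)) ≤ 2 * d * c !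
  ∑ᵒ-exceptional = begin
    c * ∑ᵒ Z c (λ l → visits (ι ∘ exceptional?) Z (take R l))
      ≡⟨ cong (c *_) (∑ᵒ-visits Z c (ι ∘ exceptional?) Z (take R)) ⟩
    c * ∑ˢ (λ A → ι (exceptional? A) * ∑ᵒ Z c (λ l → visits (δ A) Z (take R l)))
      ≡⟨ ∑ˢ-*ˡ {n} c _ ⟩
    ∑ˢ (λ A → c * (ι (exceptional? A) * ∑ᵒ Z c (λ l → visits (δ A) Z (take R l))))
      ≤⟨ ∑ˢ-mono (λ A → ≤-trans (≤-reflexive (swap c (ι (exceptional? A)) _))
           (ι*-mono (exceptional? A) (∑ᵒ-visits-proper ∘ proper))) ⟩
    ∑ˢ (λ A → ι (exceptional? A) * c !)
      ≡⟨ ∑ˢ-*ʳ (ι ∘ exceptional?) (c !) ⟩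
    ∑ˢ (ι ∘ exceptional?) * c !
      ≤⟨ *-monoˡ-≤ (c !) few-exceptional ⟩
    2 * d * c ! ∎
    where
    open ≤-Reasoning
    swap : ∀ x y z → x * (y * z) ≡ y * (x * z)
    swap = solve-∀
    proper : ∀ {A} → Exceptional A → Proper A
    proper (inj₁ h) = proj₁ h
    proper (inj₂ s) = proj₁ s

  LightAdj : Subset n → Subset n → Set
  LightAdj A B = Light B × A ∪ B ≡ Z

  lightAdj? : ∀ A → Decidable (LightAdj A)
  lightAdj? A B = light? B ×-dec A ∪ B ≟ˢ Z

  -- Removing elements of V from W keeps V ∪ W = Z, so a light set met from Z through elements of V is a neighbour of V.
  hit-neighbour : ∀ {V W} → V ⊆ Z → W ⊆ Z → (∀ {y} → y ∈ Z → y ∈ V ⊎ y ∈ W) →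
    ∀ {l} → All (_∈ V) l → Hit Light W l → Hit (LightAdj V) W l
  hit-neighbour {V} {W} V⊆Z W⊆Z cover = go
    where
    here′ : Light W → LightAdj V W
    here′ h = h , ⊆-antisym (λ x∈ → case x∈p∪q⁻ V W x∈ of λ { (inj₁ x∈V) → V⊆Z x∈V ; (inj₂ x∈W) → W⊆Z x∈W })
                            (λ x∈Z → x∈p∪q⁺ (cover x∈Z))
    go : ∀ {l} → All (_∈ V) l → Hit Light W l → Hit (LightAdj V) W l
    go []           h        = here′ h
    go (_ ∷ _)      (inj₁ h) = inj₁ (here′ h)
    go (_∷_ {x} x∈V al) (inj₂ h) = inj₂ (hit-neighbour V⊆Z (⊆-trans (V-x⊆V W x) W⊆Z) cover′ al h)
      where
      cover′ : ∀ {y} → y ∈ Z → y ∈ V ⊎ y ∈ W - x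
      cover′ {y} y∈Z with cover y∈Z | y Fin.≟ x
      ... | inj₁ y∈V | _        = inj₁ y∈V
      ... | inj₂ _   | yes refl = inj₁ x∈V
      ... | inj₂ y∈W | no y≢x   = inj₂ (x∈p∧x≢y⇒x∈p-y y∈W y≢x)

  ψ : Subset n → List (Fin n) → ℕ
  ψ V l = ι (light? V) * ι (hit? (lightAdj? V) Z (take R l))

  -- Sums `ψ` over the first r + 1 sets of the chain, while the second block stays at a fixed place
  -- in the ordering: each removal shortens the list by one, so its offset s falls together with r.
  Φ : ℕ → ℕ → Subset n → List (Fin n) → ℕ
  Φ (suc r) (suc s) V (x ∷ l) = ψ V (drop s l) + Φ r s (V - x) l
  Φ r       s       V l       = ψ V (drop s l)

  e : List (Fin n) → ℕ
  e l = ι (hit? light? Z (take R l))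

  -- A union bound over the place where the first block meets a light set. Since r ≤ s, the second
  -- block removes only elements still in that set, so by `hit-neighbour` whatever light set it
  -- meets is a partner.
  pair≤Φ : ∀ {V m l} r s → Seq V m l → V ⊆ Z → r ≤ s →
    ι (hit? light? V (take r l)) * e (drop s l) ≤ Φ r s V l
  pair≤Φ {V} {l = l} zero s sq V⊆Z r≤s = ι*-mono (light? V) λ _ →
    ι-mono (hit? light? Z (take R (drop s l))) (hit? (lightAdj? V) Z (take R (drop s l)))
      (hit-neighbour V⊆Z ⊆-refl inj₂ (take⁺ R (drop⁺ s (Seq-All sq))))
  pair≤Φ {V} (suc r) (suc s) [] V⊆Z r≤s = ι*-mono (light? V) λ _ →
    ι-mono (hit? light? Z (take R [])) (hit? (lightAdj? V) Z (take R []))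
      (hit-neighbour V⊆Z ⊆-refl inj₂ (take⁺ R []))
  pair≤Φ {V} (suc r) (suc s) (_∷_ {x = x} {l} x∈V sq) V⊆Z (s≤s r≤s) = begin
    ι (light? V ⊎-dec hit? light? (V - x) (take r l)) * e (drop s l)
      ≤⟨ *-monoˡ-≤ _ (ι-⊎ (light? V) (hit? light? (V - x) (take r l))) ⟩
    (ι (light? V) + ι (hit? light? (V - x) (take r l))) * e (drop s l)
      ≡⟨ *-distribʳ-+ (e (drop s l)) (ι (light? V)) _ ⟩
    ι (light? V) * e (drop s l) + ι (hit? light? (V - x) (take r l)) * e (drop s l)
      ≤⟨ +-mono-≤ (ι*-mono (light? V) λ _ →
           ι-mono (hit? light? Z (take R (drop s l))) (hit? (lightAdj? V) Z (take R (drop s l)))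
             (hit-neighbour V⊆Z ⊆-refl inj₂ (take⁺ R (drop⁺ s (All.map (V-x⊆V V x) (Seq-All sq))))))
           (pair≤Φ r s sq (⊆-trans (V-x⊆V V x) V⊆Z) r≤s) ⟩
    ψ V (drop s l) + Φ r s (V - x) l ∎
    where open ≤-Reasoning

  Local-take : (f : List (Fin n) → ℕ) → Local R (f ∘ take R)
  Local-take f l l′ h = cong f (take-++ R l l′ h)

  neighbour-⊆ : ∀ {V B} → V ∪ B ≡ Z → B ⊆ Z
  neighbour-⊆ {V} {B} refl = q⊆p∪q V B

  -- A light `B` misses at least two elements of `Z`, since otherwise it would be exceptional. Hence
  -- it is met with probability at most 2 / (v (v - 1)); this square is what pays for the `R` + 1
  -- positions in `Φ`.
  ∑ᵒ-visits-light : ∀ {V v B} → V ⊆ Z → ∣ V ∣ ≡ v → 2 + R ≤ v → LightAdj V B →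
    suc R * (suc R * ∑ᵒ V v (λ l → visits (δ B) Z (take R l))) ≤ 2 * v !
  ∑ᵒ-visits-light {V} {v} {B} V⊆Z eqv R≤v ((prB , ¬exc) , V∪B≡Z) with codim prB (neighbour-⊆ {V} V∪B≡Z)
  ... | zero  , c≡ , r<R = ⊥-elim (¬exc (inj₂ (prB , neighbour-⊆ {V} V∪B≡Z , sym c≡)))
  -- `B` misses 2 + r ≤ `R` elements and v ≥ 2 + `R`, so at least two entries follow them; s counts
  -- the entries beyond those two.
  ... | suc r , c≡ , r<R with v ∸ (4 + r) in eq
  ... | s = begin
    suc R * (suc R * ∑ᵒ V v (λ l → visits (δ B) Z (take R l)))
      ≤⟨ *-monoʳ-≤ (suc R) (*-monoʳ-≤ (suc R) (∑ᵒ-visits-≤ R v (2 + r) V⊆Z (neighbour-⊆ {V} V∪B≡Z) eqv c≡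
           (≤-trans r<R (≤-trans (m≤n+m R 2) R≤v)))) ⟩
    suc R * (suc R * ((2 + r) ! * (v ∸ (2 + r)) !))
      ≡⟨ cong (λ z → suc R * (suc R * ((2 + r) ! * z !))) (trans (cong (_∸ (2 + r)) v≡) (trans (cong (_∸ (2 + r)) (comm₄ r s)) (m+n∸m≡n (2 + r) (2 + s)))) ⟩
    suc R * (suc R * ((2 + r) ! * (2 + s) !))
      ≤⟨ *-monoʳ-≤ (suc R) (*-monoʳ-≤ (suc R) (m!*n!≤2*[m+n-2]! r s)) ⟩
    suc R * (suc R * (2 * (2 + (r + s)) !))
      ≤⟨ *-mono-≤ (≤-trans (n≤1+n _) 2+R≤) (*-monoˡ-≤ (2 * (2 + (r + s)) !) (s≤s⁻¹ 2+R≤)) ⟩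
    (4 + (r + s)) * ((3 + (r + s)) * (2 * (2 + (r + s)) !))
      ≡⟨ swap (4 + (r + s)) (3 + (r + s)) 2 ((2 + (r + s)) !) ⟩
    2 * (4 + (r + s)) !
      ≡⟨ cong (λ z → 2 * z !) v≡ ⟨
    2 * v ! ∎
    where
    open ≤-Reasoning
    v≡ : v ≡ 4 + (r + s)
    v≡ = trans (sym (m+[n∸m]≡n (≤-trans (+-monoʳ-≤ 2 r<R) R≤v))) (cong (4 + r +_) eq)
    2+R≤ : 2 + R ≤ 4 + (r + s)
    2+R≤ = ≤-trans R≤v (≤-reflexive v≡)
    comm₄ : ∀ r s → 4 + (r + s) ≡ 2 + r + (2 + s)
    comm₄ = solve-∀
    swap : ∀ x y a z → x * (y * (a * z)) ≡ a * (x * (y * z))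
    swap = solve-∀

  -- `V` is not heavy, so it has fewer than `d` partners, and each is bounded by `∑ᵒ-visits-light`.
  -- The offset s disappears by `∑ᵒ-drop`.
  ∑ᵒ-ψ : ∀ {V v} s → V ⊆ Z → ∣ V ∣ ≡ v → 2 + R ≤ v → s + R ≤ v →
    suc R * (suc R * ∑ᵒ V v (ψ V ∘ drop s)) ≤ d * (2 * v !)
  ∑ᵒ-ψ {V} {v} s V⊆Z eqv R≤v s+R≤v with light? V
  ... | no _ = ≤-trans (≤-reflexive (trans (cong (λ z → suc R * (suc R * z)) (trans (∑ᵒ-const V v eqv 0) (*-zeroʳ (v !))))
                                           (trans (cong (suc R *_) (*-zeroʳ (suc R))) (*-zeroʳ (suc R))))) z≤n
  ... | yes (prV , ¬exc) = begin
    suc R * (suc R * ∑ᵒ V v (λ l → 1 * ι (hit? (lightAdj? V) Z (take R (drop s l)))))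
      ≡⟨ cong (λ z → suc R * (suc R * z)) (trans (∑ᵒ-cong V v λ _ → *-identityˡ _)
           (∑ᵒ-drop V v s R (Local-take (λ l → ι (hit? (lightAdj? V) Z l))) s+R≤v)) ⟩
    suc R * (suc R * ∑ᵒ V v (λ l → ι (hit? (lightAdj? V) Z (take R l))))
      ≤⟨ *-monoʳ-≤ (suc R) (*-monoʳ-≤ (suc R) (∑ᵒ-mono V v λ {l} _ → ι-hit≤visits (lightAdj? V) Z (take R l))) ⟩
    suc R * (suc R * ∑ᵒ V v (λ l → visits (ι ∘ lightAdj? V) Z (take R l)))
      ≡⟨ cong (λ z → suc R * (suc R * z)) (∑ᵒ-visits V v (ι ∘ lightAdj? V) Z (take R)) ⟩
    suc R * (suc R * ∑ˢ (λ B → ι (lightAdj? V B) * ∑ᵒ V v (λ l → visits (δ B) Z (take R l))))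
      ≡⟨ trans (cong (suc R *_) (∑ˢ-*ˡ {n} (suc R) _)) (∑ˢ-*ˡ {n} (suc R) _) ⟩
    ∑ˢ (λ B → suc R * (suc R * (ι (lightAdj? V B) * ∑ᵒ V v (λ l → visits (δ B) Z (take R l)))))
      ≤⟨ ∑ˢ-mono (λ B → ≤-trans (≤-reflexive (swap (suc R) (ι (lightAdj? V B)) _))
           (ι*-mono (lightAdj? V B) (∑ᵒ-visits-light V⊆Z eqv R≤v))) ⟩
    ∑ˢ (λ B → ι (lightAdj? V B) * (2 * v !))
      ≡⟨ ∑ˢ-*ʳ (ι ∘ lightAdj? V) _ ⟩
    ∑ˢ (ι ∘ lightAdj? V) * (2 * v !)
      ≤⟨ *-monoˡ-≤ _ (≤-trans (∑ˢ-mono λ B → ι-mono (lightAdj? V B) (adj? V B) λ ((prB , _) , eq) → prB , eq)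
           (<⇒≤ (≰⇒> λ d≤ → ¬exc (inj₁ (prV , d≤))))) ⟩
    d * (2 * v !) ∎
    where
    open ≤-Reasoning
    swap : ∀ x y z → x * (x * (y * z)) ≡ y * (x * (x * z))
    swap = solve-∀

  -- Adds `∑ᵒ-ψ` over r + 1 positions. The hypothesis r + (2 + `R`) ≤ v keeps every set on this
  -- stretch of the chain large enough for it.
  ∑ᵒ-Φ : ∀ {V v} r s → V ⊆ Z → ∣ V ∣ ≡ v → r + (2 + R) ≤ v → s + R ≤ v → r ≤ s →
    suc R * (suc R * ∑ᵒ V v (Φ r s V)) ≤ suc r * (d * (2 * v !))
  ∑ᵒ-Φ zero s V⊆Z eqv r≤v s≤v r≤s = ≤-trans (∑ᵒ-ψ s V⊆Z eqv r≤v s≤v) (≤-reflexive (sym (*-identityˡ _)))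
  ∑ᵒ-Φ {V} {suc v} (suc r) (suc s) V⊆Z eqv (s≤s r≤v) (s≤s s≤v) (s≤s r≤s) = begin
    suc R * (suc R * ∑ᵒ V (suc v) (Φ (suc r) (suc s) V))
      ≡⟨ cong (λ z → suc R * (suc R * z)) (trans (∑∈-cong V λ {x} _ → ∑ᵒ-+ (V - x) v (ψ V ∘ drop s) (Φ r s (V - x)))
           (∑∈-+ V (λ x → ∑ᵒ (V - x) v (ψ V ∘ drop s)) (λ x → ∑ᵒ (V - x) v (Φ r s (V - x))))) ⟩
    suc R * (suc R * (∑ᵒ V (suc v) (ψ V ∘ drop (suc s)) + ∑∈ V (λ x → ∑ᵒ (V - x) v (Φ r s (V - x)))))
      ≡⟨ distrib (suc R) (∑ᵒ V (suc v) (ψ V ∘ drop (suc s))) _ ⟩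
    suc R * (suc R * ∑ᵒ V (suc v) (ψ V ∘ drop (suc s))) + suc R * (suc R * ∑∈ V (λ x → ∑ᵒ (V - x) v (Φ r s (V - x))))
      ≤⟨ +-mono-≤ (∑ᵒ-ψ (suc s) V⊆Z eqv (≤-trans (m≤n+m (2 + R) (suc r)) (s≤s r≤v)) (s≤s s≤v)) (begin
           suc R * (suc R * ∑∈ V (λ x → ∑ᵒ (V - x) v (Φ r s (V - x))))
             ≡⟨ trans (∑∈-*ˡ V (suc R) _) (cong (suc R *_) (∑∈-*ˡ V (suc R) _)) ⟨
           ∑∈ V (λ x → suc R * (suc R * ∑ᵒ (V - x) v (Φ r s (V - x))))
             ≤⟨ ∑∈-mono V (λ {x} x∈V → ∑ᵒ-Φ r s (⊆-trans (V-x⊆V V x) V⊆Z) (∣V-x∣≡ eqv x∈V) r≤v s≤v r≤s) ⟩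
           ∑∈ V (λ _ → suc r * (d * (2 * v !)))
             ≡⟨ trans (∑∈-const V _) (cong (_* (suc r * (d * (2 * v !)))) eqv) ⟩
           suc v * (suc r * (d * (2 * v !)))
             ≡⟨ swap (suc v) (suc r) d 2 (v !) ⟩
           suc r * (d * (2 * suc v !)) ∎) ⟩
    d * (2 * suc v !) + suc r * (d * (2 * suc v !)) ∎
    where
    open ≤-Reasoning
    swap : ∀ v r d t f → v * (r * (d * (t * f))) ≡ r * (d * (t * (v * f)))
    swap = solve-∀
    distrib : ∀ k a b → k * (k * (a + b)) ≡ k * (k * a) + k * (k * b)
    distrib = solve-∀

  ∑ᵒ-pair : ∀ s → R ≤ s → s + R ≤ c → suc R * ∑ᵒ Z c (λ l → e l * e (drop s l)) ≤ d * (2 * c !)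
  ∑ᵒ-pair s R≤s s+R≤c = *-cancelˡ-≤ (suc R) (≤-trans
    (*-monoʳ-≤ (suc R) (*-monoʳ-≤ (suc R) (∑ᵒ-mono Z c λ sq → pair≤Φ R s sq ⊆-refl R≤s)))
    (∑ᵒ-Φ R s ⊆-refl refl wide s+R≤c R≤s))

  -- Each block starts again at `Z` instead of continuing the chain of the previous one, so all
  -- blocks are equally distributed.
  blocks : ℕ → List (Fin n) → ℕ
  blocks zero    l = 0
  blocks (suc b) l = e l + blocks b (drop R l)

  pairs : ℕ → List (Fin n) → ℕ
  pairs zero    l = 0
  pairs (suc b) l = e l * blocks b (drop R l) + pairs b (drop R l)

  -- If j ≥ 1 blocks succeed, there are j (j - 1) / 2 ≥ j - 1 pairs.
  blocks≤1+pairs : ∀ b l → blocks b l ≤ 1 + pairs b l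
  blocks≤1+pairs zero    l = z≤n
  blocks≤1+pairs (suc b) l with hit? light? Z (take R l)
  ... | yes _ = s≤s (≤-trans (≤-reflexive (sym (*-identityˡ (blocks b (drop R l))))) (m≤m+n _ _))
  ... | no _  = blocks≤1+pairs b (drop R l)

  Local-blocks : ∀ b → Local (b * R) (blocks b)
  Local-blocks zero    l l′ h = refl
  Local-blocks (suc b) l l′ h = cong₂ _+_ (Local-take (λ l → ι (hit? light? Z l)) l l′ (≤-trans (m≤m+n R (b * R)) h))
    (Local-drop R (Local-blocks b) l l′ h)

  ∑ᵒ-blocks : ∀ b s → s + b * R ≤ c → ∑ᵒ Z c (blocks b ∘ drop s) ≡ b * ∑ᵒ Z c e
  ∑ᵒ-blocks zero    s h = trans (∑ᵒ-const Z c refl 0) (*-zeroʳ (c !))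
  ∑ᵒ-blocks (suc b) s h = begin
    ∑ᵒ Z c (λ l → e (drop s l) + blocks b (drop R (drop s l)))
      ≡⟨ ∑ᵒ-+ Z c (e ∘ drop s) _ ⟩
    ∑ᵒ Z c (e ∘ drop s) + ∑ᵒ Z c (λ l → blocks b (drop R (drop s l)))
      ≡⟨ cong₂ _+_ (∑ᵒ-drop Z c s R (Local-take (λ l → ι (hit? light? Z l))) (≤-trans (+-monoʳ-≤ s (m≤m+n R (b * R))) h))
           (trans (∑ᵒ-cong Z c λ {l} _ → cong (blocks b) (drop-drop s R l))
                  (∑ᵒ-blocks b (s + R) (≤-trans (≤-reflexive (+-assoc s R (b * R))) h))) ⟩
    suc b * ∑ᵒ Z c e ∎
    where open ≡-Reasoning

  ∑ᵒ-e*blocks : ∀ b s → R ≤ s → s + b * R ≤ c → suc R * ∑ᵒ Z c (λ l → e l * blocks b (drop s l)) ≤ b * (d * (2 * c !))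
  ∑ᵒ-e*blocks zero s R≤s h = ≤-reflexive (trans (cong (suc R *_) (trans (∑ᵒ-cong Z c λ {l} _ → *-zeroʳ (e l)) (trans (∑ᵒ-const Z c refl 0) (*-zeroʳ (c !))))) (*-zeroʳ (suc R)))
  ∑ᵒ-e*blocks (suc b) s R≤s h = begin
    suc R * ∑ᵒ Z c (λ l → e l * (e (drop s l) + blocks b (drop R (drop s l))))
      ≡⟨ cong (suc R *_) (trans (∑ᵒ-cong Z c λ {l} _ → trans (*-distribˡ-+ (e l) _ _)
           (cong (λ z → e l * e (drop s l) + e l * blocks b z) (drop-drop s R l))) (∑ᵒ-+ Z c (λ l → e l * e (drop s l)) _)) ⟩
    suc R * (∑ᵒ Z c (λ l → e l * e (drop s l)) + ∑ᵒ Z c (λ l → e l * blocks b (drop (s + R) l)))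
      ≡⟨ *-distribˡ-+ (suc R) (∑ᵒ Z c (λ l → e l * e (drop s l))) _ ⟩
    suc R * ∑ᵒ Z c (λ l → e l * e (drop s l)) + suc R * ∑ᵒ Z c (λ l → e l * blocks b (drop (s + R) l))
      ≤⟨ +-mono-≤ (∑ᵒ-pair s R≤s (≤-trans (+-monoʳ-≤ s (m≤m+n R (b * R))) h))
                  (∑ᵒ-e*blocks b (s + R) (≤-trans R≤s (m≤m+n s R)) (≤-trans (≤-reflexive (+-assoc s R (b * R))) h)) ⟩
    suc b * (d * (2 * c !)) ∎
    where open ≤-Reasoning

  -- Each block forms pairs with fewer than B later ones. B stays fixed in the induction so that
  -- every block is charged the same amount.
  ∑ᵒ-pairs : ∀ B b s → b ≤ B → s + b * R ≤ c → suc R * ∑ᵒ Z c (pairs b ∘ drop s) ≤ b * (B * (d * (2 * c !)))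
  ∑ᵒ-pairs B zero    s b≤B h = ≤-reflexive (trans (cong (suc R *_) (trans (∑ᵒ-const Z c refl 0) (*-zeroʳ (c !)))) (*-zeroʳ (suc R)))
  ∑ᵒ-pairs B (suc b) s b<B h = begin
    suc R * ∑ᵒ Z c (λ l → F (drop s l) + pairs b (drop R (drop s l)))
      ≡⟨ cong (suc R *_) (∑ᵒ-+ Z c (F ∘ drop s) _) ⟩
    suc R * (∑ᵒ Z c (F ∘ drop s) + ∑ᵒ Z c (λ l → pairs b (drop R (drop s l))))
      ≡⟨ *-distribˡ-+ (suc R) (∑ᵒ Z c (F ∘ drop s)) _ ⟩
    suc R * ∑ᵒ Z c (F ∘ drop s) + suc R * ∑ᵒ Z c (λ l → pairs b (drop R (drop s l)))
      ≡⟨ cong₂ (λ x y → suc R * x + suc R * y) (∑ᵒ-drop Z c s (R + b * R) {F} Local-F h)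
           (∑ᵒ-cong Z c λ {l} _ → cong (pairs b) (drop-drop s R l)) ⟩
    suc R * ∑ᵒ Z c F + suc R * ∑ᵒ Z c (pairs b ∘ drop (s + R))
      ≤⟨ +-mono-≤ (≤-trans (∑ᵒ-e*blocks b R ≤-refl (≤-trans (m≤n+m _ s) h)) (*-monoˡ-≤ _ (<⇒≤ b<B)))
                  (∑ᵒ-pairs B b (s + R) (<⇒≤ b<B) (≤-trans (≤-reflexive (+-assoc s R (b * R))) h)) ⟩
    suc b * (B * (d * (2 * c !))) ∎
    where
    open ≤-Reasoning
    F : List (Fin n) → ℕ
    F l = e l * blocks b (drop R l)
    Local-F : Local (R + b * R) F
    Local-F l l′ h = cong₂ _*_ (Local-take (λ l → ι (hit? light? Z l)) l l′ (≤-trans (m≤m+n R (b * R)) h))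
      (Local-drop R (Local-blocks b) l l′ h)

  -- In expectation at most 1 + 1/2 blocks succeed, because `dense` bounds the expected number of
  -- pairs by 1/2; this equals b times the probability for one block. Exceptional sets add at most
  -- 2bd/c ≤ 1/2. The statement is doubled to clear the halves: 3 + 1 = 2 * 2.
  thin : ∀ b → 1 ≤ b → b * R ≤ c → 4 * (b * (b * d)) ≤ suc R →
    b * ∑ᵒ Z c (λ l → ι (hit? proper? Z (take R l))) ≤ 2 * c !
  thin b 1≤b bR≤c dense = *-cancelˡ-≤ 2 (begin
    2 * (b * ∑ᵒ Z c (λ l → ι (hit? proper? Z (take R l))))
      ≤⟨ *-monoʳ-≤ 2 (*-monoʳ-≤ b (∑ᵒ-mono Z c λ {l} _ → ι-hit-⊎ proper? light? exceptional? split Z (take R l))) ⟩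
    2 * (b * ∑ᵒ Z c (λ l → e l + visits (ι ∘ exceptional?) Z (take R l)))
      ≡⟨ cong (λ z → 2 * (b * z)) (∑ᵒ-+ Z c e _) ⟩
    2 * (b * (∑ᵒ Z c e + X))
      ≡⟨ distrib b (∑ᵒ Z c e) X ⟩
    2 * (b * ∑ᵒ Z c e) + 2 * (b * X)
      ≤⟨ +-mono-≤ light-bound exceptional-bound ⟩
    3 * c ! + c !
      ≡⟨ four (c !) ⟩
    2 * (2 * c !) ∎)
    where
    open ≤-Reasoning
    X : ℕ
    X = ∑ᵒ Z c (λ l → visits (ι ∘ exceptional?) Z (take R l))
    distrib : ∀ b x y → 2 * (b * (x + y)) ≡ 2 * (b * x) + 2 * (b * y)
    distrib = solve-∀
    four : ∀ x → 3 * x + x ≡ 2 * (2 * x)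
    four = solve-∀
    split : ∀ {A} → Proper A → Light A ⊎ Exceptional A
    split {A} prA with exceptional? A
    ... | yes ex = inj₂ ex
    ... | no ¬ex = inj₁ (prA , ¬ex)
    light-bound : 2 * (b * ∑ᵒ Z c e) ≤ 3 * c !
    light-bound = *-cancelˡ-≤ (suc R) (begin
      suc R * (2 * (b * ∑ᵒ Z c e))
        ≡⟨ cong (λ z → suc R * (2 * z)) (∑ᵒ-blocks b 0 bR≤c) ⟨
      suc R * (2 * ∑ᵒ Z c (blocks b))
        ≤⟨ *-monoʳ-≤ (suc R) (*-monoʳ-≤ 2 (∑ᵒ-mono Z c λ {l} _ → blocks≤1+pairs b l)) ⟩
      suc R * (2 * ∑ᵒ Z c (λ l → 1 + pairs b l))
        ≡⟨ cong (λ z → suc R * (2 * z)) (trans (∑ᵒ-+ Z c (λ _ → 1) (pairs b)) (cong (_+ ∑ᵒ Z c (pairs b)) (∑ᵒ-const Z c refl 1))) ⟩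
      suc R * (2 * (c ! * 1 + ∑ᵒ Z c (pairs b)))
        ≡⟨ lemma₁ (suc R) (c !) _ ⟩
      suc R * (2 * c !) + 2 * (suc R * ∑ᵒ Z c (pairs b))
        ≤⟨ +-monoʳ-≤ (suc R * (2 * c !)) (*-monoʳ-≤ 2 (∑ᵒ-pairs b b 0 ≤-refl bR≤c)) ⟩
      suc R * (2 * c !) + 2 * (b * (b * (d * (2 * c !))))
        ≡⟨ cong (suc R * (2 * c !) +_) (lemma₂ b d (c !)) ⟩
      suc R * (2 * c !) + 4 * (b * (b * d)) * c !
        ≤⟨ +-monoʳ-≤ (suc R * (2 * c !)) (*-monoˡ-≤ (c !) dense) ⟩
      suc R * (2 * c !) + suc R * c !
        ≡⟨ lemma₃ (suc R) (c !) ⟩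
      suc R * (3 * c !) ∎)
      where
      lemma₁ : ∀ r f p → r * (2 * (f * 1 + p)) ≡ r * (2 * f) + 2 * (r * p)
      lemma₁ = solve-∀
      lemma₂ : ∀ b d f → 2 * (b * (b * (d * (2 * f)))) ≡ 4 * (b * (b * d)) * f
      lemma₂ = solve-∀
      lemma₃ : ∀ r f → r * (2 * f) + r * f ≡ r * (3 * f)
      lemma₃ = solve-∀
    c≥ : suc R ≤ c
    c≥ = ≤-trans (≤-trans (n≤1+n (suc R)) (m≤n+m (2 + R) R)) wide
    exceptional-bound : 2 * (b * X) ≤ c !
    exceptional-bound = cancel c≥ (begin
      c * (2 * (b * X))          ≡⟨ lemma₁ c b X ⟩
      2 * b * (c * X)            ≤⟨ *-monoʳ-≤ (2 * b) ∑ᵒ-exceptional ⟩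
      2 * b * (2 * d * c !)      ≡⟨ lemma₂ b d (c !) ⟩
      4 * (1 * (b * d)) * c !    ≤⟨ *-monoˡ-≤ (c !) (≤-trans (*-monoʳ-≤ 4 (*-monoˡ-≤ (b * d) 1≤b)) (≤-trans dense c≥)) ⟩
      c * c !                    ∎)
      where
      cancel : ∀ {k x y} → suc R ≤ k → k * x ≤ k * y → x ≤ y
      cancel {suc k} _ h = *-cancelˡ-≤ (suc k) h
      lemma₁ : ∀ c b x → c * (2 * (b * x)) ≡ 2 * b * (c * x)
      lemma₁ = solve-∀
      lemma₂ : ∀ b d f → 2 * b * (2 * d * f) ≡ 4 * (1 * (b * d)) * f
      lemma₂ = solve-∀

-- Central binomial coefficients

C*k!*[n∸k]! : ∀ {k} → k ≤ n → (n C k) * (k ! * (n ∸ k) !) ≡ n !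
C*k!*[n∸k]! {n} {k} k≤n = trans (cong (_* (k ! * (n ∸ k) !)) (nCk≡n!/k![n-k]! k≤n))
  (m/n*n≡m {{k !* (n ∸ k) !≢0}} (k![n∸k]!∣n! k≤n))

-- After cancelling x! and y!, i factors remain on each side: those on the left are at most x + i,
-- those on the right at least y + 1.
!-balance : ∀ i x y → x + i ≤ suc y → (x + i) ! * y ! ≤ x ! * (y + i) !
!-balance zero    x y h rewrite +-identityʳ x | +-identityʳ y = ≤-refl
!-balance (suc i) x y h rewrite +-suc x i | +-suc y i = begin
  suc (x + i) * (x + i) ! * y !       ≤⟨ *-monoˡ-≤ (y !) (*-monoˡ-≤ ((x + i) !) h) ⟩
  suc y * (x + i) ! * y !             ≡⟨ swap (suc y) ((x + i) !) (y !) ⟩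
  (x + i) ! * suc y !                 ≤⟨ !-balance i x (suc y) (≤-trans (n≤1+n _) (m≤n⇒m≤1+n h)) ⟩
  x ! * suc (y + i) !                 ∎
  where
  open ≤-Reasoning
  swap : ∀ a b c → a * b * c ≡ b * (a * c)
  swap = solve-∀

n/2+n/2≤n : ∀ n → n / 2 + n / 2 ≤ n
n/2+n/2≤n n = ≤-trans (≤-reflexive (double (n / 2))) (m/n*n≤m n 2)
  where
  double : ∀ x → x + x ≡ x * 2
  double = solve-∀

n≤1+n/2+n/2 : ∀ n → n ≤ suc (n / 2 + n / 2)
n≤1+n/2+n/2 n = begin
  n                    ≡⟨ m≡m%n+[m/n]*n n 2 ⟩
  n % 2 + n / 2 * 2    ≤⟨ +-monoˡ-≤ (n / 2 * 2) (s≤s⁻¹ (m%n<n n 2)) ⟩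
  1 + n / 2 * 2        ≡⟨ cong suc (double (n / 2)) ⟩
  suc (n / 2 + n / 2)  ∎
  where
  open ≤-Reasoning
  double : ∀ x → x * 2 ≡ x + x
  double = solve-∀

halve-≤ : ∀ {a b} → a + a ≤ suc (b + b) → a ≤ b
halve-≤ {a} {b} h = s≤s⁻¹ (*-cancelʳ-< 2 a (suc b) (begin
  suc (a * 2)          ≡⟨ cong suc (double a) ⟩
  suc (a + a)          ≤⟨ s≤s h ⟩
  suc (suc (b + b))    ≡⟨ cong (2 +_) (double b) ⟨
  suc b * 2            ∎))
  where
  open ≤-Reasoning
  double : ∀ x → x * 2 ≡ x + x
  double = solve-∀

central-!-≤ : ∀ k a → a ≤ k → (k + a) ! ≤ ((k + a) C ((k + a) / 2)) * (k ! * a !)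
central-!-≤ k a a≤k = begin
  p !                        ≡⟨ C*k!*[n∸k]! h≤n ⟨
  (p C h) * (h ! * (p ∸ h) !)  ≤⟨ *-monoʳ-≤ (p C h) balanced ⟩
  (p C h) * (k ! * a !)        ∎
  where
  open ≤-Reasoning
  p = k + a
  h = p / 2
  h≤n : h ≤ p
  h≤n = ≤-trans (m≤m+n h h) (n/2+n/2≤n p)
  a≤h : a ≤ h
  a≤h = halve-≤ (≤-trans (+-monoˡ-≤ a a≤k) (n≤1+n/2+n/2 p))
  i = h ∸ a
  a+i≡h : a + i ≡ h
  a+i≡h = m+[n∸m]≡n a≤h
  h≤n∸h : h ≤ p ∸ h
  h≤n∸h = m+n≤o⇒m≤o∸n h (n/2+n/2≤n p)
  k≡ : k ≡ p ∸ h + i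
  k≡ = +-cancelʳ-≡ a k (p ∸ h + i) (begin-equality
    p                  ≡⟨ m∸n+n≡m h≤n ⟨
    p ∸ h + h          ≡⟨ cong (p ∸ h +_) a+i≡h ⟨
    p ∸ h + (a + i)    ≡⟨ shuffle (p ∸ h) a i ⟩
    p ∸ h + i + a      ∎)
    where
    shuffle : ∀ x y z → x + (y + z) ≡ x + z + y
    shuffle = solve-∀
  balanced : h ! * (p ∸ h) ! ≤ k ! * a !
  balanced = begin
    h ! * (p ∸ h) !          ≡⟨ cong (λ z → z ! * (p ∸ h) !) a+i≡h ⟨
    (a + i) ! * (p ∸ h) !    ≤⟨ !-balance i a (p ∸ h) (≤-trans (≤-reflexive a+i≡h) (m≤n⇒m≤1+n h≤n∸h)) ⟩
    a ! * (p ∸ h + i) !      ≡⟨ cong (λ z → a ! * z !) k≡ ⟨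
    a ! * k !                ≡⟨ *-comm (a !) (k !) ⟩
    k ! * a !                ∎

central-! : ∀ k a → (k + a) ! ≤ ((k + a) C ((k + a) / 2)) * (k ! * a !)
central-! k a with ≤-total a k
... | inj₁ a≤k = central-!-≤ k a a≤k
... | inj₂ k≤a = subst₂ (λ x y → x ! ≤ (x C (x / 2)) * y) (+-comm a k) (*-comm (a !) (k !)) (central-!-≤ a k k≤a)

central-≥ : ∀ n k → n C k ≤ n C (n / 2)
central-≥ n k with k ≤? n
... | no k≰n = subst (_≤ n C (n / 2)) (sym (k>n⇒nCk≡0 (≰⇒> k≰n))) z≤n
... | yes k≤n = *-cancelʳ-≤ (n C k) (n C (n / 2)) (k ! * (n ∸ k) !) {{k !* (n ∸ k) !≢0}} (begin
  (n C k) * (k ! * (n ∸ k) !)          ≡⟨ C*k!*[n∸k]! k≤n ⟩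
  n !                                  ≡⟨ cong _! (m+[n∸m]≡n k≤n) ⟨
  (k + (n ∸ k)) !                      ≤⟨ central-! k (n ∸ k) ⟩
  ((k + (n ∸ k)) C ((k + (n ∸ k)) / 2)) * (k ! * (n ∸ k) !) ≡⟨ cong (λ z → (z C (z / 2)) * (k ! * (n ∸ k) !)) (m+[n∸m]≡n k≤n) ⟩
  (n C (n / 2)) * (k ! * (n ∸ k) !)    ∎)
  where open ≤-Reasoning

∑ˢ-level : ∀ n k → ∑ˢ {n} (λ V → ι (∣ V ∣ ≟ k)) ≡ n C k
∑ˢ-level zero    zero    = refl
∑ˢ-level zero    (suc k) = refl
∑ˢ-level (suc n) zero    = trans (cong₂ _+_ (∑ˢ-level n 0) (∑ˢ-zero {n} λ V → ι-no (suc ∣ V ∣ ≟ 0) λ ())) refl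
∑ˢ-level (suc n) (suc k) = begin
  ∑ˢ {n} (λ V → ι (∣ V ∣ ≟ suc k)) + ∑ˢ {n} (λ V → ι (suc ∣ V ∣ ≟ suc k))
    ≡⟨ cong₂ _+_ (∑ˢ-level n (suc k)) (trans (∑ˢ-cong {n} λ V → ι-cong (suc ∣ V ∣ ≟ suc k) (∣ V ∣ ≟ k) suc-injective (cong suc)) (∑ˢ-level n k)) ⟩
  n C suc k + n C k    ≡⟨ +-comm (n C suc k) (n C k) ⟩
  n C k + n C suc k    ≡⟨ nCk+nC[k+1]≡[n+1]C[k+1] n k ⟩
  suc n C suc k        ∎
  where open ≡-Reasoning

-- Each set A lies on at least ∣ A ∣ ! (n - ∣ A ∣) ! of the n ! maximal chains, and this is at least
-- n ! / C(n, n/2).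
lym : (g : Subset n → ℕ) → ∑ˢ g * n ! ≤ (n C (n / 2)) * ∑ᵒ ⊤ n (visits g ⊤)
lym {n} g = begin
  ∑ˢ g * n !
    ≡⟨ ∑ˢ-*ʳ g (n !) ⟨
  ∑ˢ (λ A → g A * n !)
    ≤⟨ ∑ˢ-mono pointwise ⟩
  ∑ˢ (λ A → N * (g A * ∑ᵒ ⊤ n (visits (δ A) ⊤)))
    ≡⟨ ∑ˢ-*ˡ {n} N _ ⟨
  N * ∑ˢ (λ A → g A * ∑ᵒ ⊤ n (visits (δ A) ⊤))
    ≡⟨ cong (N *_) (∑ᵒ-visits ⊤ n g ⊤ (λ l → l)) ⟨
  N * ∑ᵒ ⊤ n (visits g ⊤) ∎
  where
  open ≤-Reasoning
  N = n C (n / 2)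
  pointwise : ∀ A → g A * n ! ≤ N * (g A * ∑ᵒ ⊤ n (visits (δ A) ⊤))
  pointwise A = begin
    g A * n !
      ≤⟨ *-monoʳ-≤ (g A) (subst (λ z → z ! ≤ (z C (z / 2)) * ((n ∸ a) ! * a !)) (m∸n+n≡m (∣p∣≤n A)) (central-! (n ∸ a) a)) ⟩
    g A * (N * ((n ∸ a) ! * a !))
      ≤⟨ *-monoʳ-≤ (g A) (*-monoʳ-≤ N (∑ᵒ-visits-≥ (n ∸ a) n ⊆⊤ (trans (∣⊤∣≡n n) (sym (m∸n+n≡m (∣p∣≤n A)))) (∣⊤∣≡n n))) ⟩
    g A * (N * ∑ᵒ ⊤ n (visits (δ A) ⊤))
      ≡⟨ swap (g A) N _ ⟩
    N * (g A * ∑ᵒ ⊤ n (visits (δ A) ⊤)) ∎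
    where
    a = ∣ A ∣
    swap : ∀ x y z → x * (y * z) ≡ y * (x * z)
    swap = solve-∀

-- With b = 2 + β the bound b S ≤ b n ! + 2 S on the total S of visits becomes β S ≤ (2 + β) n !. An
-- average chain thus meets at most 1 + 2/β members, and `lym` turns this into a bound on their
-- number.
supersaturation : {u : Subset n → Set} (u? : Decidable u) (R d β : ℕ) →
  (∀ {A B} → u A → u B → ∣ A ∣ ≤ R + ∣ B ∣) →
  (∀ {Z} → u Z → R + (2 + R) ≤ ∣ Z ∣) →
  (∀ {Z} → u Z → (2 + β) * R ≤ ∣ Z ∣) →
  4 * ((2 + β) * ((2 + β) * d)) ≤ suc R →
  (∀ {Z} → u Z → ∑ˢ (ι ∘ Degrees.heavy? u? Z d) ≤ d) →
  β * ∑ˢ (ι ∘ u?) ≤ (2 + β) * (n C (n / 2))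
supersaturation {n} u? R d β near wide long dense few =
  *-cancelʳ-≤ (β * ∑ˢ (ι ∘ u?)) ((2 + β) * N) (n !) {{n !≢0}} (begin
    β * ∑ˢ (ι ∘ u?) * n !       ≡⟨ *-assoc β _ (n !) ⟩
    β * (∑ˢ (ι ∘ u?) * n !)     ≤⟨ *-monoʳ-≤ β (lym (ι ∘ u?)) ⟩
    β * (N * S)                 ≡⟨ swap β N S ⟩
    N * (β * S)                 ≤⟨ *-monoʳ-≤ N βS≤ ⟩
    N * ((2 + β) * n !)         ≡⟨ shuffle N (2 + β) (n !) ⟩
    (2 + β) * N * n !           ∎)
  where
  open ≤-Reasoning
  open Chains u? R near
  N S : ℕ
  N = n C (n / 2)
  S = ∑ᵒ ⊤ n (visits (ι ∘ u?) ⊤)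
  swap : ∀ x y z → x * (y * z) ≡ y * (x * z)
  swap = solve-∀
  shuffle : ∀ x y z → x * (y * z) ≡ y * x * z
  shuffle = solve-∀
  βS≤ : β * S ≤ (2 + β) * n !
  βS≤ = +-cancelˡ-≤ (2 * S) (β * S) ((2 + β) * n !) (begin
    2 * S + β * S                    ≡⟨ *-distribʳ-+ S 2 β ⟨
    (2 + β) * S                      ≤⟨ ∑ᵒ-visits-thin {2 + β} (λ {V} uV →
                                          Thin.thin u? V R d (near uV) (wide uV) (few uV) (2 + β) (s≤s z≤n) (long uV) dense) ⟩
    (2 + β) * n ! + 2 * S            ≡⟨ +-comm ((2 + β) * n !) (2 * S) ⟩
    2 * S + (2 + β) * n !            ∎)

-- Concentration near the middle layers

∣∣+∣∁∣ : (V : Subset n) → ∣ V ∣ + ∣ ∁ V ∣ ≡ n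
∣∣+∣∁∣ V = trans (cong (∣ V ∣ +_) (∣∁p∣≡n∸∣p∣ V)) (m+[n∸m]≡n (∣p∣≤n V))

-- Twice the distance of ∣ V ∣ from n/2, which stays integral.
dev : Subset n → ℕ
dev V = dist ∣ V ∣ (∣ ∁ V ∣)

dist²-≤ : ∀ {a b} → a ≤ b → dist a b * dist a b + 2 * (a * b) ≡ a * a + b * b
dist²-≤ {a} {b} a≤b rewrite m≤n⇒∣m-n∣≡n∸m a≤b = begin
  k * k + 2 * (a * b)              ≡⟨ cong (λ z → k * k + 2 * (a * z)) b≡ ⟨
  k * k + 2 * (a * (a + k))        ≡⟨ lemma a k ⟩
  a * a + (a + k) * (a + k)        ≡⟨ cong (λ z → a * a + z * z) b≡ ⟩
  a * a + b * b                    ∎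
  where
  open ≡-Reasoning
  k = b ∸ a
  b≡ : a + k ≡ b
  b≡ = m+[n∸m]≡n a≤b
  lemma : ∀ a k → k * k + 2 * (a * (a + k)) ≡ a * a + (a + k) * (a + k)
  lemma = solve-∀

dist² : ∀ a b → dist a b * dist a b + 2 * (a * b) ≡ a * a + b * b
dist² a b with ≤-total a b
... | inj₁ a≤b = dist²-≤ a≤b
... | inj₂ b≤a = trans (cong₂ (λ x y → x * x + 2 * y) (∣-∣-comm a b) (*-comm a b))
  (trans (dist²-≤ b≤a) (+-comm (b * b) (a * a)))

-- This is (x - 1)² + (x + 1)² = 2 x² + 2 for x = a - b. Adding the products 2ab via `dist²` avoids
-- negative numbers.
dist²-step : ∀ a b → let sq = λ x y → dist x y * dist x y in sq a (suc b) + sq (suc a) b ≡ 2 * sq a b + 2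
dist²-step a b = +-cancelʳ-≡ (2 * (a * suc b) + 2 * (suc a * b)) _ _ (begin
  sq a (suc b) + sq (suc a) b + (2 * (a * suc b) + 2 * (suc a * b))
    ≡⟨ lemma₁ (sq a (suc b)) (sq (suc a) b) (2 * (a * suc b)) (2 * (suc a * b)) ⟩
  (sq a (suc b) + 2 * (a * suc b)) + (sq (suc a) b + 2 * (suc a * b))
    ≡⟨ cong₂ _+_ (dist² a (suc b)) (dist² (suc a) b) ⟩
  (a * a + suc b * suc b) + (suc a * suc a + b * b)
    ≡⟨ lemma₂ a b ⟩
  2 * (a * a + b * b) + 2 + (2 * a + 2 * b)
    ≡⟨ cong (λ z → 2 * z + 2 + (2 * a + 2 * b)) (dist² a b) ⟨
  2 * (sq a b + 2 * (a * b)) + 2 + (2 * a + 2 * b)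
    ≡⟨ lemma₃ (sq a b) a b ⟩
  2 * sq a b + 2 + (2 * (a * suc b) + 2 * (suc a * b)) ∎)
  where
  open ≡-Reasoning
  sq : ℕ → ℕ → ℕ
  sq x y = dist x y * dist x y
  lemma₁ : ∀ x y z w → x + y + (z + w) ≡ (x + z) + (y + w)
  lemma₁ = solve-∀
  lemma₂ : ∀ a b → (a * a + (1 + b) * (1 + b)) + ((1 + a) * (1 + a) + b * b) ≡ 2 * (a * a + b * b) + 2 + (2 * a + 2 * b)
  lemma₂ = solve-∀
  lemma₃ : ∀ s a b → 2 * (s + 2 * (a * b)) + 2 + (2 * a + 2 * b) ≡ 2 * s + 2 + (2 * (a * (1 + b)) + 2 * ((1 + a) * b))
  lemma₃ = solve-∀

-- `dev V` is the absolute value of a sum of n independent signs, and each coordinate adds 1 to the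
-- mean square.
variance : ∀ n → ∑ˢ {n} (λ V → dev V * dev V) ≡ n * 2 ^ n
variance zero    = refl
variance (suc n) = begin
  ∑ˢ {n} (λ V → dev (outside ∷ V) * dev (outside ∷ V)) + ∑ˢ {n} (λ V → dev (inside ∷ V) * dev (inside ∷ V))
    ≡⟨ ∑ˢ-+ {n} _ _ ⟨
  ∑ˢ {n} (λ V → dev (outside ∷ V) * dev (outside ∷ V) + dev (inside ∷ V) * dev (inside ∷ V))
    ≡⟨ ∑ˢ-cong {n} (λ V → dist²-step ∣ V ∣ (∣ ∁ V ∣)) ⟩
  ∑ˢ {n} (λ V → 2 * (dev V * dev V) + 2)
    ≡⟨ ∑ˢ-+ {n} _ _ ⟩
  ∑ˢ {n} (λ V → 2 * (dev V * dev V)) + ∑ˢ {n} (λ V → 2)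
    ≡⟨ cong₂ _+_ (trans (sym (∑ˢ-*ˡ {n} 2 _)) (cong (2 *_) (variance n))) (∑ˢ-const n 2) ⟩
  2 * (n * 2 ^ n) + 2 ^ n * 2
    ≡⟨ lemma n (2 ^ n) ⟩
  suc n * 2 ^ suc n ∎
  where
  open ≡-Reasoning
  lemma : ∀ n p → 2 * (n * p) + p * 2 ≡ (1 + n) * (2 * p)
  lemma = solve-∀

chebyshev : ∀ n w → w * w * ∑ˢ {n} (λ V → ι (w ≤? dev V)) ≤ n * 2 ^ n
chebyshev n w = begin
  w * w * ∑ˢ {n} (λ V → ι (w ≤? dev V))      ≡⟨ ∑ˢ-*ˡ {n} (w * w) _ ⟩
  ∑ˢ {n} (λ V → w * w * ι (w ≤? dev V))      ≤⟨ ∑ˢ-mono {n} pointwise ⟩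
  ∑ˢ {n} (λ V → dev V * dev V)               ≡⟨ variance n ⟩
  n * 2 ^ n                                  ∎
  where
  open ≤-Reasoning
  pointwise : (V : Subset n) → w * w * ι (w ≤? dev V) ≤ dev V * dev V
  pointwise V with w ≤? dev V
  ... | yes w≤ = ≤-trans (≤-reflexive (*-identityʳ (w * w))) (*-mono-≤ w≤ w≤)
  ... | no _   = ≤-trans (≤-reflexive (*-zeroʳ (w * w))) z≤n

∣V∣≤∣∁V∣+dev : (V : Subset n) → ∣ V ∣ ≤ ∣ ∁ V ∣ + dev V
∣V∣≤∣∁V∣+dev V = m≤n+∣m-n∣ ∣ V ∣ (∣ ∁ V ∣)

∣∁V∣≤∣V∣+dev : (V : Subset n) → ∣ ∁ V ∣ ≤ ∣ V ∣ + dev V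
∣∁V∣≤∣V∣+dev V = ≤-trans (m≤n+∣m-n∣ (∣ ∁ V ∣) ∣ V ∣) (≤-reflexive (cong (∣ V ∣ +_) (∣-∣-comm (∣ ∁ V ∣) ∣ V ∣)))

2∣V∣≤n+dev : (V : Subset n) → ∣ V ∣ + ∣ V ∣ ≤ n + dev V
2∣V∣≤n+dev {n} V = begin
  ∣ V ∣ + ∣ V ∣              ≤⟨ +-monoʳ-≤ ∣ V ∣ (∣V∣≤∣∁V∣+dev V) ⟩
  ∣ V ∣ + (∣ ∁ V ∣ + dev V)  ≡⟨ +-assoc ∣ V ∣ (∣ ∁ V ∣) (dev V) ⟨
  (∣ V ∣ + ∣ ∁ V ∣) + dev V  ≡⟨ cong (_+ dev V) (∣∣+∣∁∣ V) ⟩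
  n + dev V                  ∎
  where open ≤-Reasoning

n≤2∣V∣+dev : (V : Subset n) → n ≤ ∣ V ∣ + ∣ V ∣ + dev V
n≤2∣V∣+dev {n} V = begin
  n                          ≡⟨ ∣∣+∣∁∣ V ⟨
  ∣ V ∣ + ∣ ∁ V ∣            ≤⟨ +-monoʳ-≤ ∣ V ∣ (∣∁V∣≤∣V∣+dev V) ⟩
  ∣ V ∣ + (∣ V ∣ + dev V)    ≡⟨ +-assoc ∣ V ∣ ∣ V ∣ (dev V) ⟨
  ∣ V ∣ + ∣ V ∣ + dev V      ∎
  where open ≤-Reasoning

dev-near : ∀ {R} (A B : Subset n) → dev A ≤ R → dev B ≤ R → ∣ A ∣ ≤ R + ∣ B ∣
dev-near {n} {R} A B dA dB = halve-≤ (m≤n⇒m≤1+n (begin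
  ∣ A ∣ + ∣ A ∣                       ≤⟨ 2∣V∣≤n+dev A ⟩
  n + dev A                           ≤⟨ +-mono-≤ (n≤2∣V∣+dev B) dA ⟩
  (∣ B ∣ + ∣ B ∣ + dev B) + R         ≤⟨ +-monoˡ-≤ R (+-monoʳ-≤ (∣ B ∣ + ∣ B ∣) dB) ⟩
  (∣ B ∣ + ∣ B ∣ + R) + R             ≡⟨ lemma ∣ B ∣ R ⟩
  (R + ∣ B ∣) + (R + ∣ B ∣)           ∎))
  where
  open ≤-Reasoning
  lemma : ∀ b R → (b + b + R) + R ≡ (R + b) + (R + b)
  lemma = solve-∀

∑ˢ-window : ∀ n w → ∑ˢ {n} (λ V → ι (¬? (w ≤? dev V))) ≤ suc w * (n C (n / 2))
∑ˢ-window n w = begin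
  ∑ˢ {n} (λ V → ι (¬? (w ≤? dev V)))
    ≤⟨ ∑ˢ-mono {n} pointwise ⟩
  ∑ˢ {n} (λ V → sum {suc w} (λ j → ι (∣ V ∣ ≟ base + toℕ j)))
    ≡⟨ ∑-∑ˢ-comm {suc w} {n} (λ j V → ι (∣ V ∣ ≟ base + toℕ j)) ⟨
  sum {suc w} (λ j → ∑ˢ {n} (λ V → ι (∣ V ∣ ≟ base + toℕ j)))
    ≤⟨ ∑-mono {suc w} (λ j → ≤-trans (≤-reflexive (∑ˢ-level n (base + toℕ j))) (central-≥ n (base + toℕ j))) ⟩
  sum {suc w} (λ _ → n C (n / 2))
    ≡⟨ ∑-const (suc w) (n C (n / 2)) ⟩
  suc w * (n C (n / 2)) ∎
  where
  open ≤-Reasoning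
  ∑-const : ∀ m c → sum {m} (λ _ → c) ≡ m * c
  ∑-const zero    c = refl
  ∑-const (suc m) c = cong (c +_) (∑-const m c)
  base = (n ∸ w) / 2
  pointwise : (V : Subset n) → ι (¬? (w ≤? dev V)) ≤ sum {suc w} (λ j → ι (∣ V ∣ ≟ base + toℕ j))
  pointwise V with w ≤? dev V
  ... | yes _  = z≤n
  ... | no w≰ = begin
    1                                                  ≡⟨ ι-yes (∣ V ∣ ≟ base + toℕ j₀) (sym hit) ⟨
    ι (∣ V ∣ ≟ base + toℕ j₀)                          ≤⟨ ∑-term {suc w} (λ j → ι (∣ V ∣ ≟ base + toℕ j)) j₀ ⟩
    sum {suc w} (λ j → ι (∣ V ∣ ≟ base + toℕ j))       ∎
    where
    a = ∣ V ∣
    dev< : dev V < w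
    dev< = ≰⇒> w≰
    base≤a : base ≤ a
    base≤a = halve-≤ (begin
      base + base     ≤⟨ n/2+n/2≤n (n ∸ w) ⟩
      n ∸ w           ≤⟨ m≤n+o⇒m∸n≤o n w (≤-trans (n≤2∣V∣+dev V) (≤-trans (+-monoʳ-≤ (a + a) (<⇒≤ dev<)) (≤-reflexive (+-comm (a + a) w)))) ⟩
      a + a           ≤⟨ n≤1+n _ ⟩
      suc (a + a)     ∎)
    a≤ : a ≤ base + w
    a≤ = halve-≤ (begin
      a + a                              ≤⟨ 2∣V∣≤n+dev V ⟩
      n + dev V                          ≤⟨ +-mono-≤ (m≤n+m∸n n w) (<⇒≤ dev<) ⟩
      (w + (n ∸ w)) + w                  ≤⟨ +-monoˡ-≤ w (+-monoʳ-≤ w (n≤1+n/2+n/2 (n ∸ w))) ⟩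
      (w + suc (base + base)) + w        ≡⟨ lemma w base ⟩
      suc ((base + w) + (base + w))      ∎)
      where
      lemma : ∀ w b → (w + (1 + (b + b))) + w ≡ 1 + ((b + w) + (b + w))
      lemma = solve-∀
    j<  : a ∸ base < suc w
    j< = s≤s (m≤n+o⇒m∸n≤o a base a≤)
    j₀ : Fin (suc w)
    j₀ = fromℕ< j<
    hit : base + toℕ j₀ ≡ a
    hit = trans (cong (base +_) (Fin.toℕ-fromℕ< j<)) (m+[n∸m]≡n base≤a)

-- By Chebyshev at most a quarter of all sets deviate by w or more. The rest fill w + 1 levels, so
-- 3/4 of 2^n is at most (w + 1) C(n, n/2), and w + 1 ≤ 3w/2.
2^n≤w*central : ∀ n w → 1 ≤ n → 2 ≤ w → 4 * n ≤ w * w → 2 ^ n ≤ 2 * w * (n C (n / 2))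
2^n≤w*central n@(suc _) w 1≤n 2≤w 4n≤w² = *-cancelˡ-≤ 3 (+-cancelˡ-≤ (2 ^ n) _ _ (begin
  2 ^ n + 3 * 2 ^ n                   ≡⟨ lemma₁ (2 ^ n) ⟩
  4 * (2 ^ n * 1)                     ≡⟨ cong (4 *_) (∑ˢ-const n 1) ⟨
  4 * ∑ˢ {n} (λ _ → 1)                ≤⟨ *-monoʳ-≤ 4 (∑ˢ-mono {n} λ V → ι-split (w ≤? dev V)) ⟩
  4 * ∑ˢ {n} (λ V → ι (w ≤? dev V) + ι (¬? (w ≤? dev V)))
                                      ≡⟨ cong (4 *_) (∑ˢ-+ {n} (λ V → ι (w ≤? dev V)) (λ V → ι (¬? (w ≤? dev V)))) ⟩
  4 * (far + ∑ˢ {n} (λ V → ι (¬? (w ≤? dev V))))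
                                      ≤⟨ *-monoʳ-≤ 4 (+-monoʳ-≤ far (∑ˢ-window n w)) ⟩
  4 * (far + suc w * N)               ≡⟨ *-distribˡ-+ 4 far _ ⟩
  4 * far + 4 * (suc w * N)           ≤⟨ +-mono-≤ 4far≤ 4w≤ ⟩
  2 ^ n + 3 * (2 * w * N)             ∎))
  where
  open ≤-Reasoning
  N far : ℕ
  N = n C (n / 2)
  far = ∑ˢ {n} (λ V → ι (w ≤? dev V))
  lemma₁ : ∀ x → x + 3 * x ≡ 4 * (x * 1)
  lemma₁ = solve-∀
  ι-split : ∀ {P} (P? : Dec P) → 1 ≤ ι P? + ι (¬? P?)
  ι-split (yes _) = ≤-refl
  ι-split (no _)  = ≤-refl
  4far≤ : 4 * far ≤ 2 ^ n
  4far≤ = *-cancelˡ-≤ n (begin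
    n * (4 * far)    ≡⟨ lemma n far ⟩
    4 * n * far      ≤⟨ *-monoˡ-≤ far 4n≤w² ⟩
    w * w * far      ≤⟨ chebyshev n w ⟩
    n * 2 ^ n        ∎)
    where
    lemma : ∀ n f → n * (4 * f) ≡ 4 * n * f
    lemma = solve-∀
  4w≤ : 4 * (suc w * N) ≤ 3 * (2 * w * N)
  4w≤ = begin
    4 * (suc w * N)           ≡⟨ lemma₂ w N ⟩
    (4 * w + 2 * 2) * N       ≤⟨ *-monoˡ-≤ N (+-monoʳ-≤ (4 * w) (*-monoʳ-≤ 2 2≤w)) ⟩
    (4 * w + 2 * w) * N       ≡⟨ lemma₃ w N ⟩
    3 * (2 * w * N)           ∎
    where
    lemma₂ : ∀ w N → 4 * ((1 + w) * N) ≡ (4 * w + 2 * 2) * N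
    lemma₂ = solve-∀
    lemma₃ : ∀ w N → (4 * w + 2 * w) * N ≡ 3 * (2 * w * N)
    lemma₃ = solve-∀

-- Containers

subsets-of-size : (d : ℕ) (H : Subset m) → d ≤ ∣ H ∣ → ∃ λ H′ → H′ ⊆ H × ∣ H′ ∣ ≡ d
subsets-of-size {m} zero H            h       = ∅ , ⊥⊆ , ∣⊥∣≡0 m
subsets-of-size (suc d) (outside ∷ H) h       with subsets-of-size (suc d) H h
... | H′ , H′⊆H , eq = outside ∷ H′ , out⊆ H′⊆H , eq
subsets-of-size (suc d) (inside ∷ H)  (s≤s h) with subsets-of-size d H h
... | H′ , H′⊆H , eq = inside ∷ H′ , in⊆in H′⊆H , cong suc eq

∑ˢ-⊆ : (U : Subset m) → ∑ˢ (λ F → ι (F ⊆? U)) ≡ 2 ^ ∣ U ∣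
∑ˢ-⊆ []            = refl
∑ˢ-⊆ (outside ∷ U) = trans (cong₂ _+_
  (trans (∑ˢ-cong λ F → ι-cong (outside ∷ F ⊆? outside ∷ U) (F ⊆? U) (λ h → drop-∷-⊆ h) (λ h → out⊆ h)) (∑ˢ-⊆ U))
  (∑ˢ-zero λ F → ι-no (inside ∷ F ⊆? outside ∷ U) λ h → contradiction (h here) λ ())) (+-identityʳ _)
∑ˢ-⊆ (inside ∷ U)  = cong₂ _+_
  (trans (∑ˢ-cong λ F → ι-cong (outside ∷ F ⊆? inside ∷ U) (F ⊆? U) (λ h → drop-∷-⊆ h) (λ h → out⊆ h)) (∑ˢ-⊆ U))
  (trans (trans (∑ˢ-cong λ F → ι-cong (inside ∷ F ⊆? inside ∷ U) (F ⊆? U) (λ h → drop-∷-⊆ h) (λ h → in⊆in h)) (∑ˢ-⊆ U)) (sym (+-identityʳ _)))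

comprehension : {P : Fin m → Set} → Decidable P → Subset m
comprehension P? = tabulate (does ∘ P?)

∈-comprehension⁺ : {P : Fin m → Set} (P? : Decidable P) {x : Fin m} → P x → x ∈ comprehension P?
∈-comprehension⁺ P? {x} p = lookup⇒[]= x _ (trans (lookup∘tabulate (does ∘ P?) x) (dec-true (P? x) p))

∈-comprehension⁻ : {P : Fin m → Set} (P? : Decidable P) {x : Fin m} → x ∈ comprehension P? → P x
∈-comprehension⁻ P? {x} x∈ with P? x in eq
... | yes p = p
... | no ¬p = contradiction (trans (sym (cong does eq)) (trans (sym (lookup∘tabulate (does ∘ P?) x)) ([]=⇒lookup x∈))) λ ()

∣comprehension∣ : {P : Fin m → Set} (P? : Decidable P) → ∣ comprehension P? ∣ ≡ sum (ι ∘ P?)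
∣comprehension∣ P? = trans (sym (∣∣-sum (comprehension P?)))
  (sum-cong-≗ λ x → ι-cong (x ∈? comprehension P?) (P? x) (∈-comprehension⁻ P?) (∈-comprehension⁺ P?))

module Container {m : ℕ} {E : Fin m → Fin m → Fin m → Set} (E? : ∀ z x y → Dec (E z x y))
  {Q : Subset m → Set} (Q? : Decidable Q)
  (independent : ∀ {F z x y} → Q F → z ∈ F → x ∈ F → y ∈ F → ¬ E z x y) where

  neighbours : Subset m → Fin m → Fin m → Subset m
  neighbours U z x = comprehension (λ y → y ∈? U ×-dec E? z x y)

  hubs : ℕ → Subset m → Fin m → Subset m
  hubs d U z = comprehension (λ x → x ∈? U ×-dec d ≤? ∣ neighbours U z x ∣)

  Rich : ℕ → Subset m → Set
  Rich d U = ∃ λ z → z ∈ U × d ≤ ∣ hubs d U z ∣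

  rich? : ∀ d → Decidable (Rich d)
  rich? d U = any? λ z → z ∈? U ×-dec d ≤? ∣ hubs d U z ∣

  cnt : Subset m → ℕ
  cnt U = ∑ˢ (λ F → ι (Q? F ×-dec F ⊆? U))

  cnt≤2^ : ∀ U → cnt U ≤ 2 ^ ∣ U ∣
  cnt≤2^ U = ≤-trans (∑ˢ-mono λ F → ι-mono (Q? F ×-dec F ⊆? U) (F ⊆? U) (λ (_ , h) → λ {x} → h {x})) (≤-reflexive (∑ˢ-⊆ U))

  ⊆─ : ∀ {F U H : Subset m} → F ⊆ U → (∀ {x} → x ∈ F → x ∉ H) → F ⊆ U ─ H
  ⊆─ F⊆U h x∈F = x∈p∧x∉q⇒x∈p─q (F⊆U x∈F) (h x∈F)

  -- A family inside U either omits z, or contains z and one of the x ∈ H and hence no neighbour of x, or avoids H.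
  cnt-branch : ∀ U z H → cnt U ≤ cnt (U - z) + (∑∈ H (λ x → cnt (U ─ neighbours U z x)) + cnt (U ─ H))
  cnt-branch U z H = begin
    cnt U
      ≤⟨ ∑ˢ-mono pointwise ⟩
    ∑ˢ (λ F → in? F (U - z) + (∑∈ H (λ x → in? F (U ─ neighbours U z x)) + in? F (U ─ H)))
      ≡⟨ trans (∑ˢ-+ (λ F → in? F (U - z)) _) (cong (cnt (U - z) +_) (∑ˢ-+ (λ F → ∑∈ H (λ x → in? F (U ─ neighbours U z x))) _)) ⟩
    cnt (U - z) + (∑ˢ (λ F → ∑∈ H (λ x → in? F (U ─ neighbours U z x))) + cnt (U ─ H))
      ≡⟨ cong (λ s → cnt (U - z) + (s + cnt (U ─ H))) (∑∈-∑ˢ H (λ x F → in? F (U ─ neighbours U z x))) ⟨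
    cnt (U - z) + (∑∈ H (λ x → cnt (U ─ neighbours U z x)) + cnt (U ─ H)) ∎
    where
    open ≤-Reasoning
    in? : Subset m → Subset m → ℕ
    in? F V = ι (Q? F ×-dec F ⊆? V)
    in?-yes : ∀ {F V} → Q F → F ⊆ V → 1 ≤ in? F V
    in?-yes {F} {V} qF F⊆V = ≤-reflexive (sym (ι-yes (Q? F ×-dec F ⊆? V) (qF , F⊆V)))
    pointwise : ∀ F → in? F U ≤ in? F (U - z) + (∑∈ H (λ x → in? F (U ─ neighbours U z x)) + in? F (U ─ H))
    pointwise F with Q? F ×-dec F ⊆? U
    ... | no _ = z≤n
    ... | yes (qF , F⊆U) with z ∈? F
    ... | no z∉F = ≤-trans (in?-yes qF (⊆-x {V = U} F⊆U z∉F)) (m≤m+n _ _)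
    ... | yes z∈F with any? (λ x → x ∈? H ×-dec x ∈? F)
    ... | no none = ≤-trans (in?-yes qF (⊆─ {H = H} F⊆U λ {x} x∈F x∈H → none (x , x∈H , x∈F)))
      (≤-trans (m≤n+m _ (∑∈ H (λ x → in? F (U ─ neighbours U z x)))) (m≤n+m _ (in? F (U - z))))
    ... | yes (x , x∈H , x∈F) = begin
      1
        ≤⟨ in?-yes qF (⊆─ {H = neighbours U z x} F⊆U λ y∈F y∈N → independent qF z∈F x∈F y∈F (proj₂ (∈-comprehension⁻ (λ y → y ∈? U ×-dec E? z x y) y∈N))) ⟩
      in? F (U ─ neighbours U z x)
        ≡⟨ trans (cong (_* in? F (U ─ neighbours U z x)) (ι-yes (x ∈? H) x∈H)) (*-identityˡ _) ⟨
      ι (x ∈? H) * in? F (U ─ neighbours U z x)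
        ≤⟨ ∑-term (λ x → ι (x ∈? H) * in? F (U ─ neighbours U z x)) x ⟩
      ∑∈ H (λ x → in? F (U ─ neighbours U z x))
        ≤⟨ ≤-trans (m≤m+n _ (in? F (U ─ H))) (m≤n+m _ (in? F (U - z))) ⟩
      in? F (U - z) + (∑∈ H (λ x → in? F (U ─ neighbours U z x)) + in? F (U ─ H)) ∎

  -- Each branching step costs a factor of at most (1 + 1/t) per discarded element.
  module _ (t d B : ℕ) (weight : (2 + d) * t ^ suc d ≤ suc t ^ d)
    (rich : ∀ {U} → B < ∣ U ∣ → Rich (suc d) U) where

    -- With q = t / (t + 1), the branch omitting z costs q, and each of the d + 1 choices of x and
    -- the branch avoiding `H` costs at most q^(d + 1). The hypothesis `weight` says exactly that q
    -- + (2 + d) q^(d + 1) ≤ 1. Since s may fall by more than one, the recursion runs on k.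
    cnt-bound : ∀ k s U → s ≤ k → ∣ U ∣ ≤ s → cnt U * t ^ s ≤ 2 ^ B * suc t ^ s
    cnt-bound k s U s≤k ∣U∣≤s with ∣ U ∣ ≤? B
    ... | yes ∣U∣≤B = *-mono-≤ (≤-trans (cnt≤2^ U) (^-monoʳ-≤ 2 ∣U∣≤B)) (^-monoˡ-≤ s (n≤1+n t))
    ... | no ∣U∣≰B with rich {U} (≰⇒> ∣U∣≰B)
    ... | z , z∈U , d<hubs with subsets-of-size (suc d) (hubs (suc d) U z) d<hubs
    -- `H` lies in `U`, so s is at least d + 1; r is what remains of s once d + 1 elements are
    -- discarded.
    ... | H , H⊆hubs , ∣H∣≡ with ≤⇒∃ (≤-trans (≤-trans (≤-reflexive (sym ∣H∣≡)) (p⊆q⇒∣p∣≤∣q∣ {p = H} {q = U} H⊆U)) ∣U∣≤s)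
      where
      ≤⇒∃ : ∀ {x y} → x ≤ y → ∃ λ r → y ≡ x + r
      ≤⇒∃ {x} {y} h = y ∸ x , sym (m+[n∸m]≡n h)
      H⊆U : H ⊆ U
      H⊆U x∈H = proj₁ (∈-comprehension⁻ (λ x → x ∈? U ×-dec suc d ≤? ∣ neighbours U z x ∣) (H⊆hubs x∈H))
    cnt-bound (suc k) _ U (s≤s s≤k) ∣U∣≤s | no _ | z , z∈U , _ | H , H⊆hubs , ∣H∣≡ | r , refl = begin
      cnt U * t ^ suc (d + r)
        ≤⟨ *-monoˡ-≤ (t ^ suc (d + r)) (cnt-branch U z H) ⟩
      (cnt (U - z) + (∑∈ H (λ x → cnt (U ─ neighbours U z x)) + cnt (U ─ H))) * t ^ suc (d + r)
        ≡⟨ trans (*-distribʳ-+ (t ^ suc (d + r)) (cnt (U - z)) _)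
             (cong (cnt (U - z) * t ^ suc (d + r) +_) (*-distribʳ-+ (t ^ suc (d + r)) (∑∈ H (λ x → cnt (U ─ neighbours U z x))) _)) ⟩
      cnt (U - z) * t ^ suc (d + r) + (∑∈ H (λ x → cnt (U ─ neighbours U z x)) * t ^ suc (d + r) + cnt (U ─ H) * t ^ suc (d + r))
        ≤⟨ +-mono-≤ omit (+-mono-≤ choose (small H⊆U (≤-reflexive (sym ∣H∣≡)))) ⟩
      K * suc t ^ (d + r) * t + (suc d * (K * suc t ^ r * t ^ suc d) + K * suc t ^ r * t ^ suc d)
        ≡⟨ lemma K (suc t ^ (d + r)) t d (suc t ^ r) (t ^ suc d) ⟩
      K * (suc t ^ (d + r) * t + (2 + d) * t ^ suc d * suc t ^ r)
        ≤⟨ *-monoʳ-≤ K (+-monoʳ-≤ (suc t ^ (d + r) * t) (*-monoˡ-≤ (suc t ^ r) weight)) ⟩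
      K * (suc t ^ (d + r) * t + suc t ^ d * suc t ^ r)
        ≡⟨ cong (λ x → K * (suc t ^ (d + r) * t + x)) (^-distribˡ-+-* (suc t) d r) ⟨
      K * (suc t ^ (d + r) * t + suc t ^ (d + r))
        ≡⟨ lemma′ K (suc t ^ (d + r)) t ⟩
      K * suc t ^ suc (d + r) ∎
      where
      open ≤-Reasoning
      K : ℕ
      K = 2 ^ B
      lemma : ∀ K a t d b c → K * a * t + ((1 + d) * (K * b * c) + K * b * c) ≡ K * (a * t + (2 + d) * c * b)
      lemma = solve-∀
      lemma′ : ∀ K a t → K * (a * t + a) ≡ K * ((1 + t) * a)
      lemma′ = solve-∀
      hubs⁻ : ∀ {x} → x ∈ H → x ∈ U × suc d ≤ ∣ neighbours U z x ∣
      hubs⁻ x∈H = ∈-comprehension⁻ (λ x → x ∈? U ×-dec suc d ≤? ∣ neighbours U z x ∣) (H⊆hubs x∈H)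
      H⊆U : H ⊆ U
      H⊆U x∈H = proj₁ (hubs⁻ x∈H)
      omit : cnt (U - z) * t ^ suc (d + r) ≤ K * suc t ^ (d + r) * t
      omit = begin
        cnt (U - z) * (t * t ^ (d + r))   ≡⟨ swap (cnt (U - z)) t (t ^ (d + r)) ⟩
        cnt (U - z) * t ^ (d + r) * t     ≤⟨ *-monoˡ-≤ t (cnt-bound k (d + r) (U - z) s≤k
                                               (s≤s⁻¹ (≤-trans (≤-reflexive (∣V-x∣ z∈U)) ∣U∣≤s))) ⟩
        K * suc t ^ (d + r) * t           ∎
        where
        swap : ∀ c t p → c * (t * p) ≡ c * p * t
        swap = solve-∀
      small : ∀ {W} → W ⊆ U → suc d ≤ ∣ W ∣ → cnt (U ─ W) * t ^ suc (d + r) ≤ K * suc t ^ r * t ^ suc d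
      small {W} W⊆U d< = begin
        cnt (U ─ W) * t ^ (suc d + r)          ≡⟨ cong (cnt (U ─ W) *_) (^-distribˡ-+-* t (suc d) r) ⟩
        cnt (U ─ W) * (t ^ suc d * t ^ r)      ≡⟨ swap (cnt (U ─ W)) (t ^ suc d) (t ^ r) ⟩
        cnt (U ─ W) * t ^ r * t ^ suc d        ≤⟨ *-monoˡ-≤ (t ^ suc d) (cnt-bound k r (U ─ W) (≤-trans (m≤n+m r d) s≤k)
                                                    (+-cancelˡ-≤ (suc d) _ _ (begin
                                                      suc d + ∣ U ─ W ∣    ≤⟨ +-monoˡ-≤ ∣ U ─ W ∣ d< ⟩
                                                      ∣ W ∣ + ∣ U ─ W ∣    ≡⟨ +-comm ∣ W ∣ (∣ U ─ W ∣) ⟩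
                                                      ∣ U ─ W ∣ + ∣ W ∣    ≡⟨ ∣─∣ U W W⊆U ⟩
                                                      ∣ U ∣                ≤⟨ ∣U∣≤s ⟩
                                                      suc d + r            ∎))) ⟩
        K * suc t ^ r * t ^ suc d              ∎
        where
        swap : ∀ c t p → c * (t * p) ≡ c * p * t
        swap = solve-∀
      choose : ∑∈ H (λ x → cnt (U ─ neighbours U z x)) * t ^ suc (d + r) ≤ suc d * (K * suc t ^ r * t ^ suc d)
      choose = begin
        ∑∈ H (λ x → cnt (U ─ neighbours U z x)) * t ^ suc (d + r)
          ≡⟨ trans (*-comm _ (t ^ suc (d + r))) (sym (∑∈-*ˡ H (t ^ suc (d + r)) (λ x → cnt (U ─ neighbours U z x)))) ⟩
        ∑∈ H (λ x → t ^ suc (d + r) * cnt (U ─ neighbours U z x))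
          ≤⟨ ∑∈-mono H (λ {x} x∈H → ≤-trans (≤-reflexive (*-comm (t ^ suc (d + r)) _))
               (small (λ y∈ → proj₁ (∈-comprehension⁻ (λ y → y ∈? U ×-dec E? z x y) y∈)) (proj₂ (hubs⁻ x∈H)))) ⟩
        ∑∈ H (λ _ → K * suc t ^ r * t ^ suc d)
          ≡⟨ ∑∈-const H _ ⟩
        ∣ H ∣ * (K * suc t ^ r * t ^ suc d)
          ≡⟨ cong (_* (K * suc t ^ r * t ^ suc d)) ∣H∣≡ ⟩
        suc d * (K * suc t ^ r * t ^ suc d) ∎

    container : ∑ˢ (ι ∘ Q?) * t ^ m ≤ 2 ^ B * suc t ^ m
    container = ≤-trans
      (*-monoˡ-≤ (t ^ m) (∑ˢ-mono λ F → ι-mono (Q? F) (Q? F ×-dec F ⊆? ⊤) λ qF → qF , ⊆⊤))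
      (cnt-bound m m ⊤ ≤-refl (≤-reflexive (∣⊤∣≡n m)))

-- The enumeration of the power set

length-filter-map : {A B : Set} {P : B → Set} (P? : Decidable P) (f : A → B) (xs : List A) →
  length (filter P? (map f xs)) ≡ length (filter (P? ∘ f) xs)
length-filter-map P? f []       = refl
length-filter-map P? f (x ∷ xs) with does (P? (f x))
... | true  = cong suc (length-filter-map P? f xs)
... | false = length-filter-map P? f xs

length-filter-allVecs : ∀ m {P : Subset m → Set} (P? : Decidable P) → length (filter P? (allVecs m)) ≡ ∑ˢ (ι ∘ P?)
length-filter-allVecs zero P? with P? []
... | yes _ = refl
... | no _  = refl
length-filter-allVecs (suc m) P? = begin
  length (filter P? (map (outside ∷_) (allVecs m) ++ map (inside ∷_) (allVecs m)))
    ≡⟨ cong length (filter-++ P? (map (outside ∷_) (allVecs m)) _) ⟩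
  length (filter P? (map (outside ∷_) (allVecs m)) ++ filter P? (map (inside ∷_) (allVecs m)))
    ≡⟨ length-++ (filter P? (map (outside ∷_) (allVecs m))) ⟩
  length (filter P? (map (outside ∷_) (allVecs m))) + length (filter P? (map (inside ∷_) (allVecs m)))
    ≡⟨ cong₂ _+_ (trans (length-filter-map P? (outside ∷_) (allVecs m)) (length-filter-allVecs m (P? ∘ (outside ∷_))))
                 (trans (length-filter-map P? (inside ∷_) (allVecs m)) (length-filter-allVecs m (P? ∘ (inside ∷_)))) ⟩
  ∑ˢ (ι ∘ P?) ∎
  where open ≡-Reasoning

∑-lookup-++ : {A : Set} (g : A → ℕ) (xs ys : List A) →
  sum (g ∘ lookup (xs ++ ys)) ≡ sum (g ∘ lookup xs) + sum (g ∘ lookup ys)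
∑-lookup-++ g []       ys = refl
∑-lookup-++ g (x ∷ xs) ys = trans (cong (g x +_) (∑-lookup-++ g xs ys)) (sym (+-assoc (g x) _ _))

∑-lookup-map : {A B : Set} (g : B → ℕ) (f : A → B) (xs : List A) →
  sum (g ∘ lookup (map f xs)) ≡ sum (g ∘ f ∘ lookup xs)
∑-lookup-map g f []       = refl
∑-lookup-map g f (x ∷ xs) = cong (g (f x) +_) (∑-lookup-map g f xs)

∑-setAt : ∀ n (g : Subset n → ℕ) → sum (g ∘ setAt n) ≡ ∑ˢ g
∑-setAt zero    g = +-identityʳ (g [])
∑-setAt (suc n) g = trans (∑-lookup-++ g (map (outside ∷_) (allVecs n)) _) (cong₂ _+_
  (trans (∑-lookup-map g (outside ∷_) (allVecs n)) (∑-setAt n (g ∘ (outside ∷_))))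
  (trans (∑-lookup-map g (inside ∷_) (allVecs n)) (∑-setAt n (g ∘ (inside ∷_)))))

length-allVecs : ∀ n → length (allVecs n) ≡ 2 ^ n
length-allVecs zero    = refl
length-allVecs (suc n) = trans (length-++ (map (outside ∷_) (allVecs n)))
  (cong₂ _+_ (trans (length-map _ (allVecs n)) (length-allVecs n))
             (trans (length-map _ (allVecs n)) (trans (length-allVecs n) (sym (+-identityʳ _)))))

∈-allVecs : (V : Subset n) → V ∈ˡ allVecs n
∈-allVecs []                    = here refl
∈-allVecs (outside ∷ V)         = ∈-++⁺ˡ (∈-map⁺ (outside ∷_) (∈-allVecs V))
∈-allVecs {suc n} (inside ∷ V)  = ∈-++⁺ʳ (map (outside ∷_) (allVecs n)) (∈-map⁺ (inside ∷_) (∈-allVecs V))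

allVecs-unique : ∀ n → Unique (allVecs n)
allVecs-unique zero    = [] ∷ []
allVecs-unique (suc n) = Unique.++⁺ (Unique.map⁺ ∷-injectiveʳ (allVecs-unique n)) (Unique.map⁺ ∷-injectiveʳ (allVecs-unique n)) disjoint
  where
  disjoint : Disjoint (map (outside ∷_) (allVecs n)) (map (inside ∷_) (allVecs n))
  disjoint (p , q) with ∈-map⁻ (outside ∷_) p | ∈-map⁻ (inside ∷_) q
  ... | _ , _ , refl | _ , _ , ()

lookup-injective : {A : Set} {xs : List A} → Unique xs → ∀ i j → lookup xs i ≡ lookup xs j → i ≡ j
lookup-injective (x∉ ∷ u) zero    zero    eq = refl
lookup-injective (x∉ ∷ u) zero    (suc j) eq = contradiction eq (All.lookup x∉ (∈-lookup j))
lookup-injective (x∉ ∷ u) (suc i) zero    eq = contradiction (sym eq) (All.lookup x∉ (∈-lookup i))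
lookup-injective (x∉ ∷ u) (suc i) (suc j) eq = cong suc (lookup-injective u i j eq)

idx : Subset n → PIdx n
idx V = index (∈-allVecs V)

setAt-idx : (V : Subset n) → setAt n (idx V) ≡ V
setAt-idx V = sym (lookup-index (∈-allVecs V))

idx-setAt : (i : PIdx n) → idx (setAt n i) ≡ i
idx-setAt {n} i = lookup-injective (allVecs-unique n) _ i (setAt-idx (setAt n i))

-- The lower bound from the middle layer

α-∑ˢ : ∀ n → α n ≡ ∑ˢ (ι ∘ unionFree? {n})
α-∑ˢ n = length-filter-allVecs (length (powerSet n)) (unionFree? {n})

middleLayer : ∀ n → Subset (length (powerSet n))
middleLayer n = comprehension (λ i → ∣ setAt n i ∣ ≟ n / 2)

∣middleLayer∣ : ∀ n → ∣ middleLayer n ∣ ≡ n C (n / 2)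
∣middleLayer∣ n = trans (∣comprehension∣ (λ i → ∣ setAt n i ∣ ≟ n / 2))
  (trans (∑-setAt n (λ V → ι (∣ V ∣ ≟ n / 2))) (∑ˢ-level n (n / 2)))

middleLayer-unionFree : ∀ n {F : Family n} → F ⊆ middleLayer n → UnionFree F
middleLayer-unionFree n F⊆ i j k i∈F j∈F k∈F _ _ Si≢Sk Si∪Sj≡Sk =
  Si≢Sk (⊆-card-≡ (⊆-trans (p⊆p∪q (setAt n j)) (⊆-reflexive Si∪Sj≡Sk)) (≤-reflexive (trans (size k∈F) (sym (size i∈F)))))
  where
  size : ∀ {i} → i ∈ _ → ∣ setAt n i ∣ ≡ n / 2
  size i∈F = ∈-comprehension⁻ (λ i → ∣ setAt n i ∣ ≟ n / 2) (F⊆ i∈F)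

2^central≤α : ∀ n → 2 ^ (n C (n / 2)) ≤ α n
2^central≤α n = begin
  2 ^ (n C (n / 2))                          ≡⟨ cong (2 ^_) (∣middleLayer∣ n) ⟨
  2 ^ ∣ middleLayer n ∣                      ≡⟨ ∑ˢ-⊆ (middleLayer n) ⟨
  ∑ˢ (λ F → ι (F ⊆? middleLayer n))          ≤⟨ ∑ˢ-mono (λ F → ι-mono (F ⊆? middleLayer n) (unionFree? {n} F) λ h → middleLayer-unionFree n h) ⟩
  ∑ˢ (ι ∘ unionFree? {n})                    ≡⟨ α-∑ˢ n ⟨
  α n                                        ∎
  where open ≤-Reasoning

-- Union-free families as independent sets

module Families (n : ℕ) where

  private
    S : PIdx n → Subset n
    S = setAt n

  Triple : PIdx n → PIdx n → PIdx n → Set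
  Triple z x y = (S x ≢ S z × S y ≢ S z) × S x ∪ S y ≡ S z

  triple? : ∀ z x y → Dec (Triple z x y)
  triple? z x y = (¬? (S x ≟ˢ S z) ×-dec ¬? (S y ≟ˢ S z)) ×-dec S x ∪ S y ≟ˢ S z

  -- That x and y differ need not be part of `Triple`: if `S x` and `S y` agreed, their union `S z`
  -- would equal `S x`.
  unionFree⇒independent : ∀ {F : Family n} {z x y} → UnionFree F → z ∈ F → x ∈ F → y ∈ F → ¬ Triple z x y
  unionFree⇒independent {z = z} {x} {y} uf z∈F x∈F y∈F ((x≢z , y≢z) , x∪y≡z) =
    uf x y z x∈F y∈F z∈F x≢y y≢z x≢z x∪y≡z
    where
    x≢y : S x ≢ S y
    x≢y eq = x≢z (trans (sym (∪-idem (S x))) (trans (cong (S x ∪_) eq) x∪y≡z))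

  open Container triple? (unionFree? {n}) unionFree⇒independent public

  far : ℕ → ℕ
  far R = ∑ˢ {n} (λ V → ι (suc R ≤? dev V))

  -- Supersaturation is applied to the members of `U` with deviation at most R; the others are
  -- counted by `far R`. Such a member has at least (n - R) / 2 elements, which 4 (2 + β) R ≤ n
  -- makes large enough for 2 + β blocks.
  poor-bound : ∀ R d β → 1 ≤ R → 2 ≤ β → 4 * ((2 + β) * R) ≤ n → 4 * ((2 + β) * ((2 + β) * d)) ≤ suc R →
    ∀ {U} → ¬ Rich d U → β * ∣ U ∣ ≤ (2 + β) * (n C (n / 2)) + β * far R
  poor-bound R d β 1≤R 2≤β 4bR≤n dense {U} poor = begin
    β * ∣ U ∣
      ≤⟨ *-monoʳ-≤ β ∣U∣≤ ⟩
    β * (∑ˢ (ι ∘ u?) + far R)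
      ≡⟨ *-distribˡ-+ β _ (far R) ⟩
    β * ∑ˢ (ι ∘ u?) + β * far R
      ≤⟨ +-monoˡ-≤ (β * far R) (supersaturation u? R d β near wide long dense few) ⟩
    (2 + β) * (n C (n / 2)) + β * far R ∎
    where
    open ≤-Reasoning
    u : Subset n → Set
    u A = idx A ∈ U × dev A ≤ R
    u? : Decidable u
    u? A = idx A ∈? U ×-dec dev A ≤? R
    ∣U∣≤ : ∣ U ∣ ≤ ∑ˢ (ι ∘ u?) + far R
    ∣U∣≤ = begin
      ∣ U ∣                                                  ≡⟨ ∣∣-sum U ⟨
      sum (λ i → ι (i ∈? U))                                 ≡⟨ sum-cong-≗ (λ i → cong (λ j → ι (j ∈? U)) (idx-setAt {n} i)) ⟨
      sum (λ i → ι (idx (S i) ∈? U))                         ≡⟨ ∑-setAt n (λ A → ι (idx A ∈? U)) ⟩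
      ∑ˢ {n} (λ A → ι (idx A ∈? U))                              ≤⟨ ∑ˢ-mono {n} (λ A → ≤-trans (ι-mono (idx A ∈? U) (u? A ⊎-dec suc R ≤? dev A) (split A)) (ι-⊎ (u? A) (suc R ≤? dev A))) ⟩
      ∑ˢ (λ A → ι (u? A) + ι (suc R ≤? dev A))               ≡⟨ ∑ˢ-+ (ι ∘ u?) (λ A → ι (suc R ≤? dev A)) ⟩
      ∑ˢ (ι ∘ u?) + far R                                    ∎
      where
      split : ∀ A → idx A ∈ U → u A ⊎ suc R ≤ dev A
      split A A∈U with dev A ≤? R
      ... | yes le = inj₁ (A∈U , le)
      ... | no ≰   = inj₂ (≰⇒> ≰)
    near : ∀ {A B} → u A → u B → ∣ A ∣ ≤ R + ∣ B ∣
    near {A} {B} (_ , dA) (_ , dB) = dev-near A B dA dB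
    long : ∀ {Z} → u Z → (2 + β) * R ≤ ∣ Z ∣
    long {Z} (_ , dZ) = halve-≤ (+-cancelʳ-≤ R _ _ (begin
      -- The summand added to the last R completes it to 2 (2 + β) R.
      (2 + β) * R + (2 + β) * R + R                        ≤⟨ +-monoʳ-≤ ((2 + β) * R + (2 + β) * R) (m≤m+n R (R + β * R + ((2 + β) * R + 0))) ⟩
      (2 + β) * R + (2 + β) * R + (R + (R + β * R + ((2 + β) * R + 0)))  ≡⟨ lemma β R ⟩
      4 * ((2 + β) * R)                                    ≤⟨ 4bR≤n ⟩
      n                                                    ≤⟨ n≤2∣V∣+dev Z ⟩
      ∣ Z ∣ + ∣ Z ∣ + dev Z                                ≤⟨ +-mono-≤ (n≤1+n (∣ Z ∣ + ∣ Z ∣)) dZ ⟩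
      suc (∣ Z ∣ + ∣ Z ∣) + R                              ∎))
      where
      lemma : ∀ β R → (2 + β) * R + (2 + β) * R + (R + (R + β * R + ((2 + β) * R + 0))) ≡ 4 * ((2 + β) * R)
      lemma = solve-∀
    wide : ∀ {Z} → u Z → R + (2 + R) ≤ ∣ Z ∣
    wide uZ = ≤-trans (begin
      R + (2 + R)            ≡⟨ lemma₁ R ⟩
      2 * R + 2 * 1          ≤⟨ +-monoʳ-≤ (2 * R) (*-monoʳ-≤ 2 1≤R) ⟩
      2 * R + 2 * R          ≤⟨ +-monoʳ-≤ (2 * R) (*-monoˡ-≤ R 2≤β) ⟩
      2 * R + β * R          ≡⟨ *-distribʳ-+ R 2 β ⟨
      (2 + β) * R            ∎) (long uZ)
      where
      lemma₁ : ∀ R → R + (2 + R) ≡ 2 * R + 2 * 1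
      lemma₁ = solve-∀
    few : ∀ {Z} → u Z → ∑ˢ (ι ∘ Degrees.heavy? u? Z d) ≤ d
    few {Z} (Z∈U , _) = begin
      ∑ˢ (ι ∘ heavy?)                       ≡⟨ ∑-setAt n (ι ∘ heavy?) ⟨
      sum (λ i → ι (heavy? (S i)))          ≤⟨ ∑-mono (λ i → ι-mono (heavy? (S i)) (i ∈? U ×-dec d ≤? ∣ neighbours U (idx Z) i ∣) hub) ⟩
      sum (λ i → ι (i ∈? U ×-dec d ≤? ∣ neighbours U (idx Z) i ∣))
                                            ≡⟨ ∣comprehension∣ (λ i → i ∈? U ×-dec d ≤? ∣ neighbours U (idx Z) i ∣) ⟨
      ∣ hubs d U (idx Z) ∣                  ≤⟨ <⇒≤ (≰⇒> λ d≤ → poor (idx Z , Z∈U , d≤)) ⟩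
      d                                     ∎
      where
      open Degrees u? Z d
      member : ∀ {i} → u (S i) → i ∈ U
      member {i} (i∈U , _) = subst (_∈ U) (idx-setAt {n} i) i∈U
      S≢ : ∀ {i} → S i ≢ Z → S i ≢ S (idx Z)
      S≢ ≢Z eq = ≢Z (trans eq (setAt-idx Z))
      hub : ∀ {i} → Heavy (S i) → i ∈ U × d ≤ ∣ neighbours U (idx Z) i ∣
      hub {i} ((uSi , Si≢Z) , d≤deg) = member uSi , (begin
        d                                                 ≤⟨ d≤deg ⟩
        ∑ˢ (ι ∘ adj? (S i))                               ≡⟨ ∑-setAt n (ι ∘ adj? (S i)) ⟨
        sum (λ j → ι (adj? (S i) (S j)))                  ≤⟨ ∑-mono (λ j → ι-mono (adj? (S i) (S j)) (j ∈? U ×-dec triple? (idx Z) i j)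
                                                               λ ((uSj , Sj≢Z) , eq) → member uSj , (S≢ Si≢Z , S≢ Sj≢Z) , trans eq (sym (setAt-idx Z))) ⟩
        sum (λ j → ι (j ∈? U ×-dec triple? (idx Z) i j))  ≡⟨ ∣comprehension∣ (λ j → j ∈? U ×-dec triple? (idx Z) i j) ⟨
        ∣ neighbours U (idx Z) i ∣                        ∎)

  -- The choice β = 8K makes the chain error 2/β equal to 1/(4K). The sets far from the middle cost
  -- another 1/(4K), so the threshold is (1 + 1/(2K)) C(n, n/2).
  large⇒rich : ∀ K R d → let β = 8 * K in 1 ≤ K → 1 ≤ R → 4 * ((2 + β) * R) ≤ n →
    4 * ((2 + β) * ((2 + β) * d)) ≤ suc R → 4 * K * far R ≤ n C (n / 2) →
    ∀ {U} → (4 * K + 2) * (n C (n / 2)) < ∣ U ∣ * (4 * K) → Rich d U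
  large⇒rich K R d 1≤K 1≤R 4bR≤n dense far-small {U} large with rich? d U
  ... | yes rich = rich
  ... | no poor = contradiction (*-cancelˡ-≤ 2 (begin
    2 * (∣ U ∣ * (4 * K))                ≡⟨ lemma₁ ∣ U ∣ K ⟩
    8 * K * ∣ U ∣                        ≤⟨ poor-bound R d (8 * K) 1≤R (≤-trans (s≤s (s≤s z≤n)) (*-monoʳ-≤ 8 1≤K)) 4bR≤n dense poor ⟩
    (2 + 8 * K) * N + 8 * K * far R      ≡⟨ cong ((2 + 8 * K) * N +_) (lemma₂ K (far R)) ⟩
    (2 + 8 * K) * N + 2 * (4 * K * far R) ≤⟨ +-monoʳ-≤ ((2 + 8 * K) * N) (*-monoʳ-≤ 2 far-small) ⟩
    (2 + 8 * K) * N + 2 * N              ≡⟨ lemma₃ K N ⟩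
    2 * ((4 * K + 2) * N)                ∎)) (<⇒≱ large)
    where
    open ≤-Reasoning
    N : ℕ
    N = n C (n / 2)
    lemma₁ : ∀ u K → 2 * (u * (4 * K)) ≡ 8 * K * u
    lemma₁ = solve-∀
    lemma₂ : ∀ K f → 8 * K * f ≡ 2 * (4 * K * f)
    lemma₂ = solve-∀
    lemma₃ : ∀ K N → (2 + 8 * K) * N + 2 * N ≡ 2 * ((4 * K + 2) * N)
    lemma₃ = solve-∀

  α-container : ∀ t d B → (2 + d) * t ^ suc d ≤ suc t ^ d → (∀ {U} → B < ∣ U ∣ → Rich (suc d) U) →
    α n * t ^ (2 ^ n) ≤ 2 ^ B * suc t ^ (2 ^ n)
  α-container t d B weight rich = subst₂ (λ x m → x * t ^ m ≤ 2 ^ B * suc t ^ m)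
    (sym (α-∑ˢ n)) (length-allVecs n) (container t d B weight rich)

-- Powers and exponential growth

-- Bernoulli's inequality (1 + 1/t)^j ≥ 1 + j/t at j = t, cleared of denominators.
2t^t≤[1+t]^t : ∀ t .{{_ : NonZero t}} → 2 * t ^ t ≤ suc t ^ t
2t^t≤[1+t]^t t = *-cancelˡ-≤ t (begin
  t * (2 * t ^ t)   ≡⟨ lemma t (t ^ t) ⟩
  t ^ t * (t + t)   ≤⟨ bernoulli t ⟩
  t * suc t ^ t     ∎)
  where
  open ≤-Reasoning
  lemma : ∀ t p → t * (2 * p) ≡ p * (t + t)
  lemma = solve-∀
  bernoulli : ∀ j → t ^ j * (t + j) ≤ t * suc t ^ j
  bernoulli zero    = ≤-reflexive (zeroth t)
    where
    zeroth : ∀ t → 1 * (t + 0) ≡ t * 1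
    zeroth = solve-∀
  bernoulli (suc j) = begin
    t * t ^ j * (t + suc j)              ≤⟨ m≤m+n _ (t ^ j * j) ⟩
    t * t ^ j * (t + suc j) + t ^ j * j  ≡⟨ lemma₁ t (t ^ j) j ⟩
    suc t * (t ^ j * (t + j))            ≤⟨ *-monoʳ-≤ (suc t) (bernoulli j) ⟩
    suc t * (t * suc t ^ j)              ≡⟨ lemma₂ (suc t) t (suc t ^ j) ⟩
    t * (suc t * suc t ^ j)              ∎
    where
    lemma₁ : ∀ t p j → t * p * (t + (1 + j)) + p * j ≡ (1 + t) * (p * (t + j))
    lemma₁ = solve-∀
    lemma₂ : ∀ a b c → a * (b * c) ≡ b * (a * c)
    lemma₂ = solve-∀

-- Bernoulli for the reciprocal, (1 - 1/(t + 1))^j ≥ 1 - j/(t + 1), at t = 2m and j = m: the ratio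
-- is at most (2m + 1) / (m + 1) < 2.
[1+2m]^m≤2[2m]^m : ∀ m → suc (2 * m) ^ m ≤ 2 * (2 * m) ^ m
[1+2m]^m≤2[2m]^m m = *-cancelʳ-≤ _ _ (suc m) (begin
  suc t ^ m * suc m              ≤⟨ bernoulli m (suc m) (split m) ⟩
  t ^ m * suc t                  ≤⟨ m≤m+n _ (t ^ m) ⟩
  t ^ m * suc t + t ^ m          ≡⟨ lemma m (t ^ m) ⟩
  2 * t ^ m * suc m              ∎)
  where
  open ≤-Reasoning
  t = 2 * m
  split : ∀ m → m + (1 + m) ≡ 1 + 2 * m
  split = solve-∀
  lemma : ∀ m p → p * (1 + 2 * m) + p ≡ 2 * p * (1 + m)
  lemma = solve-∀
  bernoulli : ∀ j i → j + i ≡ suc t → suc t ^ j * i ≤ t ^ j * suc t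
  bernoulli zero    i refl = ≤-refl
  bernoulli (suc j) i eq = begin
    suc t * suc t ^ j * i        ≡⟨ lemma₁ t (suc t ^ j) i ⟩
    suc t ^ j * (t * i + i)      ≤⟨ *-monoʳ-≤ (suc t ^ j) (+-monoʳ-≤ (t * i) i≤t) ⟩
    suc t ^ j * (t * i + t)      ≡⟨ lemma₂ (suc t ^ j) t i ⟩
    t * (suc t ^ j * suc i)      ≤⟨ *-monoʳ-≤ t (bernoulli j (suc i) (trans (+-suc j i) eq)) ⟩
    t * (t ^ j * suc t)          ≡⟨ *-assoc t (t ^ j) (suc t) ⟨
    t * t ^ j * suc t            ∎
    where
    i≤t : i ≤ t
    i≤t = ≤-trans (m≤n+m i j) (≤-reflexive (suc-injective eq))
    lemma₁ : ∀ t p i → (1 + t) * p * i ≡ p * (t * i + i)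
    lemma₁ = solve-∀
    lemma₂ : ∀ p t i → p * (t * i + t) ≡ t * (p * (1 + i))
    lemma₂ = solve-∀

[1+t]^t≤4t^t : ∀ τ → let t = 2 ^ suc τ in suc t ^ t ≤ 4 * t ^ t
[1+t]^t≤4t^t τ = begin
  suc t ^ t                       ≡⟨ cong (suc t ^_) (cong (h +_) (+-identityʳ h)) ⟩
  suc t ^ (h + h)                 ≡⟨ ^-distribˡ-+-* (suc t) h h ⟩
  suc t ^ h * suc t ^ h           ≤⟨ *-mono-≤ ([1+2m]^m≤2[2m]^m h) ([1+2m]^m≤2[2m]^m h) ⟩
  2 * t ^ h * (2 * t ^ h)         ≡⟨ lemma (t ^ h) ⟩
  4 * (t ^ h * t ^ h)             ≡⟨ cong (4 *_) (^-distribˡ-+-* t h h) ⟨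
  4 * t ^ (h + h)                 ≡⟨ cong (λ z → 4 * t ^ (h + z)) (+-identityʳ h) ⟨
  4 * t ^ t                       ∎
  where
  open ≤-Reasoning
  h t : ℕ
  h = 2 ^ τ
  t = 2 ^ suc τ
  lemma : ∀ p → 2 * p * (2 * p) ≡ 4 * (p * p)
  lemma = solve-∀

n<2^n : ∀ n → n < 2 ^ n
n<2^n zero    = s≤s z≤n
n<2^n (suc n) = +-mono-≤ (≤-trans (s≤s z≤n) (n<2^n n)) (≤-trans (n<2^n n) (≤-reflexive (sym (+-identityʳ _))))

-- At σ₀ = 4y the right side is (2^y)^4 ≥ (1 + y)^4 ≥ 5y². From there on it doubles at each step,
-- while the left side grows by a ≤ 2^σ₀.
exponential-growth : ∀ a b → ∃ λ σ₀ → ∀ σ → σ₀ ≤ σ → a * (σ + b) ≤ 2 ^ σ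
exponential-growth a b = σ₀ , λ σ σ₀≤σ → subst (λ z → a * (z + b) ≤ 2 ^ z) (m∸n+n≡m σ₀≤σ) (above (σ ∸ σ₀))
  where
  open ≤-Reasoning
  y σ₀ : ℕ
  y = a + b
  σ₀ = 4 * y
  base : a * (σ₀ + b) ≤ 2 ^ σ₀
  base = begin
    a * (4 * y + b)           ≤⟨ *-mono-≤ (m≤m+n a b) (+-monoʳ-≤ (4 * y) (m≤n+m b a)) ⟩
    y * (4 * y + y)           ≤⟨ m≤m+n _ _ ⟩
    y * (4 * y + y) + (1 + 4 * y + y * y + 4 * (y * (y * y)) + y * (y * (y * y)))
                              ≡⟨ expand y ⟩
    (1 + y) * ((1 + y) * ((1 + y) * (1 + y)))
                              ≤⟨ *-mono-≤ (n<2^n y) (*-mono-≤ (n<2^n y) (*-mono-≤ (n<2^n y) (n<2^n y))) ⟩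
    p * (p * (p * p))         ≡⟨ cong (λ z → p * (p * (p * z))) (*-identityʳ p) ⟨
    p ^ 4                     ≡⟨ ^-*-assoc 2 y 4 ⟩
    2 ^ (y * 4)               ≡⟨ cong (2 ^_) (*-comm y 4) ⟩
    2 ^ σ₀                    ∎
    where
    p = 2 ^ y
    expand : ∀ y → y * (4 * y + y) + (1 + 4 * y + y * y + 4 * (y * (y * y)) + y * (y * (y * y))) ≡ (1 + y) * ((1 + y) * ((1 + y) * (1 + y)))
    expand = solve-∀
  a≤ : a ≤ 2 ^ σ₀
  a≤ = ≤-trans (m≤m+n a b) (≤-trans (m≤m+n y _) (<⇒≤ (n<2^n σ₀)))
  above : ∀ k → a * (k + σ₀ + b) ≤ 2 ^ (k + σ₀)
  above zero    = base
  above (suc k) = begin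
    a * suc (k + σ₀ + b)             ≡⟨ *-suc a (k + σ₀ + b) ⟩
    a + a * (k + σ₀ + b)             ≤⟨ +-mono-≤ (≤-trans a≤ (^-monoʳ-≤ 2 (m≤n+m σ₀ k))) (above k) ⟩
    2 ^ (k + σ₀) + 2 ^ (k + σ₀)      ≡⟨ cong (2 ^ (k + σ₀) +_) (+-identityʳ _) ⟨
    2 ^ suc (k + σ₀)                 ∎

-- Supplies s = 2^σ with s ≤ √n < 2s. A power of two is wanted so that t divides 2^n.
log₄ : ∀ n → 1 ≤ n → ∃ λ σ → 2 ^ σ * 2 ^ σ ≤ n × n < 4 * (2 ^ σ * 2 ^ σ)
log₄ (suc zero)    _ = 0 , s≤s z≤n , s≤s (s≤s z≤n)
log₄ (suc (suc n)) _ with log₄ (suc n) (s≤s z≤n)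
... | σ , lo , hi with suc (suc n) <? 4 * (2 ^ σ * 2 ^ σ)
... | yes <4 = σ , m≤n⇒m≤1+n lo , <4
... | no ≮4 = suc σ , ≤-trans (≤-reflexive (double (2 ^ σ))) (≮⇒≥ ≮4)
            , ≤-trans (s≤s hi) (≤-trans (bump (≤-trans (s≤s z≤n) hi)) (≤-reflexive (cong (4 *_) (sym (double (2 ^ σ))))))
  where
  double : ∀ x → 2 * x * (2 * x) ≡ 4 * (x * x)
  double = solve-∀
  bump : ∀ {q} → 1 ≤ q → suc q ≤ 4 * q
  bump {q} h = +-mono-≤ h (m≤m+n q _)

^-distribʳ-* : ∀ x y k → (x * y) ^ k ≡ x ^ k * y ^ k
^-distribʳ-* x y zero    = refl
^-distribʳ-* x y (suc k) = trans (cong (x * y *_) (^-distribʳ-* x y k)) (lemma x y (x ^ k) (y ^ k))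
  where
  lemma : ∀ a b c d → a * b * (c * d) ≡ a * c * (b * d)
  lemma = solve-∀

4τ≤2^τ : ∀ {τ} → 4 ≤ τ → 4 * τ ≤ 2 ^ τ
4τ≤2^τ {τ} 4≤τ = subst (λ z → 4 * z ≤ 2 ^ z) (m∸n+n≡m 4≤τ) (above (τ ∸ 4))
  where
  open ≤-Reasoning
  above : ∀ k → 4 * (k + 4) ≤ 2 ^ (k + 4)
  above zero    = ≤-refl
  above (suc k) = begin
    4 * suc (k + 4)            ≡⟨ *-suc 4 (k + 4) ⟩
    4 + 4 * (k + 4)            ≤⟨ +-mono-≤ (≤-trans (≤-trans (m≤n+m 4 k) (m≤m+n (k + 4) _)) (above k)) (above k) ⟩
    2 ^ (k + 4) + 2 ^ (k + 4)  ≡⟨ cong (2 ^ (k + 4) +_) (+-identityʳ _) ⟨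
    2 ^ suc (k + 4)            ∎

-- With d + 1 = 4τt, (1 + 1/t)^(d + 1) is at least 2^(4τ) = t⁴, which beats (t + 1)(d + 2) because
-- 4τ ≤ t. The logarithmic factor in d pays for the d + 2 branches.
container-weight : ∀ τ t d → 4 ≤ τ → 2 ^ τ ≡ t → suc d ≡ t * (4 * τ) → (2 + d) * t ^ suc d ≤ suc t ^ d
container-weight τ t d 4≤τ 2^τ≡t eq = *-cancelˡ-≤ (suc t) (begin
  suc t * ((2 + d) * t ^ suc d)            ≡⟨ *-assoc (suc t) (2 + d) (t ^ suc d) ⟨
  suc t * (2 + d) * t ^ suc d              ≤⟨ *-mono-≤ small (≤-reflexive (trans (cong (t ^_) eq) (sym (^-*-assoc t t (4 * τ))))) ⟩
  2 ^ (4 * τ) * (t ^ t) ^ (4 * τ)          ≡⟨ ^-distribʳ-* 2 (t ^ t) (4 * τ) ⟨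
  (2 * t ^ t) ^ (4 * τ)                    ≤⟨ ^-monoˡ-≤ (4 * τ) (2t^t≤[1+t]^t t {{>-nonZero 1≤t}}) ⟩
  (suc t ^ t) ^ (4 * τ)                    ≡⟨ ^-*-assoc (suc t) t (4 * τ) ⟩
  suc t ^ (t * (4 * τ))                    ≡⟨ cong (suc t ^_) eq ⟨
  suc t ^ suc d                            ∎)
  where
  open ≤-Reasoning
  4τ≤t : 4 * τ ≤ t
  4τ≤t = ≤-trans (4τ≤2^τ 4≤τ) (≤-reflexive 2^τ≡t)
  4≤t : 4 ≤ t
  4≤t = ≤-trans (≤-trans 4≤τ (m≤m+n τ _)) 4τ≤t
  1≤t : 1 ≤ t
  1≤t = ≤-trans (s≤s z≤n) 4≤t
  lemma : ∀ t → (t + t) * (t * t + t * t) ≡ 4 * (t * (t * t))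
  lemma = solve-∀
  small : suc t * (2 + d) ≤ 2 ^ (4 * τ)
  small = begin
    suc t * (2 + d)              ≡⟨ cong (λ z → suc t * suc z) eq ⟩
    suc t * suc (t * (4 * τ))    ≤⟨ *-mono-≤ (+-monoˡ-≤ t 1≤t) (+-mono-≤ (*-mono-≤ 1≤t 1≤t) (*-monoʳ-≤ t 4τ≤t)) ⟩
    (t + t) * (t * t + t * t)    ≡⟨ lemma t ⟩
    4 * (t * (t * t))            ≤⟨ *-monoˡ-≤ (t * (t * t)) 4≤t ⟩
    t * (t * (t * t))            ≡⟨ cong (λ z → t * (t * (t * z))) (*-identityʳ t) ⟨
    t ^ 4                        ≡⟨ cong (_^ 4) 2^τ≡t ⟨
    (2 ^ τ) ^ 4                  ≡⟨ ^-*-assoc 2 τ 4 ⟩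
    2 ^ (τ * 4)                  ≡⟨ cong (2 ^_) (*-comm τ 4) ⟩
    2 ^ (4 * τ)                  ∎

-- Uses (1 + 1/t)^(2^n) ≤ 4^(2^n / t).
container⇒2^ : ∀ x B n τ t → 4 ≤ τ → 2 ^ τ ≡ t → τ ≤ n →
  x * t ^ (2 ^ n) ≤ 2 ^ B * suc t ^ (2 ^ n) → x ≤ 2 ^ (B + 2 * 2 ^ (n ∸ τ))
container⇒2^ x B n τ@(suc τ′) t 4≤τ 2^τ≡t τ≤n h = *-cancelʳ-≤ x _ (t ^ (2 ^ n)) {{m^n≢0 t (2 ^ n) {{t≢0}}}} (begin
  x * t ^ (2 ^ n)                          ≤⟨ h ⟩
  2 ^ B * suc t ^ (2 ^ n)                  ≡⟨ cong (λ z → 2 ^ B * suc t ^ z) 2^n≡ ⟩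
  2 ^ B * suc t ^ (t * z)                  ≡⟨ cong (2 ^ B *_) (^-*-assoc (suc t) t z) ⟨
  2 ^ B * (suc t ^ t) ^ z                  ≤⟨ *-monoʳ-≤ (2 ^ B) (^-monoˡ-≤ z (subst (λ t → suc t ^ t ≤ 4 * t ^ t) 2^τ≡t ([1+t]^t≤4t^t τ′))) ⟩
  2 ^ B * (4 * t ^ t) ^ z                  ≡⟨ cong (2 ^ B *_) (^-distribʳ-* 4 (t ^ t) z) ⟩
  2 ^ B * (4 ^ z * (t ^ t) ^ z)            ≡⟨ cong (2 ^ B *_) (cong₂ _*_ (^-*-assoc 2 2 z) (^-*-assoc t t z)) ⟩
  2 ^ B * (2 ^ (2 * z) * t ^ (t * z))      ≡⟨ *-assoc (2 ^ B) _ _ ⟨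
  2 ^ B * 2 ^ (2 * z) * t ^ (t * z)        ≡⟨ cong₂ (λ p q → p * t ^ q) (^-distribˡ-+-* 2 B (2 * z)) 2^n≡ ⟨
  2 ^ (B + 2 * z) * t ^ (2 ^ n)            ∎)
  where
  open ≤-Reasoning
  z : ℕ
  z = 2 ^ (n ∸ τ)
  t≢0 : NonZero t
  t≢0 = subst NonZero 2^τ≡t (m^n≢0 2 τ)
  2^n≡ : 2 ^ n ≡ t * z
  2^n≡ = trans (cong (2 ^_) (sym (m+[n∸m]≡n τ≤n))) (trans (^-distribˡ-+-* 2 τ (n ∸ τ)) (cong (_* z) 2^τ≡t))

-- Choice of parameters for the upper bound

≤-/ : ∀ {x y} q .{{_ : NonZero q}} → x * q ≤ y → x ≤ y / q
≤-/ {x} q h = ≤-trans (≤-reflexive (sym (m*n/n≡m x q))) (/-monoˡ-≤ q h)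

-- With p = 2 ^ K, threshold K p * τ ≤ s says 16 b³ d ≤ s² for d = 4τt and t = 32ps.
threshold : ℕ → ℕ → ℕ
threshold K p = 16 * (b * (b * (b * (32 * p * 4))))
  where
  b = 2 + 8 * K

-- Here s ≈ √n, and t, d, R are the parameters of the container and supersaturation bounds.
module UpperBound (n K p s τ t d : ℕ) (1≤n : 1 ≤ n) (1≤K : 1 ≤ K) (K≤p : K ≤ p)
  (K≤τ : K ≤ τ) (4≤τ : 4 ≤ τ) (1≤s : 1 ≤ s)
  (2^τ≡t : 2 ^ τ ≡ t) (t≡ : t ≡ 32 * (p * s)) (d≡ : d ≡ t * (4 * τ))
  (growth : threshold K p * τ ≤ s)
  (lo : s * s ≤ n) (hi : n < 4 * (s * s)) where

  open Families n
  open ≤-Reasoning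

  b R N : ℕ
  b = 2 + 8 * K
  R = n / (4 * b)
  N = n C (n / 2)

  t≢0 : NonZero t
  t≢0 = subst NonZero 2^τ≡t (m^n≢0 2 τ)

  4τ≤d : 4 * τ ≤ d
  4τ≤d = ≤-trans (m≤n*m (4 * τ) t {{t≢0}}) (≤-reflexive (sym d≡))

  1≤d : 1 ≤ d
  1≤d = ≤-trans (≤-trans (≤-trans (s≤s z≤n) 4≤τ) (m≤m+n τ _)) 4τ≤d

  d-small : 4 * (b * (b * d)) * (4 * b) ≤ n
  d-small = begin
    4 * (b * (b * d)) * (4 * b)                   ≡⟨ lemma₁ b d ⟩
    16 * (b * (b * (b * d)))                      ≡⟨ cong (λ z → 16 * (b * (b * (b * z)))) (trans d≡ (cong (_* (4 * τ)) t≡)) ⟩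
    16 * (b * (b * (b * (32 * (p * s) * (4 * τ))))) ≡⟨ lemma₂ b p s τ ⟩
    threshold K p * τ * s                                    ≤⟨ *-monoˡ-≤ s growth ⟩
    s * s                                         ≤⟨ lo ⟩
    n                                             ∎
    where
    lemma₁ : ∀ b d → 4 * (b * (b * d)) * (4 * b) ≡ 16 * (b * (b * (b * d)))
    lemma₁ = solve-∀
    lemma₂ : ∀ b p s τ → 16 * (b * (b * (b * (32 * (p * s) * (4 * τ))))) ≡ 16 * (b * (b * (b * (32 * p * 4)))) * τ * s
    lemma₂ = solve-∀

  d≤R : 4 * (b * (b * d)) ≤ R
  d≤R = ≤-/ (4 * b) d-small

  1≤4bbd : 1 ≤ 4 * (b * (b * d))
  1≤4bbd = *-mono-≤ {1} {4} (s≤s z≤n) (*-mono-≤ {1} {b} (s≤s z≤n) (*-mono-≤ {1} {b} (s≤s z≤n) 1≤d))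

  τ≤n : τ ≤ n
  τ≤n = begin
    τ                                 ≤⟨ m≤m+n τ _ ⟩
    4 * τ                             ≤⟨ 4τ≤d ⟩
    d                                 ≤⟨ ≤-trans (m≤m+n d _) (≤-trans (m≤m+n (b * d) _) (m≤m+n (b * (b * d)) _)) ⟩
    4 * (b * (b * d))                 ≡⟨ *-identityʳ _ ⟨
    4 * (b * (b * d)) * 1             ≤⟨ *-monoʳ-≤ (4 * (b * (b * d))) {1} {4 * b} (s≤s z≤n) ⟩
    4 * (b * (b * d)) * (4 * b)       ≤⟨ d-small ⟩
    n                                 ∎

  central : 2 ^ n ≤ 2 * (4 * s) * N
  central = 2^n≤w*central n (4 * s) 1≤n (≤-trans (s≤s (s≤s z≤n)) (*-monoʳ-≤ 4 1≤s)) (begin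
    4 * n                     ≤⟨ *-monoʳ-≤ 4 (<⇒≤ hi) ⟩
    4 * (4 * (s * s))         ≡⟨ lemma s ⟩
    4 * s * (4 * s)           ∎)
    where
    lemma : ∀ s → 4 * (4 * (s * s)) ≡ 4 * s * (4 * s)
    lemma = solve-∀

  n≤[1+R]4b : n ≤ suc R * (4 * b)
  n≤[1+R]4b = begin
    n                                ≡⟨ m≡m%n+[m/n]*n n (4 * b) ⟩
    n % (4 * b) + R * (4 * b)        ≤⟨ +-monoˡ-≤ (R * (4 * b)) (<⇒≤ (m%n<n n (4 * b))) ⟩
    suc R * (4 * b)                  ∎

  -- Since `R` + 1 ≥ n/(4b), Chebyshev gives `far R` = O(2^n / n). By `central` this is O(s N / n) =
  -- O(N/s), and s outgrows the constant.
  far-small : 4 * K * far R ≤ N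
  far-small = *-cancelˡ-≤ n {{>-nonZero 1≤n}} (*-cancelˡ-≤ n {{>-nonZero 1≤n}} (begin
    n * (n * (4 * K * far R))
      ≤⟨ *-mono-≤ n≤[1+R]4b (*-monoˡ-≤ (4 * K * far R) n≤[1+R]4b) ⟩
    suc R * (4 * b) * (suc R * (4 * b) * (4 * K * far R))
      ≡⟨ lemma₁ (suc R) b K (far R) ⟩
    64 * (b * (b * K)) * (suc R * suc R * far R)
      ≤⟨ *-monoʳ-≤ (64 * (b * (b * K))) (≤-trans (chebyshev n (suc R)) (*-monoʳ-≤ n central)) ⟩
    64 * (b * (b * K)) * (n * (2 * (4 * s) * N))
      ≡⟨ lemma₂ b K n s N ⟩
    -- The constant is 512 b², written in the shape of `threshold` so that the two compare factor by
    -- factor.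
    n * (16 * (b * (b * (1 * (32 * 1 * 1)))) * K * (s * N))
      ≤⟨ *-monoʳ-≤ n (*-monoˡ-≤ (s * N) (≤-trans small growth)) ⟩
    n * (s * (s * N))
      ≡⟨ cong (n *_) (*-assoc s s N) ⟨
    n * (s * s * N)
      ≤⟨ *-monoʳ-≤ n (*-monoˡ-≤ N lo) ⟩
    n * (n * N) ∎))
    where
    lemma₁ : ∀ r b K f → r * (4 * b) * (r * (4 * b) * (4 * K * f)) ≡ 64 * (b * (b * K)) * (r * r * f)
    lemma₁ = solve-∀
    lemma₂ : ∀ b K n s N → 64 * (b * (b * K)) * (n * (2 * (4 * s) * N)) ≡ n * (16 * (b * (b * (1 * (32 * 1 * 1)))) * K * (s * N))
    lemma₂ = solve-∀
    1≤4 : 1 ≤ 4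
    1≤4 = s≤s z≤n
    small : 16 * (b * (b * (1 * (32 * 1 * 1)))) * K ≤ threshold K p * τ
    small = *-mono-≤ {16 * (b * (b * (1 * (32 * 1 * 1))))} {threshold K p} (*-monoʳ-≤ 16 (*-monoʳ-≤ b (*-monoʳ-≤ b (*-mono-≤ {1} {b} (s≤s z≤n) (*-mono-≤ (*-monoʳ-≤ 32 (≤-trans 1≤K K≤p)) 1≤4)))))
                     K≤τ

  instance
    4K≢0 : NonZero (4 * K)
    4K≢0 = >-nonZero (*-mono-≤ {1} {4} (s≤s z≤n) 1≤K)

  -- The error N/K allowed in the exponent is split evenly: N/(2K) goes into `B` and N/(2K) into the
  -- term 2`z`.
  B : ℕ
  B = (4 * K + 2) * N / (4 * K)

  4bR≤n : 4 * (b * R) ≤ n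
  4bR≤n = ≤-trans (≤-reflexive (lemma b R)) (m/n*n≤m n (4 * b))
    where
    lemma : ∀ b R → 4 * (b * R) ≡ R * (4 * b)
    lemma = solve-∀

  all-rich : ∀ {U} → B < ∣ U ∣ → Rich d U
  all-rich B<∣U∣ = large⇒rich K R d 1≤K (≤-trans 1≤4bbd d≤R) 4bR≤n (m≤n⇒m≤1+n d≤R) far-small
    (≰⇒> λ le → <⇒≱ B<∣U∣ (≤-/ (4 * K) le))

  z : ℕ
  z = 2 ^ (n ∸ τ)

  α≤ : α n ≤ 2 ^ (B + 2 * z)
  α≤ = container⇒2^ (α n) B n τ t 4≤τ 2^τ≡t τ≤n
    (α-container t (pred d) B (container-weight τ t (pred d) 4≤τ 2^τ≡t (trans suc-pred-d d≡))
      (λ {U} h → subst (λ e → Rich e U) (sym suc-pred-d) (all-rich h)))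
    where
    suc-pred-d : suc (pred d) ≡ d
    suc-pred-d = suc-pred d {{>-nonZero 1≤d}}

  -- This fixes the 32 in t: 2^n ≤ 8 s N gives 4 K 2^n ≤ 32 K s N ≤ t N.
  z-small : 4 * K * z ≤ N
  z-small = *-cancelˡ-≤ t {{t≢0}} (begin
    t * (4 * K * z)                ≡⟨ lemma₁ t K z ⟩
    4 * K * (t * z)                ≡⟨ cong (4 * K *_) (trans (cong (_* z) (sym 2^τ≡t)) (trans (sym (^-distribˡ-+-* 2 τ (n ∸ τ))) (cong (2 ^_) (m+[n∸m]≡n τ≤n)))) ⟩
    4 * K * 2 ^ n                  ≤⟨ *-monoʳ-≤ (4 * K) central ⟩
    4 * K * (2 * (4 * s) * N)      ≡⟨ lemma₂ K s N ⟩
    32 * (K * s) * N               ≤⟨ *-monoˡ-≤ N (*-monoʳ-≤ 32 (*-monoˡ-≤ s K≤p)) ⟩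
    32 * (p * s) * N               ≡⟨ cong (_* N) t≡ ⟨
    t * N                          ∎)
    where
    lemma₁ : ∀ t K z → t * (4 * K * z) ≡ 4 * K * (t * z)
    lemma₁ = solve-∀
    lemma₂ : ∀ K s N → 4 * K * (2 * (4 * s) * N) ≡ 32 * (K * s) * N
    lemma₂ = solve-∀

  exponent : (B + 2 * z) * K ≤ suc K * N
  exponent = *-cancelˡ-≤ 4 (begin
    4 * ((B + 2 * z) * K)              ≡⟨ lemma₁ B z K ⟩
    B * (4 * K) + 2 * (4 * K * z)      ≤⟨ +-mono-≤ (m/n*n≤m ((4 * K + 2) * N) (4 * K)) (*-monoʳ-≤ 2 z-small) ⟩
    (4 * K + 2) * N + 2 * N            ≡⟨ lemma₂ K N ⟩
    4 * (suc K * N)                    ∎)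
    where
    lemma₁ : ∀ B z K → 4 * ((B + 2 * z) * K) ≡ B * (4 * K) + 2 * (4 * K * z)
    lemma₁ = solve-∀
    lemma₂ : ∀ K N → (4 * K + 2) * N + 2 * N ≡ 4 * ((1 + K) * N)
    lemma₂ = solve-∀

  α^K≤ : α n ^ K ≤ 2 ^ (suc K * N)
  α^K≤ = begin
    α n ^ K                        ≤⟨ ^-monoˡ-≤ K α≤ ⟩
    (2 ^ (B + 2 * z)) ^ K          ≡⟨ ^-*-assoc 2 (B + 2 * z) K ⟩
    2 ^ ((B + 2 * z) * K)          ≤⟨ ^-monoʳ-≤ 2 exponent ⟩
    2 ^ (suc K * N)                ∎

-- Using 2^K in place of K in t = 32ps makes t a power of two.
2^-split : ∀ σ K → 2 ^ (σ + (5 + K)) ≡ 32 * (2 ^ K * 2 ^ σ)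
2^-split σ K = trans (^-distribˡ-+-* 2 σ (5 + K)) (trans (cong (2 ^ σ *_) (^-distribˡ-+-* 2 5 K)) (rearrange (2 ^ σ) (2 ^ 5) (2 ^ K)))
  where
  rearrange : ∀ x y z → x * (y * z) ≡ y * (z * x)
  rearrange = solve-∀

α-upper : ∀ K → 1 ≤ K → ∃ λ M → ∀ n → M ≤ n → 1 ≤ n → α n ^ K ≤ 2 ^ (suc K * (n C (n / 2)))
α-upper K 1≤K = from-growth (exponential-growth (threshold K (2 ^ K)) (5 + K))
  where
  open ≤-Reasoning
  Bound : ℕ → Set
  Bound n = α n ^ K ≤ 2 ^ (suc K * (n C (n / 2)))
  double : ∀ x → 4 * (x * x) ≡ 2 * x * (2 * x)
  double = solve-∀
  σ₀≤σ : ∀ {σ₀ σ n} → 2 ^ σ₀ * 2 ^ σ₀ ≤ n → n < 4 * (2 ^ σ * 2 ^ σ) → σ₀ ≤ σ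
  σ₀≤σ {σ₀} {σ} {n} M≤n hi = ≮⇒≥ λ σ<σ₀ → <-irrefl refl (begin
    suc n                          ≤⟨ hi ⟩
    4 * (2 ^ σ * 2 ^ σ)            ≡⟨ double (2 ^ σ) ⟩
    2 ^ suc σ * 2 ^ suc σ          ≤⟨ *-mono-≤ (^-monoʳ-≤ 2 σ<σ₀) (^-monoʳ-≤ 2 σ<σ₀) ⟩
    2 ^ σ₀ * 2 ^ σ₀                ≤⟨ M≤n ⟩
    n                              ∎)
  from-growth : (∃ λ σ₀ → ∀ σ → σ₀ ≤ σ → threshold K (2 ^ K) * (σ + (5 + K)) ≤ 2 ^ σ) →
    ∃ λ M → ∀ n → M ≤ n → 1 ≤ n → Bound n
  from-growth (σ₀ , growth) = 2 ^ σ₀ * 2 ^ σ₀ , λ n M≤n 1≤n → from-log n M≤n 1≤n (log₄ n 1≤n)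
    where
    from-log : ∀ n → 2 ^ σ₀ * 2 ^ σ₀ ≤ n → 1 ≤ n →
      (∃ λ σ → 2 ^ σ * 2 ^ σ ≤ n × n < 4 * (2 ^ σ * 2 ^ σ)) → Bound n
    from-log n M≤n 1≤n (σ , lo , hi) =
      UpperBound.α^K≤ n K (2 ^ K) (2 ^ σ) τ (2 ^ τ) (2 ^ τ * (4 * τ)) 1≤n 1≤K (<⇒≤ (n<2^n K))
        (≤-trans (m≤n+m K 5) (m≤n+m (5 + K) σ)) (≤-trans (m≤m+n 4 (suc K)) (≤-trans (≤-reflexive (+-suc 4 K)) (m≤n+m (5 + K) σ)))
        (m^n>0 2 σ) refl (2^-split σ K) refl (growth σ (σ₀≤σ M≤n hi)) lo hi
      where
      τ : ℕ
      τ = σ + (5 + K)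

-- The asymptotic statement without real numbers: with ε = 1/(k + 1), taking (k + 1)-st roots leaves
-- the exponents (1 - ε) C(n, n/2) and (1 + ε) C(n, n/2).
theorem3 : (k : ℕ) → ∃ λ N → (n : ℕ) → N ≤ n → 1 ≤ n →
    (2 ^ (k * (n C (n / 2))) ≤ α n ^ suc k)
    × (α n ^ suc k ≤ 2 ^ (suc (suc k) * (n C (n / 2))))
theorem3 k = proj₁ upper , λ n M≤n 1≤n → lower n , proj₂ upper n M≤n 1≤n
  where
  upper : ∃ λ M → ∀ n → M ≤ n → 1 ≤ n → α n ^ suc k ≤ 2 ^ (suc (suc k) * (n C (n / 2)))
  upper = α-upper (suc k) (s≤s z≤n)
  open ≤-Reasoning
  lower : ∀ n → 2 ^ (k * (n C (n / 2))) ≤ α n ^ suc k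
  lower n = begin
    2 ^ (k * (n C (n / 2)))          ≤⟨ ^-monoʳ-≤ 2 (*-monoˡ-≤ (n C (n / 2)) (n≤1+n k)) ⟩
    2 ^ (suc k * (n C (n / 2)))      ≡⟨ cong (2 ^_) (*-comm (suc k) (n C (n / 2))) ⟩
    2 ^ ((n C (n / 2)) * suc k)      ≡⟨ ^-*-assoc 2 (n C (n / 2)) (suc k) ⟨
    (2 ^ (n C (n / 2))) ^ suc k      ≤⟨ ^-monoˡ-≤ (suc k) (2^central≤α n) ⟩
    α n ^ suc k                      ∎
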